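{- For every prime $p$ there exist positive constants $c_p$ and $X_0$ such that for all $X \ge X_0$, the number of positive integers $n \le X$ that are $p$-practical but not $\lambda$-practical is at least $c_p \frac{X}{\log X}$.
   Context: For a prime $p$, a positive integer $n$ is $p$-practical if the polynomial $x^n-1$ has a divisor in $\mathbb{F}_p[x]$ of every degree $1,2,\dots,n$. A positive integer $n$ is $\lambda$-practical if it is $p$-practical for every prime $p$. -}

module Defs where

open import Data.Nat using (ℕ; zero; suc; _+_; _*_; _∸_; _≤_; _<_)
open import Data.Nat.Divisibility using (_∣_)
open import Data.Nat.Primality using (Prime)
open import Data.List using (List; []; _∷_; map; upTo)
open import Data.Nat.ListAction using (sum)
open import Data.Product using (Σ; ∃; _×_)
open import Relation.Nullary using (¬_)
open import Relation.Binary.PropositionalEquality using (_≡_)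

_≡_[mod_] : ℕ → ℕ → ℕ → Set
a ≡ b [mod p ] = Σ ℕ λ k → Σ ℕ λ l → a + k * p ≡ b + l * p

-- Polynomials over F_p represented by coefficient lists (constant term first),
-- coefficients being natural numbers read modulo p.
Poly : Set
Poly = List ℕ

coeff : Poly → ℕ → ℕ
coeff []       _       = 0
coeff (a ∷ f)  zero    = a
coeff (a ∷ f)  (suc k) = coeff f k

mulCoeff : Poly → Poly → ℕ → ℕ
mulCoeff f g k = sum (map (λ i → coeff f i * coeff g (k ∸ i)) (upTo (suc k)))

δ : ℕ → ℕ → ℕ
δ zero    zero    = 1
δ zero    (suc _) = 0
δ (suc _) zero    = 0
δ (suc m) (suc n) = δ m n

HasDegree : ℕ → Poly → ℕ → Set
HasDegree p g d = (¬ (p ∣ coeff g d)) × (∀ k → d < k → p ∣ coeff g k)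

-- g divides x^n - 1 in F_p[x]: there is h with g * h = x^n - 1 over F_p,
-- written coefficientwise as (g*h)_k + δ_{k,0} ≡ δ_{k,n} (mod p).
DividesXn-1 : ℕ → ℕ → Poly → Set
DividesXn-1 p n g = Σ Poly λ h → ∀ k → (mulCoeff g h k + δ k 0) ≡ δ k n [mod p ]

PPractical : ℕ → ℕ → Set
PPractical p n = ∀ d → 1 ≤ d → d ≤ n → Σ Poly λ g → HasDegree p g d × DividesXn-1 p n g

LambdaPractical : ℕ → Set
LambdaPractical n = ∀ q → Prime q → PPractical q n

{-# OPTIONS --safe #-}
module Submission where

open import Defs
open import Algebra.Bundles using (CommutativeRing)
import Algebra.Properties.CommutativeSemiring.Binomial as Binomial
import Algebra.Properties.Group as GroupProperties
import Algebra.Properties.Semiring.Exp as Exp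
import Algebra.Properties.Semiring.Mult as Mult
import Algebra.Properties.Semiring.Sum as SemiringSum
open import Data.Bool using (Bool; true; false; _∧_; _∨_; not) renaming (T to True)
open import Data.Bool.Properties using (T-∧; T-∨)
open import Data.Empty using (⊥; ⊥-elim)
open import Data.Fin using (Fin; toℕ; fromℕ; fromℕ<; inject₁) renaming (zero to fzero; suc to fsuc)
import Data.Fin.Properties as Fin
open import Data.List using (List; []; _∷_; _++_; map; concatMap; length; drop; foldl; applyUpTo; deduplicate)
open import Data.List.Membership.Propositional using (_∈_)
open import Data.List.Membership.Propositional.Properties using (∈-deduplicate⁺; ∈-deduplicate⁻)
open import Data.List.Properties using (length-++; length-map; map-applyUpTo)
open import Data.List.Relation.Unary.All using (All; []; _∷_)
import Data.List.Relation.Unary.All as All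
open import Data.List.Relation.Unary.Any using (here; there)
open import Data.List.Relation.Unary.Unique.Propositional using (Unique)
open import Data.Maybe using (nothing)
open import Data.Nat
open import Data.Nat.Combinatorics using (nCn≡1; k![n∸k]!∣n!) renaming (_C_ to _choose_)
open import Data.Nat.Combinatorics.Specification using (nCk≡n!/k![n-k]!)
open import Data.Nat.Coprimality using (Coprime; coprime-Bézout; coprime-divisor; prime⇒coprime) renaming (sym to coprime-sym)
open import Data.Nat.Divisibility
open import Data.Nat.DivMod hiding (result)
open import Data.Nat.GCD using (module Bézout; gcd; gcd-GCD; gcd-greatest; gcd[m,n]∣m; gcd[m,n]∣n; gcd[m,n]≢0; c*gcd[m,n]≡gcd[cm,cn])
open import Data.Nat.ListAction using (sum; product)
open import Data.Nat.Logarithm using (⌊log₂_⌋; ⌊log₂⌋-mono-≤; ⌊log₂[2^n]⌋≡n)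
open import Data.Nat.Primality
open import Data.Nat.Primality.Factorisation using (factorise)
open import Data.Nat.Properties
open import Data.List.Relation.Unary.Unique.DecPropositional.Properties _≟_ using (deduplicate-!)
open import Data.Nat.Tactic.RingSolver using (solve-∀)
open import Data.Product using (Σ; ∃; ∃₂; _×_; _,_; proj₁; proj₂)
open import Data.Sum using (_⊎_; inj₁; inj₂; [_,_]′)
open import Data.Unit using (tt)
open import Function using (_∘_; id)
open import Function.Bundles using (Equivalence)
open import Level using (0ℓ)
open import Relation.Binary using (IsEquivalence)
open import Relation.Binary.PropositionalEquality hiding (J)
import Relation.Binary.Reasoning.Setoid as SetoidR
open import Relation.Nullary using (¬_; Dec; yes; no; contradiction)
open import Relation.Nullary.Decidable using (_→-dec_; from-yes; from-no; isYes; toWitness; toWitnessFalse)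
open import Tactic.RingSolver.Core.AlmostCommutativeRing using (AlmostCommutativeRing; fromCommutativeRing)
import Tactic.RingSolver as RS

-- Over F_p, if x^N - 1 has divisors of all degrees and q ≤ N + 2 is coprime to N, then so has x^(Nq) - 1.  Given
-- G H = x^N - 1, counting residues modulo G and H yields f and g with deg f ≤ deg G and deg g ≤ deg H such that
-- G divides f(x^q') and H divides g(x^q'), where q q' ≡ 1 mod N.  Then x^N - 1 divides f g, so f g is a constant
-- multiple of it, f divides G(x^q) and the quotient is a divisor of (x^(Nq) - 1) / (x^N - 1) of degree
-- (q - 1) deg G.  Every number reached from a p-practical seed n₀ by multiplying with new primes not exceeding the
-- current product is therefore p-practical.  The seeds are p^k for p ≥ 3 and a multiple of 14 for p = 2; they are
-- chosen so that gcd (n, E) stays fixed and excludes divisors of degree 2 or 4 over F_2, or 3 over F_3.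
--
-- It remains to count such numbers.  Include each prime q ≤ Y independently with probability 1 / (q + 1).  The
-- logarithm of the product of the chosen primes below z minus Σ log q / (q + 1) is a martingale, and by Mertens'
-- lower bound Σ log q / (q - 1) ≥ log z - O(1) it is nonpositive as soon as a prime exceeds the current product.
-- As the product overshoots Y at most by a square, optional stopping shows that it reaches Y with probability at
-- least c / log Y; Euler's product turns this into a lower bound for the sum of 1 / m over the products m.
-- Further primes bring m to a fixed range of powers of Y, and the number of choices of one last prime q ≤ X / m is
-- at least c X / (m log X) by Chebyshev's bound.  Each n arises boundedly often.

-- Polynomials over F_p

-- Counting residues takes the place of a factorisation into irreducibles: degrees alone force
-- `f ⊛ g` to be a constant multiple of x^N - 1. The probability 1 / (q + 1) is the one for which
-- inclusion and omission of q have ratio 1 / q. A product n₀ q₁ ... q_k then has probability Π q /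
-- (q + 1), over all primes considered, divided by q₁ ... q_k. Expectations over the tree are
-- therefore sums of 1 / m, the very weight with which m enters the final count X / (m log X). The
-- analysis runs in ℕ. Reciprocals are multiplied by a common multiple D, `ρ k` being D / k.
-- Logarithms are the rounded values `ℓ n` of Y log₂ n, a scale so fine that rounding once for each
-- prime up to Y costs at most one unit of the logarithm. Inequalities between expectations are
-- multiplied by Π (q + 1), and negative terms move to the other side. The seed must be large
-- because the compensated logarithm has to start above Mertens' constant and the contribution of
-- the primes up to P₀, which are never chosen.

conv : (ℕ → ℕ) → (ℕ → ℕ) → ℕ → ℕ
conv f g zero    = f 0 * g 0
conv f g (suc k) = f 0 * g (suc k) + conv (f ∘ suc) g k

conv-cong : ∀ {f f′ g g′} → (∀ k → f k ≡ f′ k) → (∀ k → g k ≡ g′ k) → ∀ k → conv f g k ≡ conv f′ g′ k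
conv-cong e e′ zero    = cong₂ _*_ (e 0) (e′ 0)
conv-cong e e′ (suc k) = cong₂ _+_ (cong₂ _*_ (e 0) (e′ (suc k))) (conv-cong (e ∘ suc) e′ k)

-- The recursion of `conv` peels off the constant term of the first factor; peeling off that of the
-- second as well is what makes commutativity an induction.
conv-sucʳ : ∀ f g k → conv f g (suc k) ≡ conv f (g ∘ suc) k + f (suc k) * g 0
conv-sucʳ f g zero    = refl
conv-sucʳ f g (suc k) = trans (cong (f 0 * g (suc (suc k)) +_) (conv-sucʳ (f ∘ suc) g k))
  (sym (+-assoc (f 0 * g (suc (suc k))) _ _))

conv-comm : ∀ f g k → conv f g k ≡ conv g f k
conv-comm f g zero    = *-comm (f 0) (g 0)
conv-comm f g (suc k) = trans (conv-sucʳ f g k)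
  (trans (+-comm (conv f (g ∘ suc) k) _) (cong₂ _+_ (*-comm (f (suc k)) (g 0)) (conv-comm f (g ∘ suc) k)))

conv-distribʳ : ∀ f g h k → conv (λ i → f i + g i) h k ≡ conv f h k + conv g h k
conv-distribʳ f g h zero    = *-distribʳ-+ (h 0) (f 0) (g 0)
conv-distribʳ f g h (suc k) rewrite conv-distribʳ (f ∘ suc) (g ∘ suc) h k =
  lem (f 0) (g 0) (h (suc k)) (conv (f ∘ suc) h k) (conv (g ∘ suc) h k)
  where
  lem : ∀ a b c d e → (a + b) * c + (d + e) ≡ a * c + d + (b * c + e)
  lem = solve-∀

conv-scale : ∀ a f g k → conv (λ i → a * f i) g k ≡ a * conv f g k
conv-scale a f g zero    = *-assoc a (f 0) (g 0)
conv-scale a f g (suc k) rewrite conv-scale a (f ∘ suc) g k =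
  lem a (f 0) (g (suc k)) (conv (f ∘ suc) g k)
  where
  lem : ∀ a b c d → a * b * c + a * d ≡ a * (b * c + d)
  lem = solve-∀

conv-zeroˡ : ∀ g k → conv (λ _ → 0) g k ≡ 0
conv-zeroˡ g zero    = refl
conv-zeroˡ g (suc k) = conv-zeroˡ g k

conv-assoc : ∀ f g h k → conv (conv f g) h k ≡ conv f (conv g h) k
conv-assoc f g h zero    = *-assoc (f 0) (g 0) (h 0)
conv-assoc f g h (suc k) = begin
  f 0 * g 0 * h (suc k) + conv (λ i → f 0 * g (suc i) + conv (f ∘ suc) g i) h k
    ≡⟨ cong (f 0 * g 0 * h (suc k) +_) (conv-distribʳ (λ i → f 0 * g (suc i)) (conv (f ∘ suc) g) h k) ⟩
  f 0 * g 0 * h (suc k) + (conv (λ i → f 0 * g (suc i)) h k + conv (conv (f ∘ suc) g) h k)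
    ≡⟨ cong (f 0 * g 0 * h (suc k) +_) (cong₂ _+_ (conv-scale (f 0) (g ∘ suc) h k) (conv-assoc (f ∘ suc) g h k)) ⟩
  f 0 * g 0 * h (suc k) + (f 0 * conv (g ∘ suc) h k + conv (f ∘ suc) (conv g h) k)
    ≡⟨ lem (f 0) (g 0) (h (suc k)) _ _ ⟩
  f 0 * (g 0 * h (suc k) + conv (g ∘ suc) h k) + conv (f ∘ suc) (conv g h) k ∎
  where
  open ≡-Reasoning
  lem : ∀ a b c d e → a * b * c + (a * d + e) ≡ a * (b * c + d) + e
  lem = solve-∀

-- The truncated subtraction in `mulCoeff` is met only here; everything else is proved for `conv` by
-- structural recursion.
mulCoeff≡conv : ∀ f g k → mulCoeff f g k ≡ conv (coeff f) (coeff g) k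
mulCoeff≡conv f g k = trans (cong sum (map-applyUpTo (λ i → i) (λ i → coeff f i * coeff g (k ∸ i)) (suc k)))
    (go (coeff f) (coeff g) k)
  where
  go : ∀ f g k → sum (applyUpTo (λ i → f i * g (k ∸ i)) (suc k)) ≡ conv f g k
  go f g zero    = +-identityʳ (f 0 * g 0)
  go f g (suc k) = cong (f 0 * g (suc k) +_) (go (f ∘ suc) g k)

infixl 6 _⊕_
infixl 7 _⊛_ _⊙_

_⊕_ : Poly → Poly → Poly
[]      ⊕ g       = g
(a ∷ f) ⊕ []      = a ∷ f
(a ∷ f) ⊕ (b ∷ g) = a + b ∷ f ⊕ g

_⊙_ : ℕ → Poly → Poly
a ⊙ f = map (a *_) f

_⊛_ : Poly → Poly → Poly
[]      ⊛ g = []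
(a ∷ f) ⊛ g = a ⊙ g ⊕ (0 ∷ f ⊛ g)

coeff-⊕ : ∀ f g k → coeff (f ⊕ g) k ≡ coeff f k + coeff g k
coeff-⊕ []      g       k       = refl
coeff-⊕ (a ∷ f) []      k       = sym (+-identityʳ _)
coeff-⊕ (a ∷ f) (b ∷ g) zero    = refl
coeff-⊕ (a ∷ f) (b ∷ g) (suc k) = coeff-⊕ f g k

coeff-⊙ : ∀ a f k → coeff (a ⊙ f) k ≡ a * coeff f k
coeff-⊙ a []      k       = sym (*-zeroʳ a)
coeff-⊙ a (b ∷ f) zero    = refl
coeff-⊙ a (b ∷ f) (suc k) = coeff-⊙ a f k

coeff-⊛ : ∀ f g k → coeff (f ⊛ g) k ≡ conv (coeff f) (coeff g) k
coeff-⊛ []      g k       = sym (conv-zeroˡ (coeff g) k)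
coeff-⊛ (a ∷ f) g zero    = trans (coeff-⊕ (a ⊙ g) (0 ∷ f ⊛ g) 0) (trans (+-identityʳ _) (coeff-⊙ a g 0))
coeff-⊛ (a ∷ f) g (suc k) = trans (coeff-⊕ (a ⊙ g) (0 ∷ f ⊛ g) (suc k)) (cong₂ _+_ (coeff-⊙ a g (suc k)) (coeff-⊛ f g k))

xp : ℕ → Poly
xp zero    = 1 ∷ []
xp (suc n) = 0 ∷ xp n

coeff-xp : ∀ n k → coeff (xp n) k ≡ δ k n
coeff-xp zero    zero    = refl
coeff-xp zero    (suc k) = refl
coeff-xp (suc n) zero    = refl
coeff-xp (suc n) (suc k) = coeff-xp n k

-- Congruences modulo p and the ring F_p[x]

module Mod (p : ℕ) .{{_ : NonZero p}} where

  infix 4 _~_ _≈_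

  record _~_ (a b : ℕ) : Set where
    constructor mk
    field
      k l : ℕ
      eq  : a + k * p ≡ b + l * p

  ~-reflexive : ∀ {a b} → a ≡ b → a ~ b
  ~-reflexive e = mk 0 0 (cong (_+ 0) e)

  ~-refl : ∀ {a} → a ~ a
  ~-refl = ~-reflexive refl

  ~-sym : ∀ {a b} → a ~ b → b ~ a
  ~-sym (mk k l e) = mk l k (sym e)

  ~-trans : ∀ {a b c} → a ~ b → b ~ c → a ~ c
  ~-trans {a} {b} {c} (mk k l e) (mk k′ l′ e′) = mk (k + k′) (l + l′) (begin
    a + (k + k′) * p  ≡⟨ lem a k k′ p ⟩
    (a + k * p) + k′ * p  ≡⟨ cong (_+ k′ * p) e ⟩
    (b + l * p) + k′ * p  ≡⟨ lem₂ b l k′ p ⟩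
    (b + k′ * p) + l * p  ≡⟨ cong (_+ l * p) e′ ⟩
    (c + l′ * p) + l * p  ≡⟨ lem₃ c l′ l p ⟩
    c + (l + l′) * p ∎)
    where
    open ≡-Reasoning
    lem : ∀ a k k′ p → a + (k + k′) * p ≡ (a + k * p) + k′ * p
    lem = solve-∀
    lem₂ : ∀ b l k p → (b + l * p) + k * p ≡ (b + k * p) + l * p
    lem₂ = solve-∀
    lem₃ : ∀ c k l p → (c + k * p) + l * p ≡ c + (l + k) * p
    lem₃ = solve-∀

  ~-+ : ∀ {a b c d} → a ~ b → c ~ d → a + c ~ b + d
  ~-+ {a} {b} {c} {d} (mk k l e) (mk k′ l′ e′) = mk (k + k′) (l + l′)
    (trans (lem a c k k′ p) (trans (cong₂ _+_ e e′) (sym (lem b d l l′ p))))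
    where
    lem : ∀ a c k k′ p → a + c + (k + k′) * p ≡ (a + k * p) + (c + k′ * p)
    lem = solve-∀

  ~-*ˡ : ∀ a {c d} → c ~ d → a * c ~ a * d
  ~-*ˡ a {c} {d} (mk k l e) = mk (a * k) (a * l) (trans (lem a c k p) (trans (cong (a *_) e) (sym (lem a d l p))))
    where
    lem : ∀ a c k p → a * c + a * k * p ≡ a * (c + k * p)
    lem = solve-∀

  ~-* : ∀ {a b c d} → a ~ b → c ~ d → a * c ~ b * d
  ~-* {a} {b} {c} {d} e e′ = ~-trans (~-*ˡ a e′)
    (~-trans (~-reflexive (*-comm a d)) (~-trans (~-*ˡ d e) (~-reflexive (*-comm d b))))

  ∣⇒~0 : ∀ {a} → p ∣ a → a ~ 0
  ∣⇒~0 {a} (divides q e) = mk 0 q (trans (+-identityʳ a) e)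

  ~0⇒∣ : ∀ {a} → a ~ 0 → p ∣ a
  ~0⇒∣ {a} (mk k l e) = ∣m+n∣m⇒∣n (divides l (trans (+-comm (k * p) a) e)) (divides k refl)

  ~⇒% : ∀ {a b} → a ~ b → a % p ≡ b % p
  ~⇒% {a} {b} (mk k l e) = trans (sym ([m+kn]%n≡m%n a k p)) (trans (cong (_% p) e) ([m+kn]%n≡m%n b l p))

  %⇒~ : ∀ {a b} → a % p ≡ b % p → a ~ b
  %⇒~ {a} {b} e = mk (b / p) (a / p) (begin
    a + b / p * p  ≡⟨ cong (_+ b / p * p) (m≡m%n+[m/n]*n a p) ⟩
    a % p + a / p * p + b / p * p  ≡⟨ cong (λ z → z + a / p * p + b / p * p) e ⟩
    b % p + a / p * p + b / p * p  ≡⟨ lem (b % p) (a / p * p) (b / p * p) ⟩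
    b % p + b / p * p + a / p * p  ≡⟨ cong (_+ a / p * p) (sym (m≡m%n+[m/n]*n b p)) ⟩
    b + a / p * p ∎)
    where
    open ≡-Reasoning
    lem : ∀ a b c → a + b + c ≡ a + c + b
    lem = solve-∀

  a%p~a : ∀ a → a % p ~ a
  a%p~a a = %⇒~ (m%n%n≡m%n a p)

  ~-neg : ∀ a → (p ∸ 1) * a + a ~ 0
  ~-neg a = mk 0 a (trans (+-identityʳ _) (trans (lem (p ∸ 1) a) (cong (a *_) (m+[n∸m]≡n (>-nonZero⁻¹ p)))))
    where
    lem : ∀ q a → q * a + a ≡ a * (1 + q)
    lem = solve-∀

  conv-~ : ∀ {f f′ g g′} → (∀ k → f k ~ f′ k) → (∀ k → g k ~ g′ k) → ∀ k → conv f g k ~ conv f′ g′ k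
  conv-~ e e′ zero    = ~-* (e 0) (e′ 0)
  conv-~ e e′ (suc k) = ~-+ (~-* (e 0) (e′ (suc k))) (conv-~ (e ∘ suc) e′ k)

  -- Coefficient lists are never normalised. Trailing multiples of p are ignored, so the degree will
  -- be a relation, `HasDeg`, and not a function.
  record _≈_ (f g : Poly) : Set where
    constructor ptw
    field _at_ : ∀ k → coeff f k ~ coeff g k
  open _≈_ public

  ≐⇒≈ : ∀ {f g} → (∀ k → coeff f k ≡ coeff g k) → f ≈ g
  ≐⇒≈ e = ptw λ k → ~-reflexive (e k)

  ≈-isEquivalence : IsEquivalence _≈_
  ≈-isEquivalence = record
    { refl  = ptw λ _ → ~-refl
    ; sym   = λ e → ptw λ k → ~-sym (e at k)
    ; trans = λ e e′ → ptw λ k → ~-trans (e at k) (e′ at k)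
    }

  via : ∀ {f g} {f′ g′ : ℕ → ℕ} → (∀ k → coeff f k ≡ f′ k) → (∀ k → coeff g k ≡ g′ k) → (∀ k → f′ k ~ g′ k) → f ≈ g
  via a b e = ptw λ k → ~-trans (~-reflexive (a k)) (~-trans (e k) (~-reflexive (sym (b k))))

  ⊕-cong : ∀ {f f′ g g′} → f ≈ f′ → g ≈ g′ → f ⊕ g ≈ f′ ⊕ g′
  ⊕-cong {f} {f′} {g} {g′} e e′ = via (coeff-⊕ f g) (coeff-⊕ f′ g′) λ k → ~-+ (e at k) (e′ at k)

  ⊛-cong : ∀ {f f′ g g′} → f ≈ f′ → g ≈ g′ → f ⊛ g ≈ f′ ⊛ g′
  ⊛-cong {f} {f′} {g} {g′} e e′ = via (coeff-⊛ f g) (coeff-⊛ f′ g′) (conv-~ (e at_) (e′ at_))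

  neg : Poly → Poly
  neg f = (p ∸ 1) ⊙ f

  private
    ⊛-comm : ∀ f g k → coeff (f ⊛ g) k ≡ coeff (g ⊛ f) k
    ⊛-comm f g k = trans (coeff-⊛ f g k) (trans (conv-comm (coeff f) (coeff g) k) (sym (coeff-⊛ g f k)))

    ⊛-assoc : ∀ f g h k → coeff (f ⊛ g ⊛ h) k ≡ coeff (f ⊛ (g ⊛ h)) k
    ⊛-assoc f g h k = trans (coeff-⊛ (f ⊛ g) h k)
      (trans (conv-cong (coeff-⊛ f g) (λ _ → refl) k)
      (trans (conv-assoc (coeff f) (coeff g) (coeff h) k)
      (trans (conv-cong {f = coeff f} (λ _ → refl) (λ k → sym (coeff-⊛ g h k)) k) (sym (coeff-⊛ f (g ⊛ h) k)))))

    ⊛-distribʳ : ∀ h f g k → coeff ((f ⊕ g) ⊛ h) k ≡ coeff (f ⊛ h ⊕ g ⊛ h) k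
    ⊛-distribʳ h f g k = trans (coeff-⊛ (f ⊕ g) h k)
      (trans (conv-cong (coeff-⊕ f g) (λ _ → refl) k)
      (trans (conv-distribʳ (coeff f) (coeff g) (coeff h) k)
      (trans (sym (cong₂ _+_ (coeff-⊛ f h k) (coeff-⊛ g h k))) (sym (coeff-⊕ (f ⊛ h) (g ⊛ h) k)))))

    ⊛-identityˡ : ∀ f k → coeff ((1 ∷ []) ⊛ f) k ≡ coeff f k
    ⊛-identityˡ f k = trans (coeff-⊕ (1 ⊙ f) (0 ∷ []) k) (trans (cong₂ _+_ (trans (coeff-⊙ 1 f k) (*-identityˡ _)) (z k)) (+-identityʳ _))
      where
      z : ∀ k → coeff (0 ∷ []) k ≡ 0
      z zero    = refl
      z (suc k) = refl

    ⊕-assoc : ∀ f g h k → coeff (f ⊕ g ⊕ h) k ≡ coeff (f ⊕ (g ⊕ h)) k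
    ⊕-assoc f g h k = trans (coeff-⊕ (f ⊕ g) h k) (trans (cong (_+ coeff h k) (coeff-⊕ f g k))
      (trans (+-assoc (coeff f k) _ _) (trans (cong (coeff f k +_) (sym (coeff-⊕ g h k))) (sym (coeff-⊕ f (g ⊕ h) k)))))

    ⊕-comm : ∀ f g k → coeff (f ⊕ g) k ≡ coeff (g ⊕ f) k
    ⊕-comm f g k = trans (coeff-⊕ f g k) (trans (+-comm (coeff f k) _) (sym (coeff-⊕ g f k)))

    ⊕-identityʳ : ∀ f k → coeff (f ⊕ []) k ≡ coeff f k
    ⊕-identityʳ f k = trans (coeff-⊕ f [] k) (+-identityʳ _)

    neg-inverseˡ : ∀ f → neg f ⊕ f ≈ []
    neg-inverseˡ f = via (λ k → trans (coeff-⊕ (neg f) f k) (cong (_+ coeff f k) (coeff-⊙ (p ∸ 1) f k))) (λ _ → refl) λ k → ~-neg (coeff f k)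

    neg-cong : ∀ {f g} → f ≈ g → neg f ≈ neg g
    neg-cong {f} {g} e = via (coeff-⊙ (p ∸ 1) f) (coeff-⊙ (p ∸ 1) g) λ k → ~-*ˡ (p ∸ 1) (e at k)

  PolyRing : CommutativeRing 0ℓ 0ℓ
  PolyRing = record
    { Carrier = Poly ; _≈_ = _≈_ ; _+_ = _⊕_ ; _*_ = _⊛_ ; -_ = neg ; 0# = [] ; 1# = 1 ∷ []
    ; isCommutativeRing = record
      { isRing = record
        { +-isAbelianGroup = record
          { isGroup = record
            { isMonoid = record
              { isSemigroup = record
                { isMagma = record { isEquivalence = ≈-isEquivalence ; ∙-cong = ⊕-cong }
                ; assoc = λ f g h → ≐⇒≈ (⊕-assoc f g h) }
              ; identity = (λ f → ≐⇒≈ λ k → refl) , (λ f → ≐⇒≈ (⊕-identityʳ f)) }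
            ; inverse = neg-inverseˡ , (λ f → IsEquivalence.trans ≈-isEquivalence (≐⇒≈ (⊕-comm f (neg f))) (neg-inverseˡ f))
            ; ⁻¹-cong = neg-cong }
          ; comm = λ f g → ≐⇒≈ (⊕-comm f g) }
        ; *-cong = ⊛-cong
        ; *-assoc = λ f g h → ≐⇒≈ (⊛-assoc f g h)
        ; *-identity = (λ f → ≐⇒≈ (⊛-identityˡ f)) , (λ f → ≐⇒≈ λ k → trans (⊛-comm f (1 ∷ []) k) (⊛-identityˡ f k))
        ; distrib = (λ h f g → ≐⇒≈ λ k → trans (⊛-comm h (f ⊕ g) k) (trans (⊛-distribʳ h f g k)
                       (trans (coeff-⊕ (f ⊛ h) (g ⊛ h) k) (trans (cong₂ _+_ (⊛-comm f h k) (⊛-comm g h k)) (sym (coeff-⊕ (h ⊛ f) (h ⊛ g) k))))))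
                  , (λ h f g → ≐⇒≈ (⊛-distribʳ h f g)) }
      ; *-comm = λ f g → ≐⇒≈ (⊛-comm f g) } }

  ring : AlmostCommutativeRing 0ℓ 0ℓ
  ring = fromCommutativeRing PolyRing (λ _ → nothing)

  open CommutativeRing PolyRing public using () renaming
    ( refl to ≈-refl ; sym to ≈-sym ; trans to ≈-trans ; setoid to ≈-setoid
    ; zeroʳ to ⊛-zeroʳ ; +-identityʳ to ⊕-idʳ ; +-identityˡ to ⊕-idˡ
    ; -‿inverseʳ to neg-invʳ ; -‿inverseˡ to neg-invˡ ; *-identityˡ to ⊛-idˡ ; *-identityʳ to ⊛-idʳ )

  -- Ring identities

  ⊕-⊛-interchange : ∀ a b x f g → a ⊕ b ⊕ x ⊛ (f ⊕ g) ≈ (a ⊕ x ⊛ f) ⊕ (b ⊕ x ⊛ g)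
  ⊕-⊛-interchange = RS.solve-∀ ring

  ⊛-pull-scalar : ∀ a b x f → a ⊛ b ⊕ x ⊛ (a ⊛ f) ≈ a ⊛ (b ⊕ x ⊛ f)
  ⊛-pull-scalar = RS.solve-∀ ring

  ⊛-horner : ∀ a x f g → a ⊛ g ⊕ x ⊛ (f ⊛ g) ≈ (a ⊕ x ⊛ f) ⊛ g
  ⊛-horner = RS.solve-∀ ring

  ⊛-distribˡ : ∀ f g h → f ⊛ (g ⊕ h) ≈ f ⊛ g ⊕ f ⊛ h
  ⊛-distribˡ = RS.solve-∀ ring

  divMod-step : ∀ A x Q G R m n → A ⊕ x ⊛ (Q ⊛ G ⊕ R) ⊕ (m ⊛ G ⊕ n) ≈ (x ⊛ Q ⊕ m) ⊛ G ⊕ (A ⊕ x ⊛ R ⊕ n)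
  divMod-step = RS.solve-∀ ring

  kernel-step : ∀ G Q m R n → G ⊛ (Q ⊕ m) ⊕ (n ⊛ G ⊕ R) ≈ (Q ⊕ (m ⊕ n)) ⊛ G ⊕ R
  kernel-step = RS.solve-∀ ring

  power-mod : ∀ A e w → (A ⊕ e) ⊛ (e ⊕ A ⊛ w) ≈ e ⊛ e ⊕ A ⊛ (e ⊕ e ⊛ w ⊕ A ⊛ w)
  power-mod = RS.solve-∀ ring

  horner-mod : ∀ a x A v f u → a ⊕ (x ⊕ A ⊛ v) ⊛ (f ⊕ A ⊛ u) ≈ (a ⊕ x ⊛ f) ⊕ A ⊛ (x ⊛ u ⊕ v ⊛ f ⊕ v ⊛ (A ⊛ u))
  horner-mod = RS.solve-∀ ring

  ⊛-swap₂₃ : ∀ x A w → x ⊛ (A ⊛ w) ≈ A ⊛ (x ⊛ w)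
  ⊛-swap₂₃ = RS.solve-∀ ring

  ⊛-interchange : ∀ a b c d → (a ⊛ b) ⊛ (c ⊛ d) ≈ (a ⊛ c) ⊛ (b ⊛ d)
  ⊛-interchange = RS.solve-∀ ring

  twist-step₁ : ∀ G H u k → (G ⊕ (G ⊛ H) ⊛ u) ⊛ (H ⊛ k) ≈ (G ⊛ H) ⊛ (k ⊕ H ⊛ (u ⊛ k))
  twist-step₁ = RS.solve-∀ ring

  twist-step₂ : ∀ g c S → g ⊛ (c ⊛ S) ≈ c ⊛ (S ⊛ g)
  twist-step₂ = RS.solve-∀ ring

  twist-step₃ : ∀ f g k → (f ⊛ g) ⊛ k ≈ g ⊛ (f ⊛ k)
  twist-step₃ = RS.solve-∀ ring

  twist-step₄ : ∀ c A k → c ⊛ (A ⊛ k) ≈ (A ⊛ c) ⊛ k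
  twist-step₄ = RS.solve-∀ ring

  twist-step₅ : ∀ c S T → (c ⊛ S) ⊛ (c ⊛ T) ≈ c ⊛ (c ⊛ (S ⊛ T))
  twist-step₅ = RS.solve-∀ ring

  cofactor-step : ∀ F k F′ k′ d → (F ⊛ k) ⊛ ((F′ ⊛ k′) ⊛ d) ≈ d ⊛ ((F ⊛ F′) ⊛ (k ⊛ k′))
  cofactor-step = RS.solve-∀ ring

  ⊛-assoc′ : ∀ a b c → (a ⊛ b) ⊛ c ≈ a ⊛ (b ⊛ c)
  ⊛-assoc′ = RS.solve-∀ ring

  ⊛-assoc-distrib : ∀ A f m u → A ⊛ (f ⊕ (m ⊕ u)) ≈ A ⊛ (f ⊕ m) ⊕ A ⊛ u
  ⊛-assoc-distrib = RS.solve-∀ ring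

  ∣-mul : ∀ e g u w → (e ⊕ g ⊛ u) ⊛ (e ⊕ g ⊛ w) ≈ e ⊛ e ⊕ g ⊛ (e ⊛ w ⊕ e ⊛ u ⊕ u ⊛ (g ⊛ w))
  ∣-mul = RS.solve-∀ ring

  ∣-sub : ∀ e g u x → (e ⊕ g ⊛ u) ⊛ x ≈ e ⊛ x ⊕ g ⊛ (u ⊛ x)
  ∣-sub = RS.solve-∀ ring

  ⊛-assoc⁴ : ∀ a b c d → (a ⊛ b) ⊛ (c ⊛ d) ≈ a ⊛ ((b ⊛ c) ⊛ d)
  ⊛-assoc⁴ = RS.solve-∀ ring

-- Substitution of powers of x, and degrees

module Sub (p : ℕ) .{{_ : NonZero p}} where
  open Mod p

  ⊕-congˡ : ∀ {f g h} → g ≈ h → f ⊕ g ≈ f ⊕ h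
  ⊕-congˡ = ⊕-cong ≈-refl
  ⊕-congʳ : ∀ {f g h} → g ≈ h → g ⊕ f ≈ h ⊕ f
  ⊕-congʳ e = ⊕-cong e ≈-refl
  ⊛-congˡ : ∀ {f g h} → g ≈ h → f ⊛ g ≈ f ⊛ h
  ⊛-congˡ {f} = ⊛-cong (≈-refl {f})
  ⊛-congʳ : ∀ {f g h} → g ≈ h → g ⊛ f ≈ h ⊛ f
  ⊛-congʳ {f} e = ⊛-cong e (≈-refl {f})

  DegLt : ℕ → Poly → Set
  DegLt d f = ∀ k → d ≤ k → coeff f k ~ 0

  DegLt-length : ∀ f → DegLt (length f) f
  DegLt-length []      k       _         = ~-refl
  DegLt-length (a ∷ f) (suc k) (s≤s le) = DegLt-length f k le

  0∷-cong : ∀ {f g} → f ≈ g → 0 ∷ f ≈ 0 ∷ g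
  0∷-cong e = ptw λ { zero → ~-refl ; (suc k) → e at k }

  0∷[] : 0 ∷ [] ≈ []
  0∷[] = ptw λ { zero → ~-refl ; (suc k) → ~-refl }

  xp-suc : ∀ m g → xp (suc m) ⊛ g ≈ 0 ∷ xp m ⊛ g
  xp-suc m g = ≐⇒≈ λ k → trans (coeff-⊕ (0 ⊙ g) (0 ∷ xp m ⊛ g) k) (cong (_+ coeff (0 ∷ xp m ⊛ g) k) (coeff-⊙ 0 g k))

  1⊛ : ∀ g → xp 0 ⊛ g ≈ g
  1⊛ = ⊛-idˡ

  xp-+ : ∀ m n → xp (m + n) ≈ xp m ⊛ xp n
  xp-+ zero    n = ≈-sym (1⊛ (xp n))
  xp-+ (suc m) n = ≈-trans (0∷-cong (xp-+ m n)) (≈-sym (xp-suc m (xp n)))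

  coeff-shift : ∀ m g k → coeff (xp m ⊛ g) (m + k) ~ coeff g k
  coeff-shift zero    g k = 1⊛ g at k
  coeff-shift (suc m) g k = ~-trans (xp-suc m g at suc (m + k)) (coeff-shift m g k)

  coeff-shift-< : ∀ m g k → k < m → coeff (xp m ⊛ g) k ~ 0
  coeff-shift-< (suc m) g zero    lt       = xp-suc m g at 0
  coeff-shift-< (suc m) g (suc k) (s≤s lt) = ~-trans (xp-suc m g at suc k) (coeff-shift-< m g k lt)

  ∷-decomp : ∀ a f → a ∷ f ≈ (a ∷ []) ⊕ xp 1 ⊛ f
  ∷-decomp a f = ptw λ
    { zero    → ~-sym (~-trans (~-reflexive (coeff-⊕ (a ∷ []) (xp 1 ⊛ f) 0)) (~-trans (~-+ (~-refl {a}) (coeff-shift-< 1 f 0 (s≤s z≤n))) (~-reflexive (+-identityʳ a))))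
    ; (suc k) → ~-sym (~-trans (~-reflexive (coeff-⊕ (a ∷ []) (xp 1 ⊛ f) (suc k))) (coeff-shift 1 f k)) }

  -- Horner's scheme for f(x^q).
  sub : ℕ → Poly → Poly
  sub q []      = []
  sub q (a ∷ f) = (a ∷ []) ⊕ xp q ⊛ sub q f

  singleton-cong : ∀ {a b} → a ~ b → a ∷ [] ≈ b ∷ []
  singleton-cong e = ptw λ { zero → e ; (suc k) → ~-refl }

  sub-zero : ∀ q f → f ≈ [] → sub q f ≈ []
  sub-zero q []      e = ≈-refl
  sub-zero q (a ∷ f) e = ≈-trans (⊕-cong (≈-trans (singleton-cong (e at 0)) 0∷[])
    (≈-trans (⊛-congˡ {xp q} (sub-zero q f (ptw λ k → e at suc k))) (⊛-zeroʳ (xp q)))) (⊕-idʳ [])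

  sub-cong : ∀ q {f g} → f ≈ g → sub q f ≈ sub q g
  sub-cong q {[]}    {g}     e = ≈-sym (sub-zero q g (≈-sym e))
  sub-cong q {a ∷ f} {[]}    e = sub-zero q (a ∷ f) e
  sub-cong q {a ∷ f} {b ∷ g} e = ⊕-cong (singleton-cong (e at 0)) (⊛-congˡ {xp q} (sub-cong q {f} {g} (ptw λ k → e at suc k)))

  sub-⊕ : ∀ q f g → sub q (f ⊕ g) ≈ sub q f ⊕ sub q g
  sub-⊕ q []      g       = ≈-refl
  sub-⊕ q (a ∷ f) []      = ≈-sym (⊕-idʳ (sub q (a ∷ f)))
  sub-⊕ q (a ∷ f) (b ∷ g) = ≈-trans (⊕-congˡ {(a ∷ []) ⊕ (b ∷ [])} (⊛-congˡ {xp q} (sub-⊕ q f g)))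
    (⊕-⊛-interchange (a ∷ []) (b ∷ []) (xp q) (sub q f) (sub q g))

  sub-⊙ : ∀ q a f → sub q (a ⊙ f) ≈ (a ∷ []) ⊛ sub q f
  sub-⊙ q a []      = ≈-sym (⊛-zeroʳ (a ∷ []))
  sub-⊙ q a (b ∷ f) = ≈-trans (⊕-cong (≐⇒≈ e) (⊛-congˡ {xp q} (sub-⊙ q a f))) (⊛-pull-scalar (a ∷ []) (b ∷ []) (xp q) (sub q f))
    where
    e : ∀ k → coeff (a * b ∷ []) k ≡ coeff ((a ∷ []) ⊛ (b ∷ [])) k
    e zero = sym (+-identityʳ (a * b))
    e (suc k) = refl

  sub-0∷ : ∀ q f → sub q (0 ∷ f) ≈ xp q ⊛ sub q f
  sub-0∷ q f = ≈-trans (⊕-congʳ 0∷[]) (⊕-idˡ (xp q ⊛ sub q f))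

  sub-⊛ : ∀ q f g → sub q (f ⊛ g) ≈ sub q f ⊛ sub q g
  sub-⊛ q []      g = ≈-refl
  sub-⊛ q (a ∷ f) g = ≈-trans (sub-⊕ q (a ⊙ g) (0 ∷ f ⊛ g))
    (≈-trans (⊕-cong (sub-⊙ q a g) (≈-trans (sub-0∷ q (f ⊛ g)) (⊛-congˡ {xp q} (sub-⊛ q f g))))
    (⊛-horner (a ∷ []) (xp q) (sub q f) (sub q g)))

  sub-xp : ∀ q n → sub q (xp n) ≈ xp (n * q)
  sub-xp q zero    = ≈-trans (⊕-congˡ {1 ∷ []} (⊛-zeroʳ (xp q))) (⊕-idʳ (1 ∷ []))
  sub-xp q (suc n) = ≈-trans (sub-0∷ q (xp n)) (≈-trans (⊛-congˡ {xp q} (sub-xp q n)) (≈-sym (xp-+ q (n * q))))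

  sub-const : ∀ q a → sub q (a ∷ []) ≈ a ∷ []
  sub-const q a = ≈-trans (⊕-congˡ {a ∷ []} (⊛-zeroʳ (xp q))) (⊕-idʳ (a ∷ []))

  sub-sub : ∀ q r f → sub q (sub r f) ≈ sub (r * q) f
  sub-sub q r []      = ≈-refl
  sub-sub q r (a ∷ f) = ≈-trans (sub-⊕ q (a ∷ []) (xp r ⊛ sub r f))
    (⊕-cong (sub-const q a) (≈-trans (sub-⊛ q (xp r) (sub r f)) (⊛-cong (sub-xp q r) (sub-sub q r f))))

  coeff-sub : ∀ q .{{_ : NonZero q}} f d → coeff (sub q f) (d * q) ~ coeff f d
  coeff-sub q []      d       = ~-refl
  coeff-sub q (a ∷ f) zero    = ~-trans (~-reflexive (coeff-⊕ (a ∷ []) (xp q ⊛ sub q f) 0))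
    (~-trans (~-+ (~-refl {a}) (coeff-shift-< q (sub q f) 0 (>-nonZero⁻¹ q))) (~-reflexive (+-identityʳ a)))
  coeff-sub (suc q) (a ∷ f) (suc d) = ~-trans (~-reflexive (coeff-⊕ (a ∷ []) (xp (suc q) ⊛ sub (suc q) f) (suc q + d * suc q)))
    (~-trans (coeff-shift (suc q) (sub (suc q) f) (d * suc q)) (coeff-sub (suc q) f d))

  DegLt-sub : ∀ q .{{_ : NonZero q}} f d → DegLt (suc d) f → DegLt (suc (d * q)) (sub q f)
  DegLt-sub q []      d       v k lt = ~-refl
  DegLt-sub q (a ∷ f) zero    v (suc k) lt = ~-trans (~-reflexive (coeff-⊕ (a ∷ []) (xp q ⊛ sub q f) (suc k)))
    (≈-trans (⊛-congˡ {xp q} (sub-zero q f (ptw λ k → v (suc k) (s≤s z≤n)))) (⊛-zeroʳ (xp q)) at suc k)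
  DegLt-sub q (a ∷ f) (suc d) v (suc k) lt = ~-trans (~-reflexive (coeff-⊕ (a ∷ []) (xp q ⊛ sub q f) (suc k)))
    (subst (λ z → coeff (xp q ⊛ sub q f) z ~ 0) (m+[n∸m]≡n le)
      (~-trans (coeff-shift q (sub q f) (suc k ∸ q))
        (DegLt-sub q f d (λ k le → v (suc k) (s≤s le)) (suc k ∸ q)
          (+-cancelˡ-≤ q _ _ (≤-trans (≤-reflexive (+-suc q (d * q))) (≤-trans lt (≤-reflexive (sym (m+[n∸m]≡n le)))))))))
    where
    le : q ≤ suc k
    le = ≤-trans (m≤m+n q (d * q)) (≤-trans (n≤1+n _) lt)

  record HasDeg (f : Poly) (d : ℕ) : Set where
    constructor deg
    field
      lead  : ¬ coeff f d ~ 0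
      above : DegLt (suc d) f
  open HasDeg public

  HasDeg-≈ : ∀ {f g d} → f ≈ g → HasDeg f d → HasDeg g d
  HasDeg-≈ {d = d} e (deg nz v) = deg (λ z → nz (~-trans (e at d) z)) λ k le → ~-trans (~-sym (e at k)) (v k le)

  HasDeg-sub : ∀ q .{{_ : NonZero q}} f d → HasDeg f d → HasDeg (sub q f) (d * q)
  HasDeg-sub q f d (deg nz v) = deg (λ z → nz (~-trans (~-sym (coeff-sub q f d)) z)) (DegLt-sub q f d v)

  HasDeg-unique : ∀ {f a b} → HasDeg f a → HasDeg f b → a ≡ b
  HasDeg-unique {f} {a} {b} (deg nz v) (deg nz′ v′) = ≤-antisym
    (≮⇒≥ λ lt → nz (v′ a lt)) (≮⇒≥ λ lt → nz′ (v b lt))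

  HasDeg-≉0 : ∀ {f d} → HasDeg f d → ¬ f ≈ []
  HasDeg-≉0 {d = d} (deg nz _) e = nz (e at d)

  ~0? : ∀ a → Dec (a ~ 0)
  ~0? a with p ∣? a
  ... | yes d = yes (∣⇒~0 d)
  ... | no ¬d = no (¬d ∘ ~0⇒∣)

  -- A bound for the degree becomes the exact degree by testing coefficients downwards until one is
  -- nonzero modulo p.
  zero-or-deg : ∀ d f → DegLt d f → (f ≈ []) ⊎ (∃ λ a → a < d × HasDeg f a)
  zero-or-deg zero    f v = inj₁ (ptw λ k → v k z≤n)
  zero-or-deg (suc d) f v with ~0? (coeff f d)
  ... | no nz = inj₂ (d , ≤-refl , deg nz v)
  ... | yes z with zero-or-deg d f (λ k le → go k (m≤n⇒m<n∨m≡n le))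
    where
    go : ∀ k → d < k ⊎ d ≡ k → coeff f k ~ 0
    go k (inj₁ lt)   = v k lt
    go k (inj₂ refl) = z
  ...   | inj₁ e = inj₁ e
  ...   | inj₂ (a , lt , h) = inj₂ (a , m<n⇒m<1+n lt , h)

  zero-or-deg′ : ∀ f → (f ≈ []) ⊎ (∃ (HasDeg f))
  zero-or-deg′ f with zero-or-deg (length f) f (DegLt-length f)
  ... | inj₁ e = inj₁ e
  ... | inj₂ (a , _ , h) = inj₂ (a , h)

  HasDeg-1 : 1 < p → HasDeg (1 ∷ []) 0
  HasDeg-1 1<p = deg (λ z → <⇒≱ 1<p (∣⇒≤ (~0⇒∣ z))) λ { (suc k) _ → ~-refl }

  HasDeg-xp : 1 < p → ∀ n → HasDeg (xp n) n
  HasDeg-xp 1<p zero = HasDeg-1 1<p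
  HasDeg-xp 1<p (suc n) with HasDeg-xp 1<p n
  ... | deg nz v = deg nz λ { (suc k) (s≤s le) → v k le }

-- Cancellation and division with remainder

module Domain (p : ℕ) (pr : Prime p) where
  private instance
    p≢0 : NonZero p
    p≢0 = prime⇒nonZero pr
  open Mod p
  open Sub p

  1<p : 1 < p
  1<p = nonTrivial⇒n>1 p {{prime⇒nonTrivial pr}}

  conv-top : ∀ a b f g → (∀ k → a < k → f k ~ 0) → (∀ k → b < k → g k ~ 0) → conv f g (a + b) ~ f a * g b
  conv-top zero    zero    f g vf vg = ~-refl
  conv-top zero    (suc b) f g vf vg = ~-trans
    (~-+ (~-refl {f 0 * g (suc b)}) (~-trans (conv-~ {g = g} (λ k → vf (suc k) (s≤s z≤n)) (λ _ → ~-refl) b) (~-reflexive (conv-zeroˡ g b))))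
    (~-reflexive (+-identityʳ _))
  conv-top (suc a) b f g vf vg = ~-trans
    (~-+ (~-*ˡ (f 0) (vg (suc (a + b)) (s≤s (m≤n+m b a)))) (conv-top a b (f ∘ suc) g (λ k lt → vf (suc k) (s≤s lt)) vg))
    (~-reflexive (cong (_+ f (suc a) * g b) (*-zeroʳ (f 0))))

  conv-above : ∀ a b f g → (∀ k → a < k → f k ~ 0) → (∀ k → b < k → g k ~ 0) → ∀ k → a + b < k → conv f g k ~ 0
  conv-above zero    b f g vf vg (suc k) lt = ~-+ (~-trans (~-*ˡ (f 0) (vg (suc k) lt)) (~-reflexive (*-zeroʳ (f 0))))
    (~-trans (conv-~ {g = g} (λ k → vf (suc k) (s≤s z≤n)) (λ _ → ~-refl) k) (~-reflexive (conv-zeroˡ g k)))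
  conv-above (suc a) b f g vf vg (suc k) (s≤s lt) = ~-+
    (~-trans (~-*ˡ (f 0) (vg (suc k) (≤-trans (s≤s (m≤n+m b a)) (m≤n⇒m≤1+n lt)))) (~-reflexive (*-zeroʳ (f 0))))
    (conv-above a b (f ∘ suc) g (λ k lt → vf (suc k) (s≤s lt)) vg k lt)

  *-nonzero : ∀ {a b} → ¬ a ~ 0 → ¬ b ~ 0 → ¬ a * b ~ 0
  *-nonzero {a} {b} na nb z with euclidsLemma a b pr (~0⇒∣ z)
  ... | inj₁ d = na (∣⇒~0 d)
  ... | inj₂ d = nb (∣⇒~0 d)

  HasDeg-⊛ : ∀ {f g a b} → HasDeg f a → HasDeg g b → HasDeg (f ⊛ g) (a + b)
  HasDeg-⊛ {f} {g} {a} {b} (deg nf vf) (deg ng vg) = deg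
    (λ z → *-nonzero nf ng (~-trans (~-sym (~-trans (~-reflexive (coeff-⊛ f g (a + b))) (conv-top a b (coeff f) (coeff g) vf vg))) z))
    (λ k lt → ~-trans (~-reflexive (coeff-⊛ f g k)) (conv-above a b (coeff f) (coeff g) vf vg k lt))

  no-zero-divisors : ∀ {f g a} → HasDeg f a → f ⊛ g ≈ [] → g ≈ []
  no-zero-divisors {f} {g} hf e with zero-or-deg′ g
  ... | inj₁ z = z
  ... | inj₂ (b , hg) = contradiction e (HasDeg-≉0 (HasDeg-⊛ hf hg))

  ⊛-cancelˡ : ∀ {f g h a} → HasDeg f a → f ⊛ g ≈ f ⊛ h → g ≈ h
  ⊛-cancelˡ {f} {g} {h} hf e = begin
    g  ≈⟨ ⊕-idʳ g ⟨
    g ⊕ []  ≈⟨ ⊕-congˡ {g} (neg-invˡ h) ⟨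
    g ⊕ (neg h ⊕ h)  ≈⟨ CommutativeRing.+-assoc PolyRing g (neg h) h ⟨
    g ⊕ neg h ⊕ h  ≈⟨ ⊕-congʳ (no-zero-divisors hf z) ⟩
    [] ⊕ h  ∎
    where
    open SetoidR ≈-setoid
    z : f ⊛ (g ⊕ neg h) ≈ []
    z = begin
      f ⊛ (g ⊕ neg h)  ≈⟨ ⊛-distribˡ f g (neg h) ⟩
      f ⊛ g ⊕ f ⊛ neg h  ≈⟨ ⊕-congʳ e ⟩
      f ⊛ h ⊕ f ⊛ neg h  ≈⟨ ⊛-distribˡ f h (neg h) ⟨
      f ⊛ (h ⊕ neg h)  ≈⟨ ⊛-congˡ {f} (neg-invʳ h) ⟩
      f ⊛ []  ≈⟨ ⊛-zeroʳ f ⟩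
      []  ∎

  abstract
    inverse : ∀ c → ¬ c ~ 0 → ∃ λ c′ → c * c′ ~ 1
    inverse c nz with coprime-Bézout {c % p} {p} cop
      where
      r≢0 : c % p ≢ 0
      r≢0 e = nz (%⇒~ (trans e (sym (m*n%n≡0 0 p))))
      cop : Coprime (c % p) p
      cop = coprime-sym (prime⇒coprime pr {{≢-nonZero r≢0}} (m%n<n c p))
    ... | Bézout.+- x y e = x , ~-trans (~-trans (~-reflexive (*-comm c x)) (~-*ˡ x (~-sym (a%p~a c)))) (~-trans (~-reflexive (sym e)) (mk 0 y (+-identityʳ _)))
    -- Here x is the inverse of -c, so the inverse of c is -x, written `(p ∸ 1) * x`.
    ... | Bézout.-+ x y e = (p ∸ 1) * x , ~-trans (~-reflexive (lem c (p ∸ 1) x)) (~-trans (~-*ˡ (p ∸ 1) (~-*ˡ x (~-sym (a%p~a c)))) (go (x * (c % p)) (mk 0 y (trans (+-identityʳ _) e))))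
      where
      lem : ∀ c q x → c * (q * x) ≡ q * (x * c)
      lem = solve-∀
      go : ∀ z → 1 + z ~ 0 → (p ∸ 1) * z ~ 1
      go z h = ~-trans (~-sym (~-trans (~-+ (~-refl {(p ∸ 1) * z}) h) (~-reflexive (+-identityʳ _))))
        (~-trans (~-reflexive (lem₂ ((p ∸ 1) * z) z)) (~-+ {1} {1} ~-refl (~-neg z)))
        where
        lem₂ : ∀ a z → a + (1 + z) ≡ 1 + (a + z)
        lem₂ = solve-∀

  module Division (G : Poly) (b : ℕ) (hG : HasDeg G b) where
    c′ : ℕ
    c′ = proj₁ (inverse (coeff G b) (lead hG))

    abstract
      -- If f = Q G + R, then a + x f = (x Q) G + (a + x R). The new remainder has degree at most b,
      -- so one constant multiple of G, chosen to cancel its coefficient at b, is enough.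
      divMod : ∀ f → ∃₂ λ Q R → f ≈ Q ⊛ G ⊕ R × DegLt b R
      divMod []      = [] , [] , ≈-refl , λ _ _ → ~-refl
      divMod (a ∷ f) with divMod f
      ... | Q , R , e , v = (0 ∷ Q) ⊕ m , (a ∷ R) ⊕ neg (m ⊛ G) , eq , vanish
        where
        m : Poly
        m = (coeff (a ∷ R) b * c′) ∷ []
        0∷≈ : ∀ g → 0 ∷ g ≈ xp 1 ⊛ g
        0∷≈ g = ≈-trans (∷-decomp 0 g) (≈-trans (⊕-congʳ 0∷[]) (⊕-idˡ (xp 1 ⊛ g)))
        eq : a ∷ f ≈ ((0 ∷ Q) ⊕ m) ⊛ G ⊕ ((a ∷ R) ⊕ neg (m ⊛ G))
        eq = begin
          a ∷ f ≈⟨ ∷-decomp a f ⟩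
          (a ∷ []) ⊕ xp 1 ⊛ f ≈⟨ ⊕-congˡ {a ∷ []} (⊛-congˡ {xp 1} e) ⟩
          (a ∷ []) ⊕ xp 1 ⊛ (Q ⊛ G ⊕ R) ≈⟨ ⊕-idʳ _ ⟨
          (a ∷ []) ⊕ xp 1 ⊛ (Q ⊛ G ⊕ R) ⊕ [] ≈⟨ ⊕-congˡ {(a ∷ []) ⊕ xp 1 ⊛ (Q ⊛ G ⊕ R)} (neg-invʳ (m ⊛ G)) ⟨
          (a ∷ []) ⊕ xp 1 ⊛ (Q ⊛ G ⊕ R) ⊕ (m ⊛ G ⊕ neg (m ⊛ G)) ≈⟨ divMod-step (a ∷ []) (xp 1) Q G R m (neg (m ⊛ G)) ⟩
          (xp 1 ⊛ Q ⊕ m) ⊛ G ⊕ ((a ∷ []) ⊕ xp 1 ⊛ R ⊕ neg (m ⊛ G))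
            ≈⟨ ⊕-cong (⊛-congʳ {G} (⊕-congʳ (≈-sym (0∷≈ Q)))) (⊕-congʳ (≈-sym (∷-decomp a R))) ⟩
          ((0 ∷ Q) ⊕ m) ⊛ G ⊕ ((a ∷ R) ⊕ neg (m ⊛ G)) ∎
          where open SetoidR ≈-setoid
        mG : ∀ k → coeff (m ⊛ G) k ~ coeff (a ∷ R) b * c′ * coeff G k
        mG k = ~-reflexive (trans (coeff-⊕ ((coeff (a ∷ R) b * c′) ⊙ G) (0 ∷ []) k)
          (trans (cong₂ _+_ (coeff-⊙ (coeff (a ∷ R) b * c′) G k) (z k)) (+-identityʳ _)))
          where
          z : ∀ k → coeff (0 ∷ []) k ≡ 0
          z zero    = refl
          z (suc k) = refl
        coeffs : ∀ k → coeff (a ∷ R) k ~ coeff (m ⊛ G) k → coeff ((a ∷ R) ⊕ neg (m ⊛ G)) k ~ 0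
        coeffs k e = ~-trans (~-reflexive (trans (coeff-⊕ (a ∷ R) (neg (m ⊛ G)) k) (cong (coeff (a ∷ R) k +_) (coeff-⊙ (p ∸ 1) (m ⊛ G) k))))
          (~-trans (~-+ e ~-refl) (~-trans (~-reflexive (+-comm (coeff (m ⊛ G) k) _)) (~-neg (coeff (m ⊛ G) k))))
        vanish : DegLt b ((a ∷ R) ⊕ neg (m ⊛ G))
        vanish k le with m≤n⇒m<n∨m≡n le
        ... | inj₂ refl = coeffs k (~-sym (~-trans (mG k) (~-trans (~-reflexive (lem₁ (coeff (a ∷ R) k) c′ (coeff G k)))
                (~-trans (~-*ˡ (coeff (a ∷ R) k) (proj₂ (inverse (coeff G b) (lead hG)))) (~-reflexive (*-identityʳ _))))))
          where
          lem₁ : ∀ a b c → a * b * c ≡ a * (c * b)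
          lem₁ = solve-∀
        ... | inj₁ lt = coeffs k (~-trans (top k lt) (~-sym (~-trans (mG k) (~-trans (~-*ˡ (coeff (a ∷ R) b * c′) (above hG k lt)) (~-reflexive (*-zeroʳ (coeff (a ∷ R) b * c′)))))))
          where
          top : ∀ k → b < k → coeff (a ∷ R) k ~ 0
          top (suc k) (s≤s le) = v k le

-- Pigeonhole on residues modulo G

module Kernel (p : ℕ) (pr : Prime p) where
  private instance
    p≢0 : NonZero p
    p≢0 = prime⇒nonZero pr
  open Mod p
  open Sub p
  open Domain p pr
  open GroupProperties (CommutativeRing.+-group PolyRing) public using () renaming (∙-cancelʳ to ⊕-cancelʳ)

  -- Base-p digits list the polynomials of degree below l by the numbers below p^l. With `code`,
  -- which numbers the residues modulo p of l coefficients, they turn the collision of polynomials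
  -- into a statement about finite sets of numbers.
  digits : ℕ → ℕ → Poly
  digits zero    n = []
  digits (suc l) n = n % p ∷ digits l (n / p)

  length-digits : ∀ l n → length (digits l n) ≡ l
  length-digits zero    n = refl
  length-digits (suc l) n = cong suc (length-digits l (n / p))

  digits-injective : ∀ l {m n} → m < p ^ l → n < p ^ l → digits l m ≈ digits l n → m ≡ n
  digits-injective zero {m} {n} m< n< e = trans (n<1⇒n≡0 m<) (sym (n<1⇒n≡0 n<))
  digits-injective (suc l) {m} {n} m< n< e = begin
    m  ≡⟨ m≡m%n+[m/n]*n m p ⟩
    m % p + m / p * p  ≡⟨ cong₂ (λ a b → a + b * p) low high ⟩
    n % p + n / p * p  ≡⟨ m≡m%n+[m/n]*n n p ⟨
    n  ∎
    where
    open ≡-Reasoning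
    low : m % p ≡ n % p
    low = trans (sym (m%n%n≡m%n m p)) (trans (~⇒% (e at 0)) (m%n%n≡m%n n p))
    bound : ∀ {m} → m < p ^ suc l → m / p < p ^ l
    bound {m} lt = m<n*o⇒m/o<n (subst (m <_) (*-comm p (p ^ l)) lt)
    high : m / p ≡ n / p
    high = digits-injective l (bound m<) (bound n<) (ptw λ k → e at suc k)

  code : ℕ → (ℕ → ℕ) → ℕ
  code zero    c = 0
  code (suc l) c = c 0 % p + code l (c ∘ suc) * p

  code< : ∀ l c → code l c < p ^ l
  code< zero    c = s≤s z≤n
  code< (suc l) c = begin-strict
    c 0 % p + code l (c ∘ suc) * p  <⟨ +-monoˡ-< _ (m%n<n (c 0) p) ⟩
    p + code l (c ∘ suc) * p  ≤⟨ *-monoˡ-≤ p (code< l (c ∘ suc)) ⟩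
    p ^ l * p  ≡⟨ *-comm (p ^ l) p ⟩
    p * p ^ l  ∎
    where open ≤-Reasoning

  code-injective : ∀ l c d → code l c ≡ code l d → ∀ k → k < l → c k ~ d k
  code-injective (suc l) c d e = λ
    { zero    _        → %⇒~ low
    ; (suc k) (s≤s lt) → code-injective l (c ∘ suc) (d ∘ suc) high k lt }
    where
    low : c 0 % p ≡ d 0 % p
    low = begin
      c 0 % p  ≡⟨ m%n%n≡m%n (c 0) p ⟨
      c 0 % p % p  ≡⟨ [m+kn]%n≡m%n (c 0 % p) (code l (c ∘ suc)) p ⟨
      code (suc l) c % p ≡⟨ cong (_% p) e ⟩
      code (suc l) d % p ≡⟨ [m+kn]%n≡m%n (d 0 % p) (code l (d ∘ suc)) p ⟩
      d 0 % p % p  ≡⟨ m%n%n≡m%n (d 0) p ⟩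
      d 0 % p  ∎
      where open ≡-Reasoning
    high : code l (c ∘ suc) ≡ code l (d ∘ suc)
    high = *-cancelʳ-≡ _ _ p (+-cancelˡ-≡ (d 0 % p) _ _ (subst (λ z → z + code l (c ∘ suc) * p ≡ code (suc l) d) low e))

  -- The p ^ (b + 1) polynomials of degree at most b have only p ^ b residues modulo G
  -- after substitution, so two of them collide.
  abstract
    kernel : ∀ T G b → HasDeg G b → ∃₂ λ f a → a ≤ b × HasDeg f a × ∃ λ k → sub T f ≈ G ⊛ k
    kernel T G b hG = from-collision (proj₁ pig) (proj₁ (proj₂ pig)) (proj₁ (proj₂ (proj₂ pig))) (proj₂ (proj₂ (proj₂ pig)))
      where
      open Division G b hG
      residue : Fin (p ^ suc b) → Fin (p ^ b)
      residue i = fromℕ< (code< b (coeff (proj₁ (proj₂ (divMod (sub T (digits (suc b) (toℕ i))))))))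
      pig : ∃₂ λ i j → toℕ i < toℕ j × residue i ≡ residue j
      pig = Fin.pigeonhole (^-monoʳ-< p 1<p (n<1+n b)) residue
      from-collision : ∀ i j → toℕ i < toℕ j → residue i ≡ residue j → ∃₂ λ f a → a ≤ b × HasDeg f a × ∃ λ k → sub T f ≈ G ⊛ k
      from-collision i j i<j same = collision
        where
        dᵢ dⱼ f Qᵢ Qⱼ Rᵢ Rⱼ : Poly
        dᵢ = digits (suc b) (toℕ i)
        dⱼ = digits (suc b) (toℕ j)
        f  = dᵢ ⊕ neg dⱼ
        Qᵢ = proj₁ (divMod (sub T dᵢ))
        Qⱼ = proj₁ (divMod (sub T dⱼ))
        Rᵢ = proj₁ (proj₂ (divMod (sub T dᵢ)))
        Rⱼ = proj₁ (proj₂ (divMod (sub T dⱼ)))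
        eᵢ : sub T dᵢ ≈ Qᵢ ⊛ G ⊕ Rᵢ
        eᵢ = proj₁ (proj₂ (proj₂ (divMod (sub T dᵢ))))
        eⱼ : sub T dⱼ ≈ Qⱼ ⊛ G ⊕ Rⱼ
        eⱼ = proj₁ (proj₂ (proj₂ (divMod (sub T dⱼ))))
        codes : code b (coeff Rᵢ) ≡ code b (coeff Rⱼ)
        codes = trans (sym (Fin.toℕ-fromℕ< (code< b (coeff Rᵢ)))) (trans (cong toℕ same) (Fin.toℕ-fromℕ< (code< b (coeff Rⱼ))))
        Rᵢ≈Rⱼ : Rᵢ ≈ Rⱼ
        Rᵢ≈Rⱼ = ptw go
          where
          go : ∀ k → coeff Rᵢ k ~ coeff Rⱼ k
          go k with k <? b
          ... | yes lt = code-injective b (coeff Rᵢ) (coeff Rⱼ) codes k lt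
          ... | no ¬lt = ~-trans (proj₂ (proj₂ (proj₂ (divMod (sub T dᵢ)))) k (≮⇒≥ ¬lt)) (~-sym (proj₂ (proj₂ (proj₂ (divMod (sub T dⱼ)))) k (≮⇒≥ ¬lt)))
        f+dⱼ : f ⊕ dⱼ ≈ dᵢ
        f+dⱼ = ≈-trans (CommutativeRing.+-assoc PolyRing dᵢ (neg dⱼ) dⱼ) (≈-trans (⊕-congˡ {dᵢ} (neg-invˡ dⱼ)) (⊕-idʳ dᵢ))
        divisible : sub T f ≈ G ⊛ (Qᵢ ⊕ neg Qⱼ)
        divisible = ⊕-cancelʳ (sub T dⱼ) (sub T f) (G ⊛ (Qᵢ ⊕ neg Qⱼ)) (begin
          sub T f ⊕ sub T dⱼ  ≈⟨ sub-⊕ T f dⱼ ⟨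
          sub T (f ⊕ dⱼ)  ≈⟨ sub-cong T f+dⱼ ⟩
          sub T dᵢ  ≈⟨ eᵢ ⟩
          Qᵢ ⊛ G ⊕ Rᵢ  ≈⟨ ⊕-cong (⊛-congʳ {G} (≈-trans (≈-sym (⊕-idʳ Qᵢ)) (⊕-congˡ {Qᵢ} (≈-sym (neg-invˡ Qⱼ))))) Rᵢ≈Rⱼ ⟩
          (Qᵢ ⊕ (neg Qⱼ ⊕ Qⱼ)) ⊛ G ⊕ Rⱼ  ≈⟨ kernel-step G Qᵢ (neg Qⱼ) Rⱼ Qⱼ ⟨
          G ⊛ (Qᵢ ⊕ neg Qⱼ) ⊕ (Qⱼ ⊛ G ⊕ Rⱼ)  ≈⟨ ⊕-congˡ {G ⊛ (Qᵢ ⊕ neg Qⱼ)} eⱼ ⟨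
          G ⊛ (Qᵢ ⊕ neg Qⱼ) ⊕ sub T dⱼ  ∎)
          where open SetoidR ≈-setoid
        small : ∀ n → DegLt (suc b) (digits (suc b) n)
        small n k le = DegLt-length (digits (suc b) n) k (subst (_≤ k) (sym (length-digits (suc b) n)) le)
        f-small : DegLt (suc b) f
        f-small k le = ~-trans (~-reflexive (trans (coeff-⊕ dᵢ (neg dⱼ) k) (cong (coeff dᵢ k +_) (coeff-⊙ (p ∸ 1) dⱼ k))))
          (~-+ (small (toℕ i) k le) (~-trans (~-*ˡ (p ∸ 1) (small (toℕ j) k le)) (~-reflexive (*-zeroʳ (p ∸ 1)))))
        f≉0 : ¬ f ≈ []
        f≉0 z = <⇒≢ i<j (digits-injective (suc b) (Fin.toℕ<n i) (Fin.toℕ<n j) (≈-trans (≈-sym f+dⱼ) (⊕-congʳ z)))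
        collision : ∃₂ λ f a → a ≤ b × HasDeg f a × ∃ λ k → sub T f ≈ G ⊛ k
        collision with zero-or-deg (suc b) f f-small
        ... | inj₁ z = contradiction z f≉0
        ... | inj₂ (a , s≤s a≤b , hf) = f , a , a≤b , hf , (Qᵢ ⊕ neg Qⱼ) , divisible

  𝟙 : Poly
  𝟙 = 1 ∷ []

  -- x ^ N - 1 itself, not a cyclotomic polynomial.
  Φ : ℕ → Poly
  Φ N = xp N ⊕ neg 𝟙

  Φ+1 : ∀ N → Φ N ⊕ 𝟙 ≈ xp N
  Φ+1 N = ≈-trans (CommutativeRing.+-assoc PolyRing (xp N) (neg 𝟙) 𝟙) (≈-trans (⊕-congˡ {xp N} (neg-invˡ 𝟙)) (⊕-idʳ (xp N)))

  -- Identities are proved in the form `f ⊕ 𝟙 ≈ xp N`, where substitutions and powers act on a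
  -- monomial; the 1 is cancelled at the end.
  Φ-unique : ∀ {f} N → f ⊕ 𝟙 ≈ xp N → f ≈ Φ N
  Φ-unique {f} N e = ⊕-cancelʳ 𝟙 f (Φ N) (≈-trans e (≈-sym (Φ+1 N)))

  HasDeg-Φ : ∀ N .{{_ : NonZero N}} → HasDeg (Φ N) N
  HasDeg-Φ (suc N) with HasDeg-xp 1<p (suc N)
  ... | deg nz v = deg (λ z → nz (~-trans (~-sym (same (suc N) (s≤s z≤n))) z)) (λ k le → ~-trans (same k (≤-trans (s≤s z≤n) le)) (v k le))
    where
    same : ∀ k → 0 < k → coeff (Φ (suc N)) k ~ coeff (xp (suc N)) k
    same (suc k) _ = ~-trans (~-reflexive (coeff-⊕ (xp (suc N)) (neg 𝟙) (suc k))) (~-reflexive (+-identityʳ _))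

-- Twisting a divisor of x^N - 1 by x ↦ x^q

module TwistM (p : ℕ) (pr : Prime p) where
  private instance
    p≢0 : NonZero p
    p≢0 = prime⇒nonZero pr
  open Mod p
  open Sub p
  open Domain p pr
  open Kernel p pr

  module Twist (N : ℕ) .{{_ : NonZero N}} (q q′ t : ℕ) .{{_ : NonZero q}} (qq′ : q * q′ ≡ 1 + N * t) where
    A : Poly
    A = Φ N

    xp-mod : ∀ s → ∃ λ w → xp (N * s) ≈ 𝟙 ⊕ A ⊛ w
    xp-mod zero    = [] , ≈-trans (≐⇒≈ λ k → cong (λ z → coeff (xp z) k) (*-zeroʳ N))
      (≈-sym (≈-trans (⊕-congˡ {𝟙} (⊛-zeroʳ A)) (⊕-idʳ 𝟙)))
    xp-mod (suc s) = _ , step (proj₁ (xp-mod s)) (proj₂ (xp-mod s))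
      where
      open SetoidR ≈-setoid
      step : ∀ w → xp (N * s) ≈ 𝟙 ⊕ A ⊛ w → xp (N * suc s) ≈ 𝟙 ⊕ A ⊛ (𝟙 ⊕ 𝟙 ⊛ w ⊕ A ⊛ w)
      step w e = begin
        xp (N * suc s)  ≈⟨ (≐⇒≈ λ k → cong (λ z → coeff (xp z) k) (*-suc N s)) ⟩
        xp (N + N * s)  ≈⟨ xp-+ N (N * s) ⟩
        xp N ⊛ xp (N * s)  ≈⟨ ⊛-cong (≈-sym (Φ+1 N)) e ⟩
        (A ⊕ 𝟙) ⊛ (𝟙 ⊕ A ⊛ w)  ≈⟨ power-mod A 𝟙 w ⟩
        𝟙 ⊛ 𝟙 ⊕ A ⊛ (𝟙 ⊕ 𝟙 ⊛ w ⊕ A ⊛ w)  ≈⟨ ⊕-congʳ {A ⊛ (𝟙 ⊕ 𝟙 ⊛ w ⊕ A ⊛ w)} {𝟙 ⊛ 𝟙} {𝟙} (⊛-idˡ 𝟙) ⟩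
        𝟙 ⊕ A ⊛ (𝟙 ⊕ 𝟙 ⊛ w ⊕ A ⊛ w)  ∎

    -- As x^(N t) is 1 modulo A, the substitution of x^(1 + N t) moves no residue class modulo A.
    sub-mod : ∀ f → ∃ λ u → sub (1 + N * t) f ≈ f ⊕ A ⊛ u
    sub-mod []      = [] , ≈-sym (⊛-zeroʳ A)
    sub-mod (a ∷ f) = _ , step (proj₁ (xp-mod t)) (proj₂ (xp-mod t)) (proj₁ (sub-mod f)) (proj₂ (sub-mod f))
      where
      open SetoidR ≈-setoid
      x≈ : ∀ w → xp (N * t) ≈ 𝟙 ⊕ A ⊛ w → xp (1 + N * t) ≈ xp 1 ⊕ A ⊛ (xp 1 ⊛ w)
      x≈ w ew = begin
        xp (1 + N * t)  ≈⟨ xp-+ 1 (N * t) ⟩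
        xp 1 ⊛ xp (N * t)  ≈⟨ ⊛-congˡ {xp 1} ew ⟩
        xp 1 ⊛ (𝟙 ⊕ A ⊛ w)  ≈⟨ ⊛-distribˡ (xp 1) 𝟙 (A ⊛ w) ⟩
        xp 1 ⊛ 𝟙 ⊕ xp 1 ⊛ (A ⊛ w)  ≈⟨ ⊕-cong (⊛-idʳ (xp 1)) (⊛-swap₂₃ (xp 1) A w) ⟩
        xp 1 ⊕ A ⊛ (xp 1 ⊛ w)  ∎
      step : ∀ w → xp (N * t) ≈ 𝟙 ⊕ A ⊛ w → ∀ u → sub (1 + N * t) f ≈ f ⊕ A ⊛ u →
        sub (1 + N * t) (a ∷ f) ≈ (a ∷ f) ⊕ A ⊛ (xp 1 ⊛ u ⊕ (xp 1 ⊛ w) ⊛ f ⊕ (xp 1 ⊛ w) ⊛ (A ⊛ u))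
      step w ew u eu = begin
        (a ∷ []) ⊕ xp (1 + N * t) ⊛ sub (1 + N * t) f  ≈⟨ ⊕-congˡ {a ∷ []} (⊛-cong (x≈ w ew) eu) ⟩
        (a ∷ []) ⊕ (xp 1 ⊕ A ⊛ (xp 1 ⊛ w)) ⊛ (f ⊕ A ⊛ u)  ≈⟨ horner-mod (a ∷ []) (xp 1) A (xp 1 ⊛ w) f u ⟩
        (a ∷ []) ⊕ xp 1 ⊛ f ⊕ A ⊛ (xp 1 ⊛ u ⊕ (xp 1 ⊛ w) ⊛ f ⊕ (xp 1 ⊛ w) ⊛ (A ⊛ u))
          ≈⟨ ⊕-congʳ (∷-decomp a f) ⟨
        (a ∷ f) ⊕ A ⊛ (xp 1 ⊛ u ⊕ (xp 1 ⊛ w) ⊛ f ⊕ (xp 1 ⊛ w) ⊛ (A ⊛ u)) ∎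

    sub-Φ : sub q A ⊕ 𝟙 ≈ xp (N * q)
    sub-Φ = begin
      sub q A ⊕ 𝟙  ≈⟨ ⊕-congˡ {sub q A} (sub-const q 1) ⟨
      sub q A ⊕ sub q 𝟙  ≈⟨ sub-⊕ q A 𝟙 ⟨
      sub q (A ⊕ 𝟙)  ≈⟨ sub-cong q (Φ+1 N) ⟩
      sub q (xp N)  ≈⟨ sub-xp q N ⟩
      xp (N * q)  ∎
      where open SetoidR ≈-setoid

    Φ∣subΦ : ∃ λ B → sub q A ≈ A ⊛ B
    Φ∣subΦ = proj₁ (xp-mod q) , ⊕-cancelʳ 𝟙 (sub q A) (A ⊛ proj₁ (xp-mod q))
      (≈-trans sub-Φ (≈-trans (proj₂ (xp-mod q)) (CommutativeRing.+-comm PolyRing 𝟙 (A ⊛ proj₁ (xp-mod q)))))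

    subst-exp : ∀ {m n} f → m ≡ n → sub m f ≈ sub n f
    subst-exp f refl = ≈-refl

    abstract
      -- Substitute x^q in the hypothesis. Its left side returns to f modulo A because q q′ = 1 + N
      -- t, and its right side stays divisible by A because A divides A(x^q).
      pullback : ∀ f k → sub q′ f ≈ A ⊛ k → ∃ λ k′ → f ≈ A ⊛ k′
      pullback f k e = _ , step (proj₁ (sub-mod f)) (proj₂ (sub-mod f)) (proj₁ Φ∣subΦ) (proj₂ Φ∣subΦ)
        where
        open SetoidR ≈-setoid
        step : ∀ u → sub (1 + N * t) f ≈ f ⊕ A ⊛ u → ∀ B → sub q A ≈ A ⊛ B → f ≈ A ⊛ (B ⊛ sub q k ⊕ neg u)
        step u eu B eB = ⊕-cancelʳ (A ⊛ u) f (A ⊛ (B ⊛ sub q k ⊕ neg u)) (begin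
          f ⊕ A ⊛ u  ≈⟨ eu ⟨
          sub (1 + N * t) f  ≈⟨ subst-exp f (trans (sym qq′) (*-comm q q′)) ⟩
          sub (q′ * q) f  ≈⟨ sub-sub q q′ f ⟨
          sub q (sub q′ f)  ≈⟨ sub-cong q e ⟩
          sub q (A ⊛ k)  ≈⟨ sub-⊛ q A k ⟩
          sub q A ⊛ sub q k  ≈⟨ ⊛-congʳ {sub q k} eB ⟩
          (A ⊛ B) ⊛ sub q k  ≈⟨ ⊛-assoc′ A B (sub q k) ⟩
          A ⊛ (B ⊛ sub q k)  ≈⟨ ⊛-congˡ {A} (≈-trans (≈-sym (⊕-idʳ (B ⊛ sub q k))) (⊕-congˡ {B ⊛ sub q k} (≈-sym (neg-invˡ u)))) ⟩
          A ⊛ (B ⊛ sub q k ⊕ (neg u ⊕ u))  ≈⟨ ⊛-assoc-distrib A (B ⊛ sub q k) (neg u) u ⟩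
          A ⊛ (B ⊛ sub q k ⊕ neg u) ⊕ A ⊛ u  ∎)

      -- After x ↦ x^q′ the factor G(x^q) is G modulo A, while g becomes a multiple of H; the
      -- product is divisible by G H = A, and `pullback` undoes the substitution.
      half : ∀ G H g kg → G ⊛ H ≈ A → sub q′ g ≈ H ⊛ kg → ∃ λ k → sub q G ⊛ g ≈ A ⊛ k
      half G H g kg GH eg = pullback (sub q G ⊛ g) (kg ⊕ H ⊛ (u ⊛ kg)) (begin
        sub q′ (sub q G ⊛ g)  ≈⟨ sub-⊛ q′ (sub q G) g ⟩
        sub q′ (sub q G) ⊛ sub q′ g  ≈⟨ ⊛-cong (≈-trans (sub-sub q′ q G) (subst-exp G qq′)) eg ⟩
        sub (1 + N * t) G ⊛ (H ⊛ kg)  ≈⟨ ⊛-congʳ {H ⊛ kg} (≈-trans (proj₂ (sub-mod G)) (⊕-congˡ {G} (⊛-congʳ {u} (≈-sym GH)))) ⟩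
        (G ⊕ (G ⊛ H) ⊛ u) ⊛ (H ⊛ kg)  ≈⟨ twist-step₁ G H u kg ⟩
        (G ⊛ H) ⊛ (kg ⊕ H ⊛ (u ⊛ kg))  ≈⟨ ⊛-congʳ {kg ⊕ H ⊛ (u ⊛ kg)} GH ⟩
        A ⊛ (kg ⊕ H ⊛ (u ⊛ kg))  ∎)
        where
        open SetoidR ≈-setoid
        u : Poly
        u = proj₁ (sub-mod G)

    -- `k` is the wanted divisor of A(x^q) / A, `k′` the complementary one obtained from H, and `d`
    -- makes up for the constant by which f g differs from A.
    record Twisted (b : ℕ) : Set where
      constructor twisted
      field
        k k′ d : Poly
        degree : HasDeg k (b * q ∸ b)
        eq     : d ⊛ (A ⊛ (k ⊛ k′)) ≈ sub q A

    module Untwist {G H f g c k k′ : Poly} {b b′ a a′ e : ℕ}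
      (GH : G ⊛ H ≈ A) (hG : HasDeg G b) (hH : HasDeg H b′)
      (a≤b : a ≤ b) (a′≤b′ : a′ ≤ b′) (hf : HasDeg f a) (hg : HasDeg g a′)
      (fg : f ⊛ g ≈ A ⊛ c) (ek : sub q G ⊛ g ≈ A ⊛ k) (ek′ : sub q H ⊛ f ≈ A ⊛ k′) (hc : HasDeg c e)
      where
      open SetoidR ≈-setoid
      bb′ : b + b′ ≡ N
      bb′ = HasDeg-unique (HasDeg-≈ GH (HasDeg-⊛ hG hH)) (HasDeg-Φ N)
      Ne : a + a′ ≡ N + e
      Ne = HasDeg-unique (HasDeg-≈ fg (HasDeg-⊛ hf hg)) (HasDeg-⊛ (HasDeg-Φ N) hc)
      -- The degrees of f and g add up to N + e but are bounded by those of G and H, which add up to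
      -- N. Hence c is a constant and both kernels have full degree.
      e≡0 : e ≡ 0
      e≡0 = n≤0⇒n≡0 (+-cancelˡ-≤ N e 0 (≤-trans (≤-reflexive (sym Ne)) (≤-trans (+-mono-≤ a≤b a′≤b′) (≤-reflexive (trans bb′ (sym (+-identityʳ N)))))))
      a≡b : a ≡ b
      a≡b = ≤-antisym a≤b (+-cancelʳ-≤ a′ b a (≤-trans (+-monoʳ-≤ b a′≤b′) (≤-reflexive (trans bb′ (sym (trans Ne (trans (cong (N +_) e≡0) (+-identityʳ N))))))))
      -- Both sides times g equal c A k. Since c is a constant, f divides S with quotient k up to
      -- that constant.
      cancelled : ∀ f g S k {x} → HasDeg g x → f ⊛ g ≈ A ⊛ c → S ⊛ g ≈ A ⊛ k → c ⊛ S ≈ f ⊛ k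
      cancelled f g S k hg fg es = ⊛-cancelˡ hg (begin
        g ⊛ (c ⊛ S)  ≈⟨ twist-step₂ g c S ⟩
        c ⊛ (S ⊛ g)  ≈⟨ ⊛-congˡ {c} es ⟩
        c ⊛ (A ⊛ k)  ≈⟨ twist-step₄ c A k ⟩
        (A ⊛ c) ⊛ k  ≈⟨ ⊛-congʳ {k} fg ⟨
        (f ⊛ g) ⊛ k  ≈⟨ twist-step₃ f g k ⟩
        g ⊛ (f ⊛ k)  ∎)
      cG : c ⊛ sub q G ≈ f ⊛ k
      cG = cancelled f g (sub q G) k hg fg ek
      cH : c ⊛ sub q H ≈ g ⊛ k′
      cH = cancelled g f (sub q H) k′ hf (≈-trans (CommutativeRing.*-comm PolyRing g f) fg) ek′
      hcG : HasDeg (f ⊛ k) (b * q)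
      hcG = subst (HasDeg (f ⊛ k)) (cong (_+ b * q) e≡0) (HasDeg-≈ cG (HasDeg-⊛ hc (HasDeg-sub q G b hG)))
      degk : HasDeg k (b * q ∸ b)
      degk = [ (λ z → contradiction (≈-trans (⊛-congˡ {f} z) (⊛-zeroʳ f)) (HasDeg-≉0 hcG))
             , (λ (x , hk) → subst (HasDeg k) (sym (trans (cong (_∸ b) (sym (xe hk))) (m+n∸m≡n b x))) hk) ]′ (zero-or-deg′ k)
        where
        xe : ∀ {x} → HasDeg k x → b + x ≡ b * q
        xe {x} hk = trans (cong (_+ x) (sym a≡b)) (HasDeg-unique (HasDeg-⊛ hf hk) hcG)
      cA : c ⊛ sub q A ≈ A ⊛ (k ⊛ k′)
      cA = ⊛-cancelˡ hc (begin
        c ⊛ (c ⊛ sub q A)  ≈⟨ ⊛-congˡ {c} (⊛-congˡ {c} (≈-trans (sub-cong q (≈-sym GH)) (sub-⊛ q G H))) ⟩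
        c ⊛ (c ⊛ (sub q G ⊛ sub q H))  ≈⟨ twist-step₅ c (sub q G) (sub q H) ⟨
        (c ⊛ sub q G) ⊛ (c ⊛ sub q H)  ≈⟨ ⊛-cong cG cH ⟩
        (f ⊛ k) ⊛ (g ⊛ k′)  ≈⟨ ⊛-interchange f k g k′ ⟩
        (f ⊛ g) ⊛ (k ⊛ k′)  ≈⟨ ⊛-congʳ {k ⊛ k′} fg ⟩
        (A ⊛ c) ⊛ (k ⊛ k′)  ≈⟨ twist-step₄ c A (k ⊛ k′) ⟨
        c ⊛ (A ⊛ (k ⊛ k′))  ∎)
      hc₀ : HasDeg c 0
      hc₀ = subst (HasDeg c) e≡0 hc
      ci : ℕ
      ci = proj₁ (inverse (coeff c 0) (lead hc₀))
      ci-inv : (ci ∷ []) ⊛ c ≈ 𝟙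
      ci-inv = ptw λ
        { zero → ~-trans (~-reflexive (trans (coeff-⊕ (ci ⊙ c) (0 ∷ []) 0) (trans (+-identityʳ _) (trans (coeff-⊙ ci c 0) (*-comm ci _))))) (proj₂ (inverse (coeff c 0) (lead hc₀)))
        ; (suc k) → ~-trans (~-reflexive (trans (coeff-⊕ (ci ⊙ c) (0 ∷ []) (suc k)) (trans (+-identityʳ _) (coeff-⊙ ci c (suc k))))) (~-trans (~-*ˡ ci (above hc₀ (suc k) (s≤s z≤n))) (~-reflexive (*-zeroʳ ci))) }
      collect : Twisted b
      collect = twisted k k′ (ci ∷ []) degk (begin
        (ci ∷ []) ⊛ (A ⊛ (k ⊛ k′))  ≈⟨ ⊛-congˡ {ci ∷ []} cA ⟨
        (ci ∷ []) ⊛ (c ⊛ sub q A)  ≈⟨ ⊛-assoc′ (ci ∷ []) c (sub q A) ⟨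
        ((ci ∷ []) ⊛ c) ⊛ sub q A  ≈⟨ ⊛-congʳ {sub q A} ci-inv ⟩
        𝟙 ⊛ sub q A  ≈⟨ ⊛-idˡ (sub q A) ⟩
        sub q A  ∎)

    abstract
      twist : ∀ G H b → G ⊛ H ≈ A → HasDeg G b → Twisted b
      twist G H b GH hG = [ (λ z → contradiction (≈-trans (≈-sym GH) (≈-trans (⊛-congˡ {G} z) (⊛-zeroʳ G))) (HasDeg-≉0 (HasDeg-Φ N)))
                          , (λ (b′ , hH) → with-kernels b′ hH (kernel q′ G b hG) (kernel q′ H b′ hH)) ]′ (zero-or-deg′ H)
        where
        with-kernels : ∀ b′ → HasDeg H b′ → (∃₂ λ f a → a ≤ b × HasDeg f a × ∃ λ k → sub q′ f ≈ G ⊛ k) →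
          (∃₂ λ g a → a ≤ b′ × HasDeg g a × ∃ λ k → sub q′ g ≈ H ⊛ k) → Twisted b
        with-kernels b′ hH (f , a , a≤b , hf , kf , ef) (g , a′ , a′≤b′ , hg , kg , eg) =
          [ (λ z → contradiction (≈-trans (proj₂ fg) (≈-trans (⊛-congˡ {A} z) (⊛-zeroʳ A))) (HasDeg-≉0 (HasDeg-⊛ hf hg)))
          , (λ (e , hc) → Untwist.collect GH hG hH a≤b a′≤b′ hf hg (proj₂ fg) (proj₂ (half G H g kg GH eg))
              (proj₂ (half H G f kf (≈-trans (CommutativeRing.*-comm PolyRing H G) GH) ef)) hc) ]′ (zero-or-deg′ (proj₁ fg))
          where
          -- f(x^q′) g(x^q′) is a multiple of G H = A, so A already divides f g.
          fg : ∃ λ c → f ⊛ g ≈ A ⊛ c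
          fg = pullback (f ⊛ g) (kf ⊛ kg) (≈-trans (sub-⊛ q′ f g) (≈-trans (⊛-cong ef eg) (≈-trans (⊛-interchange G kf H kg) (⊛-congʳ {kf ⊛ kg} GH))))

-- Divisors of x ^ N - 1

modular-inverse : ∀ {q N} .{{_ : NonZero q}} → Coprime q N → ∃₂ λ q′ t → q * q′ ≡ 1 + N * t
modular-inverse {q} {N} cop with coprime-Bézout cop
... | Bézout.+- x y e = x , y , trans (*-comm q x) (trans (sym e) (cong suc (*-comm y N)))
-- The identity reads 1 = y N, so N is 1 and there is no condition on q′.
... | Bézout.-+ zero y e = 1 , q ∸ 1 , trans (*-identityʳ q) (trans (sym (m+[n∸m]≡n (>-nonZero⁻¹ q)))
        (cong suc (trans (sym (*-identityˡ (q ∸ 1))) (cong (_* (q ∸ 1)) (sym (m*n≡1⇒n≡1 y N (sym e)))))))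
-- Now x q, with the shifted x, is -1 modulo N; its square is 1, which gives the inverse with the
-- required sign.
... | Bézout.-+ (suc x) y e = suc x * (q * suc x) , y * (suc x * q ∸ 1) , (begin
        q * (suc x * (q * suc x))  ≡⟨ lem₁ q (suc x) ⟩
        (suc x * q) * (suc x * q)  ≡⟨ cong (λ z → z * z) z≡ ⟩
        (1 + z) * (1 + z)  ≡⟨ lem₂ z ⟩
        1 + z * (1 + (1 + z))  ≡⟨ cong (λ s → 1 + z * (1 + s)) z≡ ⟨
        1 + z * (1 + suc x * q)  ≡⟨ cong (λ s → 1 + z * s) e ⟩
        1 + z * (y * N)  ≡⟨ lem₃ z y N ⟩
        1 + N * (y * z)  ∎)
  where
  open ≡-Reasoning
  z : ℕ
  z = suc x * q ∸ 1
  z≡ : suc x * q ≡ 1 + z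
  z≡ = sym (m+[n∸m]≡n (≤-trans (>-nonZero⁻¹ q) (m≤m+n q (x * q))))
  lem₁ : ∀ q x → q * (x * (q * x)) ≡ (x * q) * (x * q)
  lem₁ = solve-∀
  lem₂ : ∀ z → (1 + z) * (1 + z) ≡ 1 + z * (1 + (1 + z))
  lem₂ = solve-∀
  lem₃ : ∀ z y N → 1 + z * (y * N) ≡ 1 + N * (y * z)
  lem₃ = solve-∀

p∤m! : ∀ {p} → Prime p → ∀ m → m < p → ¬ p ∣ m !
p∤m! pr zero    m<p d = <⇒≱ (nonTrivial⇒n>1 _ {{prime⇒nonTrivial pr}}) (∣⇒≤ d)
p∤m! pr (suc m) m<p d = [ (λ d → <⇒≱ m<p (∣⇒≤ d)) , p∤m! pr m (<-trans (n<1+n m) m<p) ]′ (euclidsLemma (suc m) (m !) pr d)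

p∣pCk : ∀ {p} → Prime p → ∀ k → 0 < k → k < p → p ∣ p choose k
p∣pCk {p} pr k 0<k k<p = [ id , (λ d → ⊥-elim ([ p∤m! pr k k<p , p∤m! pr (p ∸ k) (∸-monoʳ-< 0<k (<⇒≤ k<p)) ]′ (euclidsLemma (k !) ((p ∸ k) !) pr d))) ]′
  (euclidsLemma (p choose k) (k ! * (p ∸ k) !) pr (subst (p ∣_) (sym p!≡) p∣p!))
  where
  instance
    nz : NonZero (k ! * (p ∸ k) !)
    nz = k !* (p ∸ k) !≢0
  p!≡ : (p choose k) * (k ! * (p ∸ k) !) ≡ p !
  p!≡ = trans (cong (_* (k ! * (p ∸ k) !)) (nCk≡n!/k![n-k]! (<⇒≤ k<p))) (m/n*n≡m (k![n∸k]!∣n! (<⇒≤ k<p)))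
  p∣p! : p ∣ p !
  p∣p! = subst (λ z → z ∣ z !) (m+[n∸m]≡n (<⇒≤ (nonTrivial⇒n>1 p {{prime⇒nonTrivial pr}}))) (divides ((p ∸ 1) !) (*-comm (suc (p ∸ 1)) ((p ∸ 1) !)))

module Practicality (p : ℕ) (pr : Prime p) where
  private instance
    p≢0 : NonZero p
    p≢0 = prime⇒nonZero pr
  open Mod p
  open Sub p
  open Domain p pr
  open Kernel p pr
  open TwistM p pr

  Practical : ℕ → Set
  Practical N = ∀ d → d ≤ N → ∃₂ λ g h → HasDeg g d × g ⊛ h ≈ Φ N

  -- A divisor of x^N - 1 of degree a times a twisted divisor coming from degree b has degree a + b
  -- (q - 1). With a and b up to N these values leave no gap between 0 and N q exactly when q - 1 ≤
  -- N + 1: take b = N near the top, and elsewhere divide d by q - 1 with remainder at most N.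
  practical-* : ∀ N q .{{_ : NonZero N}} → Coprime q N → 2 ≤ q → q ≤ N + 2 → Practical N → Practical (N * q)
  practical-* N (suc r) cop (s≤s 1≤r) q≤N+2 P d d≤ = build (split (N * r ≤? d))
    where
    r≤ : r ≤ N + 1
    r≤ = +-cancelˡ-≤ 1 r (N + 1) (≤-trans q≤N+2 (≤-reflexive (lem N)))
      where
      lem : ∀ N → N + 2 ≡ 1 + (N + 1)
      lem = solve-∀
    instance
      r≢0 : NonZero r
      r≢0 = >-nonZero 1≤r
    inv : ∃₂ λ q′ t → suc r * q′ ≡ 1 + N * t
    inv = modular-inverse cop
    open Twist N (suc r) (proj₁ inv) (proj₁ (proj₂ inv)) (proj₂ (proj₂ inv))
    split : Dec (N * r ≤ d) → ∃₂ λ a b → a ≤ N × b ≤ N × a + b * r ≡ d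
    split (yes le) = d ∸ N * r , N , m≤n+o⇒m∸n≤o d (N * r) (≤-trans d≤ (≤-reflexive (trans (*-suc N r) (+-comm N (N * r))))) , ≤-refl , m∸n+n≡m le
    split (no ¬le) = d % r , d / r , ≤-pred (≤-trans (m%n<n d r) (≤-trans r≤ (≤-reflexive (+-comm N 1)))) , <⇒≤ (m<n*o⇒m/o<n (≰⇒> ¬le)) , sym (m≡m%n+[m/n]*n d r)
    build : (∃₂ λ a b → a ≤ N × b ≤ N × a + b * r ≡ d) → ∃₂ λ g h → HasDeg g d × g ⊛ h ≈ Φ (N * suc r)
    build (a , b , a≤ , b≤ , e) = from (P a a≤) (P b b≤)
      where
      from : (∃₂ λ g h → HasDeg g a × g ⊛ h ≈ Φ N) → (∃₂ λ g h → HasDeg g b × g ⊛ h ≈ Φ N) → ∃₂ λ g h → HasDeg g d × g ⊛ h ≈ Φ (N * suc r)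
      from (F , F′ , hF , FF) (G , H , hG , GH) = F ⊛ k , (F′ ⊛ k′) ⊛ δ′ ,
        subst (HasDeg (F ⊛ k)) (trans (cong (a +_) (trans (cong (_∸ b) (*-suc b r)) (m+n∸m≡n b (b * r)))) e) (HasDeg-⊛ hF degree) ,
        (begin
          (F ⊛ k) ⊛ ((F′ ⊛ k′) ⊛ δ′)  ≈⟨ cofactor-step F k F′ k′ δ′ ⟩
          δ′ ⊛ ((F ⊛ F′) ⊛ (k ⊛ k′))  ≈⟨ ⊛-congˡ {δ′} (⊛-congʳ {k ⊛ k′} FF) ⟩
          δ′ ⊛ (Φ N ⊛ (k ⊛ k′))  ≈⟨ eq ⟩
          sub (suc r) (Φ N)  ≈⟨ Φ-unique (N * suc r) sub-Φ ⟩
          Φ (N * suc r)  ∎)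
        where
        open SetoidR ≈-setoid
        open Twisted (twist G H b GH hG) renaming (d to δ′)

  open CommutativeRing PolyRing using (semiring; commutativeSemiring)
  open Exp semiring using () renaming (_^_ to _^ᴾ_)
  open Mult semiring using () renaming (_×_ to _·_)
  open SemiringSum semiring using (sum-cong-≋; sum-init-last; sum-replicate-zero) renaming (sum to Σᴾ)
  module Bin = Binomial commutativeSemiring

  coeff-· : ∀ n f k → coeff (n · f) k ≡ n * coeff f k
  coeff-· zero    f k = refl
  coeff-· (suc n) f k = trans (coeff-⊕ f (n · f) k) (cong (coeff f k +_) (coeff-· n f k))

  p∣⇒·≈0 : ∀ {n} f → p ∣ n → n · f ≈ []
  p∣⇒·≈0 {n} f d = ptw λ k → ~-trans (~-reflexive (coeff-· n f k)) (∣⇒~0 (∣m⇒∣m*n (coeff f k) d))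

  Σ-zero : ∀ n (t : Fin n → Poly) → (∀ i → t i ≈ []) → Σᴾ t ≈ []
  Σ-zero n t z = ≈-trans (sum-cong-≋ z) (sum-replicate-zero n)

  1^ : ∀ n → 𝟙 ^ᴾ n ≈ 𝟙
  1^ zero    = ≈-refl
  1^ (suc n) = ≈-trans (⊛-idˡ (𝟙 ^ᴾ n)) (1^ n)

  freshman : ∀ f → (f ⊕ 𝟙) ^ᴾ p ≈ f ^ᴾ p ⊕ 𝟙
  freshman f = go (p ∸ 1) (sym (m+[n∸m]≡n (<⇒≤ 1<p)))
    where
    open SetoidR ≈-setoid
    go : ∀ r → p ≡ suc r → (f ⊕ 𝟙) ^ᴾ p ≈ f ^ᴾ p ⊕ 𝟙
    go r refl = begin
      (f ⊕ 𝟙) ^ᴾ p  ≈⟨ Bin.theorem p f 𝟙 ⟩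
      term fzero ⊕ Σᴾ (λ i → term (fsuc i))  ≈⟨ ⊕-cong bottom (sum-init-last (λ i → term (fsuc i))) ⟩
      𝟙 ⊕ (Σᴾ (λ i → term (fsuc (inject₁ i))) ⊕ term (fsuc (fromℕ r)))
        ≈⟨ ⊕-congˡ {𝟙} (⊕-cong (Σ-zero r _ middle) top) ⟩
      𝟙 ⊕ f ^ᴾ p  ≈⟨ CommutativeRing.+-comm PolyRing 𝟙 (f ^ᴾ p) ⟩
      f ^ᴾ p ⊕ 𝟙  ∎
      where
      term : Fin (suc p) → Poly
      term = Bin.binomialTerm f 𝟙 p
      ×1 : ∀ {n} g → n ≡ 1 → n · g ≈ g
      ×1 g refl = ⊕-idʳ g
      bottom : term fzero ≈ 𝟙
      bottom = ≈-trans (×1 (𝟙 ⊛ 𝟙 ^ᴾ p) refl) (≈-trans (⊛-idˡ (𝟙 ^ᴾ p)) (1^ p))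
      middle : ∀ i → term (fsuc (inject₁ i)) ≈ []
      middle i = p∣⇒·≈0 (Bin.binomial f 𝟙 p (fsuc (inject₁ i))) (p∣pCk pr _ (s≤s z≤n) (s≤s (subst (_< r) (sym (Fin.toℕ-inject₁ i)) (Fin.toℕ<n i))))
      top : term (fsuc (fromℕ r)) ≈ f ^ᴾ p
      top = ≈-trans (×1 (Bin.binomial f 𝟙 p (fsuc (fromℕ r))) (trans (cong (p choose_) (cong suc (Fin.toℕ-fromℕ r))) (nCn≡1 p)))
        (≈-trans (⊛-congˡ {f ^ᴾ suc (toℕ (fromℕ r))} (1^ (p ∸ suc (toℕ (fromℕ r)))))
        (≈-trans (⊛-idʳ (f ^ᴾ suc (toℕ (fromℕ r)))) (same (Fin.toℕ-fromℕ r))))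
        where
        same : ∀ {m n} → m ≡ n → f ^ᴾ suc m ≈ f ^ᴾ suc n
        same refl = ≈-refl

  xp-^ : ∀ N k → (xp N) ^ᴾ k ≈ xp (k * N)
  xp-^ N zero    = ≈-refl
  xp-^ N (suc k) = ≈-trans (⊛-congˡ {xp N} (xp-^ N k)) (≈-sym (xp-+ N (k * N)))

  Φ-^p : ∀ N → Φ N ^ᴾ p ≈ Φ (p * N)
  Φ-^p N = Φ-unique (p * N) (begin
    Φ N ^ᴾ p ⊕ 𝟙  ≈⟨ freshman (Φ N) ⟨
    (Φ N ⊕ 𝟙) ^ᴾ p  ≈⟨ ^-cong p (Φ+1 N) ⟩
    (xp N) ^ᴾ p  ≈⟨ xp-^ N p ⟩
    xp (p * N)  ∎)
    where
    open SetoidR ≈-setoid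
    ^-cong : ∀ {f g} n → f ≈ g → f ^ᴾ n ≈ g ^ᴾ n
    ^-cong zero    e = ≈-refl
    ^-cong (suc n) e = ⊛-cong e (^-cong n e)

  ^-+ : ∀ f m n → f ^ᴾ (m + n) ≈ f ^ᴾ m ⊛ f ^ᴾ n
  ^-+ f zero    n = ≈-sym (⊛-idˡ (f ^ᴾ n))
  ^-+ f (suc m) n = ≈-trans (⊛-congˡ {f} (^-+ f m n)) (≈-sym (⊛-assoc′ f (f ^ᴾ m) (f ^ᴾ n)))

  HasDeg-^ : ∀ {f a} n → HasDeg f a → HasDeg (f ^ᴾ n) (n * a)
  HasDeg-^ zero    h = HasDeg-1 1<p
  HasDeg-^ (suc n) h = HasDeg-⊛ h (HasDeg-^ n h)

  -- x^(p N) - 1 is the p-th power of x^N - 1. Take d / N full factors and from one more factor a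
  -- divisor of degree d % N; such a factor is left unless d = p N.
  practical-p* : ∀ N .{{_ : NonZero N}} → Practical N → Practical (p * N)
  practical-p* N P d d≤ with m≤n⇒m<n∨m≡n d≤
  ... | inj₂ refl = Φ N ^ᴾ p , 𝟙 , HasDeg-^ p (HasDeg-Φ N) , ≈-trans (⊛-idʳ (Φ N ^ᴾ p)) (Φ-^p N)
  ... | inj₁ d<  = from (P (d % N) (<⇒≤ (m%n<n d N)))
    where
    j i : ℕ
    j = d / N
    i = p ∸ suc j
    p≡ : j + (1 + i) ≡ p
    p≡ = trans (+-suc j i) (m+[n∸m]≡n {suc j} (m<n*o⇒m/o<n d<))
    open SetoidR ≈-setoid
    from : (∃₂ λ g h → HasDeg g (d % N) × g ⊛ h ≈ Φ N) → ∃₂ λ g h → HasDeg g d × g ⊛ h ≈ Φ (p * N)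
    from (g , h , hg , gh) = Φ N ^ᴾ j ⊛ g , h ⊛ Φ N ^ᴾ i ,
      subst (HasDeg _) (trans (+-comm (j * N) (d % N)) (sym (m≡m%n+[m/n]*n d N))) (HasDeg-⊛ (HasDeg-^ j (HasDeg-Φ N)) hg) ,
      (begin
        (Φ N ^ᴾ j ⊛ g) ⊛ (h ⊛ Φ N ^ᴾ i)  ≈⟨ ⊛-assoc⁴ (Φ N ^ᴾ j) g h (Φ N ^ᴾ i) ⟩
        Φ N ^ᴾ j ⊛ ((g ⊛ h) ⊛ Φ N ^ᴾ i)  ≈⟨ ⊛-congˡ {Φ N ^ᴾ j} (⊛-congʳ {Φ N ^ᴾ i} gh) ⟩
        Φ N ^ᴾ j ⊛ (Φ N ^ᴾ (1 + i))  ≈⟨ ^-+ (Φ N) j (1 + i) ⟨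
        Φ N ^ᴾ (j + (1 + i))  ≈⟨ same p≡ ⟩
        Φ N ^ᴾ p  ≈⟨ Φ-^p N ⟩
        Φ (p * N)  ∎)
      where
      same : ∀ {m n} → m ≡ n → Φ N ^ᴾ m ≈ Φ N ^ᴾ n
      same refl = ≈-refl

  practical-1 : Practical 1
  practical-1 zero          _ = 𝟙 , Φ 1 , HasDeg-1 1<p , ⊛-idˡ (Φ 1)
  practical-1 (suc zero)    _ = Φ 1 , 𝟙 , HasDeg-Φ 1 , ⊛-idʳ (Φ 1)
  practical-1 (suc (suc d)) (s≤s ())

  practical-p^ : ∀ k → Practical (p ^ k)
  practical-p^ zero    = practical-1
  practical-p^ (suc k) = practical-p* (p ^ k) {{m^n≢0 p k}} (practical-p^ k)

  δ≡ : ∀ k → δ k 0 ≡ coeff 𝟙 k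
  δ≡ zero    = refl
  δ≡ (suc k) = refl

  Practical⇒PPractical : ∀ {N} → Practical N → PPractical p N
  Practical⇒PPractical {N} P d 1≤d d≤N with P d d≤N
  ... | g , h , hg , gh = g , ((λ dv → lead hg (∣⇒~0 dv)) , λ k lt → ~0⇒∣ (above hg k lt)) , h , λ k → conv′ k
    where
    e : g ⊛ h ⊕ 𝟙 ≈ xp N
    e = ≈-trans (⊕-congʳ gh) (Φ+1 N)
    conv′ : ∀ k → (mulCoeff g h k + δ k 0) ≡ δ k N [mod p ]
    conv′ k = let mk a b eq = ~-trans (~-reflexive (trans (cong₂ _+_ (trans (mulCoeff≡conv g h k) (sym (coeff-⊛ g h k))) (δ≡ k)) (sym (coeff-⊕ (g ⊛ h) 𝟙 k))))
                                (~-trans (e at k) (~-reflexive (coeff-xp N k))) in a , b , eq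

  PPractical⇒divisor : ∀ {N} → PPractical p N → ∀ d → 1 ≤ d → d ≤ N → ∃₂ λ g h → HasDeg g d × g ⊛ h ≈ Φ N
  PPractical⇒divisor {N} P d 1≤d d≤N with P d 1≤d d≤N
  ... | g , (nz , v) , h , e = g , h , deg (λ z → nz (~0⇒∣ z)) (λ k lt → ∣⇒~0 (v k lt)) , Φ-unique N (ptw λ k →
      let (a , b , eq) = e k in
      ~-trans (~-reflexive (trans (coeff-⊕ (g ⊛ h) 𝟙 k) (cong₂ _+_ (trans (coeff-⊛ g h k) (sym (mulCoeff≡conv g h k))) (sym (δ≡ k)))))
        (~-trans (mk a b eq) (~-reflexive (sym (coeff-xp N k)))))

  infix 4 _∣Φ_
  record _∣Φ_ (g : Poly) (n : ℕ) : Set where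
    constructor _,Φ_
    field
      quotient : Poly
      equality : xp n ≈ 𝟙 ⊕ g ⊛ quotient

  divides⇒∣Φ : ∀ {g h n} → g ⊛ h ≈ Φ n → g ∣Φ n
  divides⇒∣Φ {g} {h} {n} e = h ,Φ ≈-trans (≈-sym (Φ+1 n)) (≈-trans (⊕-congʳ (≈-sym e)) (CommutativeRing.+-comm PolyRing (g ⊛ h) 𝟙))

  ∣Φ⇒divides : ∀ {g n} → g ∣Φ n → ∃ λ h → g ⊛ h ≈ Φ n
  ∣Φ⇒divides {g} {n} (h ,Φ e) = h , Φ-unique n (≈-trans (CommutativeRing.+-comm PolyRing (g ⊛ h) 𝟙) (≈-sym e))

  ∣Φ-+ : ∀ {g m n} → g ∣Φ m → g ∣Φ n → g ∣Φ m + n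
  ∣Φ-+ {g} {m} {n} (u ,Φ e) (w ,Φ e′) = r ,Φ (begin
    xp (m + n)  ≈⟨ xp-+ m n ⟩
    xp m ⊛ xp n  ≈⟨ ⊛-cong e e′ ⟩
    (𝟙 ⊕ g ⊛ u) ⊛ (𝟙 ⊕ g ⊛ w)  ≈⟨ ∣-mul 𝟙 g u w ⟩
    𝟙 ⊛ 𝟙 ⊕ g ⊛ r  ≈⟨ ⊕-congʳ {g ⊛ r} {𝟙 ⊛ 𝟙} {𝟙} (⊛-idˡ 𝟙) ⟩
    𝟙 ⊕ g ⊛ r  ∎)
    where
    open SetoidR ≈-setoid
    r : Poly
    r = 𝟙 ⊛ w ⊕ 𝟙 ⊛ u ⊕ u ⊛ (g ⊛ w)

  ∣Φ-0 : ∀ {g} → g ∣Φ 0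
  ∣Φ-0 {g} = [] ,Φ ≈-sym (≈-trans (⊕-congˡ {𝟙} (⊛-zeroʳ g)) (⊕-idʳ 𝟙))

  ∣Φ-* : ∀ {g m} k → g ∣Φ m → g ∣Φ k * m
  ∣Φ-* zero    d = ∣Φ-0
  ∣Φ-* (suc k) d = ∣Φ-+ d (∣Φ-* k d)

  ∣Φ-∸ : ∀ {g m n} → g ∣Φ m → g ∣Φ n + m → g ∣Φ n
  ∣Φ-∸ {g} {m} {n} (u ,Φ e) (w ,Φ e′) = (w ⊕ neg (u ⊛ xp n)) ,Φ ⊕-cancelʳ (g ⊛ (u ⊛ xp n)) (xp n) _ (begin
    xp n ⊕ g ⊛ (u ⊛ xp n)  ≈⟨ ⊕-congʳ (⊛-idˡ (xp n)) ⟨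
    𝟙 ⊛ xp n ⊕ g ⊛ (u ⊛ xp n)  ≈⟨ ∣-sub 𝟙 g u (xp n) ⟨
    (𝟙 ⊕ g ⊛ u) ⊛ xp n  ≈⟨ ⊛-congʳ {xp n} e ⟨
    xp m ⊛ xp n  ≈⟨ CommutativeRing.*-comm PolyRing (xp m) (xp n) ⟩
    xp n ⊛ xp m  ≈⟨ xp-+ n m ⟨
    xp (n + m)  ≈⟨ e′ ⟩
    𝟙 ⊕ g ⊛ w  ≈⟨ ⊕-congˡ {𝟙} (⊛-congˡ {g} (≈-trans (≈-sym (⊕-idʳ w)) (⊕-congˡ {w} (≈-sym (neg-invˡ (u ⊛ xp n)))))) ⟩
    𝟙 ⊕ g ⊛ (w ⊕ (neg (u ⊛ xp n) ⊕ u ⊛ xp n))  ≈⟨ ⊕-congˡ {𝟙} (⊛-assoc-distrib g w (neg (u ⊛ xp n)) (u ⊛ xp n)) ⟩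
    𝟙 ⊕ (g ⊛ (w ⊕ neg (u ⊛ xp n)) ⊕ g ⊛ (u ⊛ xp n)) ≈⟨ CommutativeRing.+-assoc PolyRing 𝟙 (g ⊛ (w ⊕ neg (u ⊛ xp n))) (g ⊛ (u ⊛ xp n)) ⟨
    𝟙 ⊕ g ⊛ (w ⊕ neg (u ⊛ xp n)) ⊕ g ⊛ (u ⊛ xp n)  ∎)
    where open SetoidR ≈-setoid

  -- The exponents n for which g divides x^n - 1 are closed under sums and differences, so Bézout's
  -- identity applies.
  ∣Φ-gcd : ∀ {g} m n → g ∣Φ m → g ∣Φ n → g ∣Φ gcd m n
  ∣Φ-gcd {g} m n dm dn with Bézout.identity (gcd-GCD m n)
  ... | Bézout.+- x y e = ∣Φ-∸ (∣Φ-* y dn) (subst (g ∣Φ_) (sym e) (∣Φ-* x dm))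
  ... | Bézout.-+ x y e = ∣Φ-∸ (∣Φ-* x dm) (subst (g ∣Φ_) (sym e) (∣Φ-* y dn))

  ∣Φ⇒deg≤ : ∀ {g d n} .{{_ : NonZero n}} → HasDeg g d → g ∣Φ n → d ≤ n
  ∣Φ⇒deg≤ {g} {d} {n} hg gn with ∣Φ⇒divides gn
  ... | h , e with zero-or-deg′ h
  ...   | inj₁ z = contradiction (≈-trans (≈-sym e) (≈-trans (⊛-congˡ {g} z) (⊛-zeroʳ g))) (HasDeg-≉0 (HasDeg-Φ n))
  ...   | inj₂ (b , hh) = subst (d ≤_) (HasDeg-unique (HasDeg-≈ e (HasDeg-⊛ hg hh)) (HasDeg-Φ n)) (m≤m+n d b)

-- Finite checks over F_2 and F_3

module Tables (p : ℕ) (pr : Prime p) where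
  private instance
    p≢0 : NonZero p
    p≢0 = prime⇒nonZero pr
  open Mod p
  open Sub p
  open Domain p pr
  open Kernel p pr
  open Practicality p pr

  eqᵇ : Poly → Poly → Bool
  eqᵇ []      []      = true
  eqᵇ []      (b ∷ g) = (0 ≡ᵇ b % p) ∧ eqᵇ [] g
  eqᵇ (a ∷ f) []      = (a % p ≡ᵇ 0) ∧ eqᵇ f []
  eqᵇ (a ∷ f) (b ∷ g) = (a % p ≡ᵇ b % p) ∧ eqᵇ f g

  ∷-≈ : ∀ {a b f g} → a ~ b → f ≈ g → a ∷ f ≈ b ∷ g
  ∷-≈ e e′ = ptw λ { zero → e ; (suc k) → e′ at k }

  0%p : 0 % p ≡ 0
  0%p = m*n%n≡0 0 p

  eqᵇ-sound : ∀ f g → True (eqᵇ f g) → f ≈ g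
  eqᵇ-sound []      []      t = ≈-refl
  eqᵇ-sound []      (b ∷ g) t = let (t₁ , t₂) = Equivalence.to T-∧ t in
    ptw λ { zero → %⇒~ (trans 0%p (≡ᵇ⇒≡ 0 (b % p) t₁)) ; (suc k) → eqᵇ-sound [] g t₂ at k }
  eqᵇ-sound (a ∷ f) []      t = let (t₁ , t₂) = Equivalence.to T-∧ t in
    ptw λ { zero → %⇒~ (trans (≡ᵇ⇒≡ (a % p) 0 t₁) (sym 0%p)) ; (suc k) → eqᵇ-sound f [] t₂ at k }
  eqᵇ-sound (a ∷ f) (b ∷ g) t = let (t₁ , t₂) = Equivalence.to T-∧ t in
    ∷-≈ (%⇒~ (≡ᵇ⇒≡ (a % p) (b % p) t₁)) (eqᵇ-sound f g t₂)

  -- Long division of t by g from the constant term, correct when the constant term of g is its own inverse.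
  series : Poly → ℕ → Poly → Poly
  series g zero    t = []
  series g (suc n) t = c ∷ series g n (drop 1 (map (_% p) (t ⊕ (p ∸ c) ⊙ g)))
    where
    c : ℕ
    c = (coeff t 0 * coeff g 0) % p

  cofactor : Poly → ℕ → Poly
  cofactor g n = series g (suc n) (Φ n)

  divisorᵇ : Poly → ℕ → Bool
  divisorᵇ g n = eqᵇ (xp n) (𝟙 ⊕ g ⊛ cofactor g n)

  divisorᵇ-sound : ∀ {g} n → True (divisorᵇ g n) → g ∣Φ n
  divisorᵇ-sound {g} n t = cofactor g n ,Φ eqᵇ-sound _ _ t

  reduce : ℕ → (ℕ → ℕ) → Poly
  reduce zero    c = []
  reduce (suc n) c = c 0 % p ∷ reduce n (c ∘ suc)

  coeff-reduce : ∀ n c k → k < n → coeff (reduce n c) k ≡ c k % p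
  coeff-reduce (suc n) c zero    lt       = refl
  coeff-reduce (suc n) c (suc k) (s≤s lt) = coeff-reduce n (c ∘ suc) k lt

  reduce-≈ : ∀ n f → DegLt n f → reduce n (coeff f) ≈ f
  reduce-≈ n f v = ptw (go n (coeff f) v)
    where
    go : ∀ n c → (∀ k → n ≤ k → c k ~ 0) → ∀ k → coeff (reduce n c) k ~ c k
    go zero    c v k       = ~-sym (v k z≤n)
    go (suc n) c v zero    = a%p~a (c 0)
    go (suc n) c v (suc k) = go n (c ∘ suc) (λ k le → v (suc k) (s≤s le)) k

  allBelow : ℕ → (ℕ → Bool) → Bool
  allBelow zero    Q = true
  allBelow (suc n) Q = Q n ∧ allBelow n Q

  allBelow-sound : ∀ n Q → True (allBelow n Q) → ∀ a → a < n → True (Q a)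
  allBelow-sound (suc n) Q t a lt with Equivalence.to T-∧ t | m≤n⇒m<n∨m≡n (≤-pred lt)
  ... | t₁ , t₂ | inj₁ lt′  = allBelow-sound n Q t₂ a lt′
  ... | t₁ , t₂ | inj₂ refl = t₁

  allReduced : ℕ → (Poly → Bool) → Bool
  allReduced zero    Q = Q []
  allReduced (suc n) Q = allBelow p (λ a → allReduced n (λ f → Q (a ∷ f)))

  allReduced-sound : ∀ n Q → True (allReduced n Q) → ∀ c → True (Q (reduce n c))
  allReduced-sound zero    Q t c = t
  allReduced-sound (suc n) Q t c = allReduced-sound n (λ f → Q (c 0 % p ∷ f))
    (allBelow-sound p (λ a → allReduced n (λ f → Q (a ∷ f))) t (c 0 % p) (m%n<n (c 0) p)) (c ∘ suc)

  someExponent : List ℕ → Poly → Bool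
  someExponent []       g = false
  someExponent (e ∷ es) g = divisorᵇ g e ∨ someExponent es g

  someExponent-sound : ∀ {E} es g → All (_∣ E) es → True (someExponent es g) → ∃ λ e → e ∣ E × g ∣Φ e
  someExponent-sound (e ∷ es) g (d ∷ ds) t with Equivalence.to T-∨ t
  ... | inj₁ t₁ = e , d , divisorᵇ-sound e t₁
  ... | inj₂ t₂ = someExponent-sound es g ds t₂

  check : ℕ → List ℕ → Poly → Bool
  check D es g = (coeff g 0 ≡ᵇ 0) ∨ ((coeff g D ≡ᵇ 0) ∨ someExponent es g)

  lead≢0 : ∀ {g D} → HasDeg g D → coeff g D % p ≢ 0
  lead≢0 h z = lead h (%⇒~ (trans z (sym 0%p)))

  constant≢0 : ∀ {g n} .{{_ : NonZero n}} → g ∣Φ n → coeff g 0 % p ≢ 0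
  constant≢0 {g} {suc n} (u ,Φ e) z = HasDeg-≉0 (HasDeg-1 1<p) (ptw λ
    { zero → ~-trans (~-sym (~-trans (~-reflexive (trans (coeff-⊕ 𝟙 (g ⊛ u) 0) (cong (1 +_) (coeff-⊛ g u 0))))
        (~-+ {1} {1} ~-refl (~-* {coeff g 0} {0} (%⇒~ (trans z (sym 0%p))) ~-refl)))) (~-sym (e at 0))
    ; (suc k) → ~-refl })

  ∣Φ-≈ : ∀ {f g n} → f ≈ g → f ∣Φ n → g ∣Φ n
  ∣Φ-≈ e (u ,Φ e′) = u ,Φ ≈-trans e′ (⊕-congˡ {𝟙} (⊛-congʳ {u} e))

  -- The table shows that a polynomial of degree D with nonzero constant term divides x^e - 1 for
  -- some e in `es`. A divisor of x^n - 1 is of this kind, hence divides x^gcd(n, e) - 1, whose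
  -- degree is at most gcd(n, E) < D.
  no-divisor : ∀ D es E → True (allReduced (suc D) (check D es)) → All (_∣ E) es → .{{_ : NonZero E}} →
    ∀ n .{{_ : NonZero n}} → gcd n E < D → D ≤ n → ¬ PPractical p n
  no-divisor D es E t ds n lt D≤n P with PPractical⇒divisor P D (≤-trans (s≤s z≤n) lt) D≤n
  ... | g , h , hg , gh = go (Equivalence.to T-∨ checked)
    where
    instance
      gcd≢0 : NonZero (gcd n E)
      gcd≢0 = ≢-nonZero (gcd[m,n]≢0 n E (inj₁ (≢-nonZero⁻¹ n)))
    gn : g ∣Φ n
    gn = divides⇒∣Φ gh
    r : Poly
    r = reduce (suc D) (coeff g)
    checked : True (check D es r)
    checked = allReduced-sound (suc D) (check D es) t (coeff g)
    fin : (∃ λ e → e ∣ E × r ∣Φ e) → ⊥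
    fin (e , e∣E , re) = <⇒≱ lt (≤-trans (∣Φ⇒deg≤ {{≢-nonZero (gcd[m,n]≢0 n e (inj₁ (≢-nonZero⁻¹ n)))}} hg
        (∣Φ-gcd n e gn (∣Φ-≈ (reduce-≈ (suc D) g (above hg)) re)))
      (∣⇒≤ (gcd-greatest {m = n} {n = E} (gcd[m,n]∣m n e) (∣-trans (gcd[m,n]∣n n e) e∣E))))
    go : True (coeff r 0 ≡ᵇ 0) ⊎ True ((coeff r D ≡ᵇ 0) ∨ someExponent es r) → ⊥
    go (inj₁ z) = constant≢0 gn (≡ᵇ⇒≡ _ 0 z)
    go (inj₂ t′) with Equivalence.to T-∨ t′
    ... | inj₁ z  = lead≢0 hg (trans (sym (coeff-reduce (suc D) (coeff g) D (n<1+n D))) (≡ᵇ⇒≡ _ 0 z))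
    ... | inj₂ t″ = fin (someExponent-sound es r ds t″)

  divisorTable : (ℕ → Poly) → ℕ → Bool
  divisorTable G n = allBelow (suc n) (λ d → (length (G d) ≡ᵇ suc d) ∧ ((coeff (G d) d % p ≡ᵇ 1) ∧ divisorᵇ (G d) n))

  divisorTable⇒practical : ∀ G n → True (divisorTable G n) → Practical n
  divisorTable⇒practical G n t d d≤n with allBelow-sound (suc n) _ t d (s≤s d≤n)
  ... | t′ with Equivalence.to T-∧ t′
  ...   | len , t″ with Equivalence.to T-∧ t″
  ...     | top , div = G d , proj₁ dv , deg (λ z → 0≢1+n (trans (sym 0%p) (trans (sym (~⇒% z)) (≡ᵇ⇒≡ _ 1 top))))
                          (λ k le → DegLt-length (G d) k (subst (_≤ k) (sym (≡ᵇ⇒≡ _ (suc d) len)) le)) , proj₂ dv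
    where
    dv : ∃ λ h → G d ⊛ h ≈ Φ n
    dv = ∣Φ⇒divides (divisorᵇ-sound {G d} n div)

prime[3] : Prime 3
prime[3] = from-yes (prime? 3)

-- Over F_2, x² + 1 divides x^2 - 1 and x² + x + 1 divides x^3 - 1; no other quadratic has a nonzero
-- constant term.
not-2-practical : ∀ n .{{_ : NonZero n}} → gcd n 6 ≡ 1 → 2 ≤ n → ¬ PPractical 2 n
not-2-practical n e 2≤n = Tables.no-divisor 2 prime[2] 2 (2 ∷ 3 ∷ []) 6 tt (divides 3 refl ∷ divides 2 refl ∷ []) n (subst (_< 2) (sym e) (s≤s (s≤s z≤n))) 2≤n

-- A multiple of 3 has divisors of degrees 1, 2 and 3 over F_2, so degree 4 is the first that can
-- fail. Exponent 4 serves (x + 1)^4, 6 the products involving x² + x + 1, 7 a linear times a cubic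
-- factor, 15 the irreducible quartics; 420 is their least common multiple.
not-2-practical′ : ∀ n .{{_ : NonZero n}} → gcd n 420 ≡ 3 → 4 ≤ n → ¬ PPractical 2 n
not-2-practical′ n e 4≤n = Tables.no-divisor 2 prime[2] 4 (4 ∷ 6 ∷ 7 ∷ 15 ∷ []) 420 tt
  (divides 105 refl ∷ divides 70 refl ∷ divides 60 refl ∷ divides 28 refl ∷ []) n (subst (_< 4) (sym e) (s≤s (s≤s (s≤s (s≤s z≤n))))) 4≤n

-- Over F_3 an even n has divisors of degrees 1 and 2. For cubics, exponent 6 serves products of
-- linear factors, 8 a linear times an irreducible quadratic, 26 the irreducible cubics; 312 is the
-- least common multiple.
not-3-practical : ∀ n .{{_ : NonZero n}} → gcd n 312 ≡ 2 → 3 ≤ n → ¬ PPractical 3 n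
not-3-practical n e 3≤n = Tables.no-divisor 3 prime[3] 3 (6 ∷ 8 ∷ 26 ∷ []) 312 tt
  (divides 52 refl ∷ divides 39 refl ∷ divides 12 refl ∷ []) n (subst (_< 3) (sym e) (s≤s (s≤s (s≤s z≤n)))) 3≤n

-- x^14 - 1 = a² b² c² over F_2. Products of the cubics b and c give degrees 0, 3, 6, 9, 12, and
-- powers of the linear a fill the gaps.
practical-14 : Practicality.Practical 2 prime[2] 14
practical-14 = Tables.divisorTable⇒practical 2 prime[2] G 14 tt
  where
  a b c : Poly
  a = 1 ∷ 1 ∷ []
  b = 1 ∷ 1 ∷ 0 ∷ 1 ∷ []
  c = 1 ∷ 0 ∷ 1 ∷ 1 ∷ []
  small : ℕ → Poly
  small 0 = 1 ∷ []
  small 1 = a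
  small _ = a ⊛ a
  G : ℕ → Poly
  G 0 = small 0
  G 1 = small 1
  G 2 = small 2
  G (suc (suc (suc d))) with d
  ... | 0 = small 0 ⊛ b
  ... | 1 = small 1 ⊛ b
  ... | 2 = small 2 ⊛ b
  ... | 3 = small 0 ⊛ (b ⊛ b)
  ... | 4 = small 1 ⊛ (b ⊛ b)
  ... | 5 = small 2 ⊛ (b ⊛ b)
  ... | 6 = small 0 ⊛ (b ⊛ b ⊛ c)
  ... | 7 = small 1 ⊛ (b ⊛ b ⊛ c)
  ... | 8 = small 2 ⊛ (b ⊛ b ⊛ c)
  ... | 9 = small 0 ⊛ (b ⊛ b ⊛ (c ⊛ c))
  ... | 10 = small 1 ⊛ (b ⊛ b ⊛ (c ⊛ c))
  ... | _ = small 2 ⊛ (b ⊛ b ⊛ (c ⊛ c))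

-- Sums over primes

abstract
  isPrime? : ∀ n → Dec (Prime n)
  isPrime? = prime?

byDec : ∀ {P A : Set} → Dec P → A → A → A
byDec (yes _) x y = x
byDec (no  _) x y = y

Σₚ : (ℕ → ℕ) → ℕ → ℕ
Σₚ f zero    = 0
Σₚ f (suc n) = Σₚ f n + byDec (isPrime? (suc n)) (f (suc n)) 0

Πₚ : (ℕ → ℕ) → ℕ → ℕ
Πₚ f zero    = 1
Πₚ f (suc n) = Πₚ f n * byDec (isPrime? (suc n)) (f (suc n)) 1

prime>1 : ∀ {q} → Prime q → 1 < q
prime>1 {q} pr = nonTrivial⇒n>1 q {{prime⇒nonTrivial pr}}

Σₚ-mono : ∀ {f g} N → (∀ q → Prime q → q ≤ N → f q ≤ g q) → Σₚ f N ≤ Σₚ g N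
Σₚ-mono zero    le = z≤n
Σₚ-mono (suc N) le with isPrime? (suc N)
... | yes pr = +-mono-≤ (Σₚ-mono N (λ q pr q≤ → le q pr (m≤n⇒m≤1+n q≤))) (le (suc N) pr ≤-refl)
... | no  _  = +-monoˡ-≤ 0 (Σₚ-mono N (λ q pr q≤ → le q pr (m≤n⇒m≤1+n q≤)))

Σₚ-+ : ∀ f g N → Σₚ (λ q → f q + g q) N ≡ Σₚ f N + Σₚ g N
Σₚ-+ f g zero    = refl
Σₚ-+ f g (suc N) rewrite Σₚ-+ f g N with isPrime? (suc N)
... | yes _ = lem (Σₚ f N) (Σₚ g N) (f (suc N)) (g (suc N))
  where
  lem : ∀ a b c d → a + b + (c + d) ≡ a + c + (b + d)
  lem = solve-∀
... | no  _ = lem (Σₚ f N) (Σₚ g N)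
  where
  lem : ∀ a b → a + b + 0 ≡ a + 0 + (b + 0)
  lem = solve-∀

Σₚ-* : ∀ c f N → Σₚ (λ q → c * f q) N ≡ c * Σₚ f N
Σₚ-* c f zero    = sym (*-zeroʳ c)
Σₚ-* c f (suc N) rewrite Σₚ-* c f N with isPrime? (suc N)
... | yes _ = sym (*-distribˡ-+ c (Σₚ f N) (f (suc N)))
... | no  _ = lem c (Σₚ f N)
  where
  lem : ∀ c a → c * a + 0 ≡ c * (a + 0)
  lem = solve-∀

Πₚ-mono : ∀ {f g} N → (∀ q → Prime q → q ≤ N → f q ≤ g q) → Πₚ f N ≤ Πₚ g N
Πₚ-mono zero    le = ≤-refl
Πₚ-mono (suc N) le with isPrime? (suc N)
... | yes pr = *-mono-≤ (Πₚ-mono N (λ q pr q≤ → le q pr (m≤n⇒m≤1+n q≤))) (le (suc N) pr ≤-refl)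
... | no  _  = *-monoˡ-≤ 1 (Πₚ-mono N (λ q pr q≤ → le q pr (m≤n⇒m≤1+n q≤)))

Πₚ-cong : ∀ {f g} N → (∀ q → Prime q → q ≤ N → f q ≡ g q) → Πₚ f N ≡ Πₚ g N
Πₚ-cong N e = ≤-antisym (Πₚ-mono N (λ q pr le → ≤-reflexive (e q pr le))) (Πₚ-mono N (λ q pr le → ≤-reflexive (sym (e q pr le))))

Πₚ-* : ∀ f g N → Πₚ (λ q → f q * g q) N ≡ Πₚ f N * Πₚ g N
Πₚ-* f g zero    = refl
Πₚ-* f g (suc N) rewrite Πₚ-* f g N with isPrime? (suc N)
... | yes _ = lem (Πₚ f N) (Πₚ g N) (f (suc N)) (g (suc N))
  where
  lem : ∀ a b c d → a * b * (c * d) ≡ a * c * (b * d)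
  lem = solve-∀
... | no  _ = lem (Πₚ f N) (Πₚ g N)
  where
  lem : ∀ a b → a * b * 1 ≡ a * 1 * (b * 1)
  lem = solve-∀

Πₚ-^ : ∀ a e N → Πₚ (λ q → a ^ e q) N ≡ a ^ Σₚ e N
Πₚ-^ a e zero    = refl
Πₚ-^ a e (suc N) rewrite Πₚ-^ a e N with isPrime? (suc N)
... | yes _ = sym (^-distribˡ-+-* a (Σₚ e N) (e (suc N)))
... | no  _ = sym (^-distribˡ-+-* a (Σₚ e N) 0)

Πₚ-1 : ∀ N → Πₚ (λ _ → 1) N ≡ 1
Πₚ-1 zero    = refl
Πₚ-1 (suc N) rewrite Πₚ-1 N with isPrime? (suc N)
... | yes _ = refl
... | no  _ = refl

Πₚ-pow : ∀ f k N → Πₚ (λ q → f q ^ k) N ≡ Πₚ f N ^ k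
Πₚ-pow f zero    N = Πₚ-1 N
Πₚ-pow f (suc k) N = trans (Πₚ-* f (λ q → f q ^ k) N) (cong (Πₚ f N *_) (Πₚ-pow f k N))

Πₚ-single : ∀ {f g} q₀ N → Prime q₀ → q₀ ≤ N → f q₀ ≡ q₀ * g q₀ → (∀ q → Prime q → q ≢ q₀ → f q ≡ g q) → Πₚ f N ≡ q₀ * Πₚ g N
Πₚ-single q₀ zero pr q₀≤ e₀ e = contradiction (<⇒≤ (prime>1 pr)) (<⇒≱ (s≤s q₀≤))
Πₚ-single {f} {g} q₀ (suc N) pr q₀≤ e₀ e with q₀ ≟ suc N | isPrime? (suc N)
... | yes refl | no ¬pr = contradiction pr ¬pr
... | yes refl | yes _  = begin
  Πₚ f N * f q₀  ≡⟨ cong₂ _*_ (Πₚ-cong N (λ q pr q≤ → e q pr (<⇒≢ (s≤s q≤)))) e₀ ⟩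
  Πₚ g N * (q₀ * g q₀)  ≡⟨ lem (Πₚ g N) q₀ (g q₀) ⟩
  q₀ * (Πₚ g N * g q₀)  ∎
  where
  open ≡-Reasoning
  lem : ∀ a b c → a * (b * c) ≡ b * (a * c)
  lem = solve-∀
... | no ≢ | d = trans (cong₂ _*_ (Πₚ-single q₀ N pr (≤-pred (≤∧≢⇒< q₀≤ ≢)) e₀ e) (same d)) (*-assoc q₀ (Πₚ g N) _)
  where
  same : ∀ d → byDec d (f (suc N)) 1 ≡ byDec d (g (suc N)) 1
  same (yes pr′) = e (suc N) pr′ (λ z → ≢ (sym z))
  same (no _)    = refl

-- Both recursions carry explicit fuel; all that the count of multiples needs holds for any amount of it.
valuation : ℕ → ℕ → ℕ → ℕ
valuation zero    q m = 0
valuation (suc f) zero m = 0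
valuation (suc f) q@(suc _) m = byDec (q ∣? m) (1 + valuation f q (m / q)) 0

legendre : ℕ → ℕ → ℕ → ℕ
legendre zero    q N = 0
legendre (suc f) zero N = 0
legendre (suc f) q@(suc _) N = N / q + legendre f q (N / q)

legendre-0 : ∀ f q → legendre f q 0 ≡ 0
legendre-0 zero    q = refl
legendre-0 (suc f) zero = refl
legendre-0 (suc f) q@(suc _) = legendre-0 f q

quotient-step : ∀ q .{{_ : NonZero q}} N k → suc N ≡ suc k * q → N / q ≡ k × suc N / q ≡ suc k
quotient-step q@(suc r) N k e = trans (cong (_/ q) N≡) (trans (+-distrib-/-∣ʳ r (divides-refl k)) (cong₂ _+_ (m<n⇒m/n≡0 (n<1+n r)) (m*n/n≡m k q))) ,
  trans (cong (_/ q) e) (m*n/n≡m (suc k) q)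
  where
  N≡ : N ≡ r + k * q
  N≡ = suc-injective e

quotient-same : ∀ q .{{_ : NonZero q}} N → ¬ q ∣ suc N → suc N / q ≡ N / q
quotient-same q N ¬d = begin
  suc N / q  ≡⟨ cong (λ z → suc z / q) (m≡m%n+[m/n]*n N q) ⟩
  (suc (N % q) + N / q * q) / q  ≡⟨ +-distrib-/-∣ʳ (suc (N % q)) (divides-refl (N / q)) ⟩
  suc (N % q) / q + (N / q * q) / q  ≡⟨ cong₂ _+_ (m<n⇒m/n≡0 lt) (m*n/n≡m (N / q) q) ⟩
  N / q  ∎
  where
  open ≡-Reasoning
  lt : suc (N % q) < q
  lt = ≤∧≢⇒< (m%n<n N q) λ e → ¬d (divides (suc (N / q)) (trans (cong suc (m≡m%n+[m/n]*n N q)) (cong (_+ N / q * q) e)))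

legendre-suc : ∀ f q N → legendre f q (suc N) ≡ legendre f q N + valuation f q (suc N)
legendre-suc zero    q N = refl
legendre-suc (suc f) zero N = refl
legendre-suc (suc f) q@(suc _) N with q ∣? suc N
... | no ¬d rewrite quotient-same q N ¬d = sym (+-identityʳ _)
... | yes (divides (suc k) e) rewrite proj₁ (quotient-step q N k e) | proj₂ (quotient-step q N k e) | legendre-suc f q k =
  lem k (legendre f q k) (valuation f q (suc k))
  where
  lem : ∀ k a b → suc k + (a + b) ≡ k + a + (1 + b)
  lem = solve-∀

valuation-stable : ∀ f q m .{{_ : NonZero m}} → 1 < q → m ≤ f → valuation (suc f) q m ≡ valuation f q m
valuation-stable zero    q m 1<q m≤0 = contradiction (n≤0⇒n≡0 m≤0) (≢-nonZero⁻¹ m)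
valuation-stable (suc f) q@(suc _) m 1<q m≤f with q ∣? m
... | no  _ = refl
... | yes d = cong suc (valuation-stable f q (m / q) {{≢-nonZero λ z → ≢-nonZero⁻¹ m (trans (sym (m/n*n≡m d)) (cong (_* q) z))}} 1<q
    (≤-pred (≤-trans (m/n<m m q 1<q) m≤f)))

valuation-other : ∀ f {q q₀} m → Prime q → Prime q₀ → q ≢ q₀ → valuation f q (q₀ * m) ≡ valuation f q m
valuation-other zero    m pr pr₀ ≢ = refl
valuation-other (suc f) {zero} m pr pr₀ ≢ = refl
valuation-other (suc f) {q@(suc _)} {q₀} m pr pr₀ ≢ with q ∣? q₀ * m | q ∣? m
... | yes d | yes d′ = cong suc (trans (cong (valuation f q) (*-/-assoc q₀ d′)) (valuation-other f (m / q) pr pr₀ ≢))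
... | no ¬d | no  _  = refl
... | no ¬d | yes d′ = contradiction (∣n⇒∣m*n q₀ d′) ¬d
... | yes d | no ¬d′ = contradiction (euclidsLemma q₀ m pr d) λ
  { (inj₁ q∣q₀) → [ (λ { refl → contradiction pr ¬prime[1] }) , ≢ ]′ (prime⇒irreducible pr₀ q∣q₀)
  ; (inj₂ q∣m)  → ¬d′ q∣m }

valuation-self : ∀ f q .{{_ : NonZero q}} m → valuation (suc f) q (q * m) ≡ 1 + valuation f q m
valuation-self f q@(suc _) m with q ∣? q * m
... | no ¬d = contradiction (m∣m*n m) ¬d
... | yes _ = cong (λ z → suc (valuation f q z)) (trans (cong (_/ q) (*-comm q m)) (m*n/n≡m m q))

valuation-1 : ∀ f q → 1 < q → valuation f q 1 ≡ 0
valuation-1 zero    q 1<q = refl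
valuation-1 (suc f) q@(suc _) 1<q with q ∣? 1
... | yes d = contradiction (∣⇒≤ d) (<⇒≱ 1<q)
... | no  _ = refl

prime-divisor : ∀ m → 1 < m → ∃ λ q → Prime q × q ∣ m
prime-divisor m 1<m with factorise m {{>-nonZero (<-trans (s≤s z≤n) 1<m)}}
... | record { factors = [] ; isFactorisation = e } = contradiction e (λ z → <⇒≢ 1<m (sym z))
... | record { factors = q ∷ qs ; isFactorisation = e ; factorsPrime = pr ∷ _ } = q , pr , divides (product qs) (trans e (*-comm q _))

factorisation : ∀ F f m .{{_ : NonZero m}} → m ≤ f → m ≤ F → Πₚ (λ q → q ^ valuation f q m) F ≡ m
factorisation F zero    m m≤f m≤F = contradiction (n≤0⇒n≡0 m≤f) (≢-nonZero⁻¹ m)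
factorisation F (suc f) m m≤f m≤F with m ≟ 1
... | yes refl = trans (Πₚ-cong F (λ q pr _ → cong (q ^_) (valuation-1 (suc f) q (prime>1 pr)))) (Πₚ-1 F)
... | no m≢1 with prime-divisor m (≤∧≢⇒< (>-nonZero⁻¹ m) (λ z → m≢1 (sym z)))
...   | q₀ , pr₀ , divides m′ refl = begin
  Πₚ (λ q → q ^ valuation (suc f) q (m′ * q₀)) F
    ≡⟨ Πₚ-single q₀ F pr₀ (≤-trans (m≤n*m q₀ m′) m≤F)
         (cong (q₀ ^_) (trans (cong (valuation (suc f) q₀) (*-comm m′ q₀)) (valuation-self f q₀ m′)))
         (λ q pr ≢ → cong (q ^_) (trans (cong (valuation (suc f) q) (*-comm m′ q₀)) (trans (valuation-other (suc f) m′ pr pr₀ ≢) (valuation-stable f q m′ (prime>1 pr) m′≤f)))) ⟩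
  q₀ * Πₚ (λ q → q ^ valuation f q m′) F  ≡⟨ cong (q₀ *_) (factorisation F f m′ m′≤f (≤-trans (<⇒≤ m′<m) m≤F)) ⟩
  q₀ * m′  ≡⟨ *-comm q₀ m′ ⟩
  m′ * q₀  ∎
  where
  open ≡-Reasoning
  instance
    m′≢0 : NonZero m′
    m′≢0 = m*n≢0⇒m≢0 m′
    q₀≢0 : NonZero q₀
    q₀≢0 = prime⇒nonZero pr₀
  m′<m : m′ < m′ * q₀
  m′<m = m<m*n m′ q₀ (prime>1 pr₀)
  m′≤f : m′ ≤ f
  m′≤f = ≤-pred (≤-trans m′<m m≤f)

legendre-formula : ∀ F N → N ≤ F → Πₚ (λ q → q ^ legendre F q N) F ≡ N !
legendre-formula F zero    _  = trans (Πₚ-cong F (λ q _ _ → cong (q ^_) (legendre-0 F q))) (Πₚ-1 F)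
legendre-formula F (suc N) N< = begin
  Πₚ (λ q → q ^ legendre F q (suc N)) F
    ≡⟨ Πₚ-cong F (λ q _ _ → trans (cong (q ^_) (legendre-suc F q N)) (^-distribˡ-+-* q (legendre F q N) (valuation F q (suc N)))) ⟩
  Πₚ (λ q → q ^ legendre F q N * q ^ valuation F q (suc N)) F
    ≡⟨ Πₚ-* (λ q → q ^ legendre F q N) (λ q → q ^ valuation F q (suc N)) F ⟩
  Πₚ (λ q → q ^ legendre F q N) F * Πₚ (λ q → q ^ valuation F q (suc N)) F
    ≡⟨ cong₂ _*_ (legendre-formula F N (<⇒≤ N<)) (factorisation F F (suc N) N< N<) ⟩
  N ! * suc N  ≡⟨ *-comm (N !) (suc N) ⟩
  suc N !  ∎
  where open ≡-Reasoning

-- The geometric series N / q + N / q² + ... has sum N / (q - 1).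
legendre-upper : ∀ f q .{{_ : NonZero q}} N → (q ∸ 1) * legendre f q N ≤ N
legendre-upper zero    q N = ≤-trans (≤-reflexive (*-zeroʳ (q ∸ 1))) z≤n
legendre-upper (suc f) q@(suc r) N = begin
  r * (N / q + legendre f q (N / q))  ≡⟨ *-distribˡ-+ r (N / q) _ ⟩
  r * (N / q) + r * legendre f q (N / q)  ≤⟨ +-monoʳ-≤ (r * (N / q)) (legendre-upper f q (N / q)) ⟩
  r * (N / q) + N / q  ≡⟨ lem r (N / q) ⟩
  N / q * q  ≤⟨ m/n*n≤m N q ⟩
  N  ∎
  where
  open ≤-Reasoning
  lem : ∀ r k → r * k + k ≡ k * suc r
  lem = solve-∀

legendre-lower : ∀ f q .{{_ : NonZero q}} N → N / q ≤ legendre (suc f) q N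
legendre-lower f q@(suc _) N = m≤m+n (N / q) _

-- In the exponent of q in a! / (b!)², each power of q up to a contributes at most 1, so that the
-- part of q is at most a. The hypothesis a ≤ 2 b + 1 survives division by q, which allows recursion
-- along the powers.
legendre-central : ∀ f q → 1 < q → ∀ a b → 1 ≤ a → a ≤ 2 * b + 1 → q ^ legendre f q a ≤ a * q ^ (2 * legendre f q b)
legendre-central zero    q 1<q a b 1≤a a≤ = ≤-trans 1≤a (≤-reflexive (sym (*-identityʳ a)))
legendre-central (suc f) q@(suc r) 1<q a b 1≤a a≤ with a <? q
... | yes a<q rewrite m<n⇒m/n≡0 a<q | legendre-0 f q = ≤-trans 1≤a (m≤m*n a _ {{m^n≢0 q (2 * (b / q + legendre f q (b / q)))}})
... | no a≮q = begin
  q ^ (a′ + legendre f q a′)  ≤⟨ ^-monoʳ-≤ q (+-monoˡ-≤ (legendre f q a′) a′≤) ⟩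
  q ^ (2 * b′ + 1 + legendre f q a′)  ≡⟨ ^-distribˡ-+-* q (2 * b′ + 1) (legendre f q a′) ⟩
  q ^ (2 * b′ + 1) * q ^ legendre f q a′  ≤⟨ *-monoʳ-≤ (q ^ (2 * b′ + 1)) (legendre-central f q 1<q a′ b′ 1≤a′ a′≤) ⟩
  q ^ (2 * b′ + 1) * (a′ * q ^ (2 * legendre f q b′))  ≡⟨ cong (_* (a′ * q ^ (2 * legendre f q b′))) (trans (^-distribˡ-+-* q (2 * b′) 1) (cong (q ^ (2 * b′) *_) (^-identityʳ q))) ⟩
  q ^ (2 * b′) * q * (a′ * q ^ (2 * legendre f q b′))  ≡⟨ lem (q ^ (2 * b′)) q a′ (q ^ (2 * legendre f q b′)) ⟩
  a′ * q * (q ^ (2 * b′) * q ^ (2 * legendre f q b′))  ≤⟨ *-monoˡ-≤ _ (m/n*n≤m a q) ⟩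
  a * (q ^ (2 * b′) * q ^ (2 * legendre f q b′))  ≡⟨ cong (a *_) (sym (trans (cong (q ^_) (*-distribˡ-+ 2 b′ (legendre f q b′))) (^-distribˡ-+-* q (2 * b′) (2 * legendre f q b′)))) ⟩
  a * q ^ (2 * (b′ + legendre f q b′))  ∎
  where
  open ≤-Reasoning
  a′ b′ : ℕ
  a′ = a / q
  b′ = b / q
  1≤a′ : 1 ≤ a′
  1≤a′ = m≥n⇒m/n>0 (≮⇒≥ a≮q)
  lem : ∀ x q a y → x * q * (a * y) ≡ a * q * (x * y)
  lem = solve-∀
  a′≤ : a′ ≤ 2 * b′ + 1
  a′≤ = ≤-pred (m<n*o⇒m/o<n {a} {suc (2 * b′ + 1)} {q} (begin-strict
    a  ≤⟨ a≤ ⟩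
    2 * b + 1  <⟨ n<1+n _ ⟩
    suc (2 * b + 1)  ≡⟨ lem₂ b ⟩
    2 * suc b  ≤⟨ *-monoʳ-≤ 2 (b< b) ⟩
    2 * (suc (b / q) * q)  ≡⟨ lem₃ (b / q) q ⟩
    suc (2 * b′ + 1) * q  ∎))
    where
    lem₂ : ∀ b → suc (2 * b + 1) ≡ 2 * suc b
    lem₂ = solve-∀
    lem₃ : ∀ b q → 2 * (suc b * q) ≡ suc (2 * b + 1) * q
    lem₃ = solve-∀
    b< : ∀ b → suc b ≤ suc (b / q) * q
    b< b = ≤-trans (s≤s (≤-reflexive (m≡m%n+[m/n]*n b q))) (+-monoˡ-≤ (b / q * q) (m%n<n b q))

-- Binary logarithm, factorials and Chebyshev's bound

^-distribʳ-* : ∀ k m n → (m * n) ^ k ≡ m ^ k * n ^ k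
^-distribʳ-* zero    m n = refl
^-distribʳ-* (suc k) m n = trans (cong (m * n *_) (^-distribʳ-* k m n)) (lem m n (m ^ k) (n ^ k))
  where
  lem : ∀ m n a b → m * n * (a * b) ≡ m * a * (n * b)
  lem = solve-∀

-- Recursion on the argument makes explicit that the logarithm grows only at powers of two, a fact
-- that `tail-potential` exploits.
lg : ℕ → ℕ
lg zero    = 0
lg (suc n) = byDec (2 ^ suc (lg n) ≤? suc n) (suc (lg n)) (lg n)

lg-suc : ∀ n → lg (suc n) ≡ lg n × suc n < 2 ^ suc (lg n) ⊎ lg (suc n) ≡ suc (lg n) × 2 ^ suc (lg n) ≤ suc n
lg-suc n with 2 ^ suc (lg n) ≤? suc n
... | yes le = inj₂ (refl , le)
... | no ¬le = inj₁ (refl , ≰⇒> ¬le)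

lg-upper : ∀ n → n < 2 ^ suc (lg n)
lg-upper zero = s≤s z≤n
lg-upper (suc n) with lg-suc n
... | inj₁ (e , lt) rewrite e = lt
... | inj₂ (e , le) rewrite e = ≤-trans (+-mono-≤ (>-nonZero⁻¹ (2 ^ suc (lg n)) {{m^n≢0 2 (suc (lg n))}}) (lg-upper n))
        (+-monoʳ-≤ (2 ^ suc (lg n)) (m≤m+n _ 0))

lg-lower : ∀ n .{{_ : NonZero n}} → 2 ^ lg n ≤ n
lg-lower (suc zero)    = ≤-refl
lg-lower (suc (suc n)) =
  [ (λ (e , _)  → subst (λ z → 2 ^ z ≤ suc (suc n)) (sym e) (m≤n⇒m≤1+n (lg-lower (suc n))))
  , (λ (e , le) → subst (λ z → 2 ^ z ≤ suc (suc n)) (sym e) le) ]′ (lg-suc (suc n))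

2^-mono-inv : ∀ {a b} → 2 ^ a ≤ 2 ^ b → a ≤ b
2^-mono-inv {a} {b} le = ≮⇒≥ λ b<a → <⇒≱ (^-monoʳ-< 2 (s≤s (s≤s z≤n)) b<a) le

2^-mono-inv-< : ∀ {a b} → 2 ^ a < 2 ^ b → a < b
2^-mono-inv-< {a} {b} lt = ≰⇒> λ b≤a → <⇒≱ lt (^-monoʳ-≤ 2 b≤a)

2^≤⇒≤lg : ∀ {k n} → 2 ^ k ≤ n → k ≤ lg n
2^≤⇒≤lg {k} {n} le = ≤-pred (2^-mono-inv-< (≤-<-trans le (lg-upper n)))

<2^⇒lg< : ∀ {k n} .{{_ : NonZero n}} → n < 2 ^ k → lg n < k
<2^⇒lg< {k} {n} lt = 2^-mono-inv-< (≤-<-trans (lg-lower n) lt)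

lg-mono : ∀ {m n} → m ≤ n → lg m ≤ lg n
lg-mono {zero}  le = z≤n
lg-mono {suc m} le = 2^≤⇒≤lg (≤-trans (lg-lower (suc m)) le)

lg-2^ : ∀ k → lg (2 ^ k) ≡ k
lg-2^ k = ≤-antisym (≤-pred (<2^⇒lg< {{m^n≢0 2 k}} (^-monoʳ-< 2 (s≤s (s≤s z≤n)) (n<1+n k)))) (2^≤⇒≤lg ≤-refl)

n<2^n : ∀ n → n < 2 ^ n
n<2^n zero    = s≤s z≤n
n<2^n (suc n) = +-mono-≤ (>-nonZero⁻¹ (2 ^ n) {{m^n≢0 2 n}}) (≤-trans (n<2^n n) (m≤m+n (2 ^ n) 0))

lg≤ : ∀ n → lg n ≤ n
lg≤ zero    = z≤n
lg≤ (suc n) = 2^-mono-inv (≤-trans (lg-lower (suc n)) (<⇒≤ (n<2^n (suc n))))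

central-step : ∀ N → (2 * suc N) ! ≡ 2 * suc N * (2 * N + 1) * (2 * N) !
central-step N = trans (cong _! (lem N)) (lem₂ N ((2 * N) !))
  where
  lem : ∀ N → 2 * suc N ≡ suc (suc (2 * N))
  lem = solve-∀
  lem₂ : ∀ N f → suc (suc (2 * N)) * (suc (2 * N) * f) ≡ 2 * suc N * (2 * N + 1) * f
  lem₂ = solve-∀

central-lower : ∀ N → 2 ^ N * (N ! * N !) ≤ (2 * N) !
central-lower zero    = ≤-refl
central-lower (suc N) = begin
  2 ^ suc N * (suc N ! * suc N !)  ≡⟨ lem (2 ^ N) N (N !) ⟩
  2 * suc N * (1 + N) * (2 ^ N * (N ! * N !))  ≤⟨ *-mono-≤ (*-monoʳ-≤ (2 * suc N) (lem₂ N)) (central-lower N) ⟩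
  2 * suc N * (2 * N + 1) * (2 * N) !  ≡⟨ central-step N ⟨
  (2 * suc N) !  ∎
  where
  open ≤-Reasoning
  lem : ∀ t N f → 2 * t * (suc N * f * (suc N * f)) ≡ 2 * suc N * (1 + N) * (t * (f * f))
  lem = solve-∀
  lem₂ : ∀ N → 1 + N ≤ 2 * N + 1
  lem₂ N = ≤-trans (≤-reflexive (+-comm 1 N)) (+-monoˡ-≤ 1 (m≤m+n N (N + 0)))

central-upper : ∀ N → (2 * N) ! ≤ 4 ^ N * (N ! * N !)
central-upper zero    = ≤-refl
central-upper (suc N) = begin
  (2 * suc N) !  ≡⟨ central-step N ⟩
  2 * suc N * (2 * N + 1) * (2 * N) !  ≤⟨ *-mono-≤ (*-monoʳ-≤ (2 * suc N) (lem₂ N)) (central-upper N) ⟩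
  2 * suc N * (2 * suc N) * (4 ^ N * (N ! * N !))  ≡⟨ lem (4 ^ N) N (N !) ⟩
  4 ^ suc N * (suc N ! * suc N !)  ∎
  where
  open ≤-Reasoning
  lem : ∀ t N f → 2 * suc N * (2 * suc N) * (t * (f * f)) ≡ 4 * t * (suc N * f * (suc N * f))
  lem = solve-∀
  lem₂ : ∀ N → 2 * N + 1 ≤ 2 * suc N
  lem₂ N = ≤-trans (+-monoʳ-≤ (2 * N) (s≤s (z≤n {1}))) (≤-reflexive (lem₃ N))
    where
    lem₃ : ∀ N → 2 * N + 2 ≡ 2 * suc N
    lem₃ = solve-∀

!-growth : ∀ N k → N ! * N ^ k ≤ (N + k) !
!-growth N zero    = ≤-reflexive (trans (*-identityʳ _) (cong _! (sym (+-identityʳ N))))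
!-growth N (suc k) = begin
  N ! * (N * N ^ k)  ≡⟨ lem (N !) N (N ^ k) ⟩
  N * (N ! * N ^ k)  ≤⟨ *-mono-≤ (≤-trans (m≤m+n N k) (n≤1+n (N + k))) (!-growth N k) ⟩
  suc (N + k) * (N + k) ! ≡⟨ cong _! (sym (+-suc N k)) ⟩
  (N + suc k) !  ∎
  where
  open ≤-Reasoning
  lem : ∀ f n p → f * (n * p) ≡ n * (f * p)
  lem = solve-∀

-- A substitute for Stirling's formula, from N! N^N ≤ (2N)! ≤ 4^N (N!)².
N^N≤4^N*N! : ∀ N → N ^ N ≤ 4 ^ N * N !
N^N≤4^N*N! N = *-cancelˡ-≤ (N !) {{N !≢0}} (begin
  N ! * N ^ N  ≤⟨ !-growth N N ⟩
  (N + N) !  ≡⟨ cong (λ z → (N + z) !) (sym (+-identityʳ N)) ⟩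
  (2 * N) !  ≤⟨ central-upper N ⟩
  4 ^ N * (N ! * N !)  ≡⟨ lem (4 ^ N) (N !) ⟩
  N ! * (4 ^ N * N !)  ∎)
  where
  open ≤-Reasoning
  lem : ∀ t f → t * (f * f) ≡ f * (t * f)
  lem = solve-∀

n!≤n^n : ∀ n → n ! ≤ n ^ n
n!≤n^n n = go n n ≤-refl
  where
  go : ∀ k n → k ≤ n → k ! ≤ n ^ k
  go zero    n _  = ≤-refl
  go (suc k) n lt = *-mono-≤ lt (go k n (<⇒≤ lt))

π : ℕ → ℕ
π = Σₚ (λ _ → 1)

-- Each of the π(2N) primes contributes at most 2N to the central binomial coefficient, which is at
-- least 2^N.
chebyshev : ∀ N .{{_ : NonZero N}} → N ≤ suc (lg (2 * N)) * π (2 * N)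
chebyshev N = 2^-mono-inv (≤-trans small big)
  where
  open ≤-Reasoning
  F : ℕ
  F = 2 * N
  1≤F : 1 ≤ F
  1≤F = ≤-trans (>-nonZero⁻¹ N) (m≤m+n N (N + 0))
  small : 2 ^ N ≤ F ^ π F
  small = *-cancelʳ-≤ (2 ^ N) (F ^ π F) (N ! * N !) {{m*n≢0 (N !) (N !) {{N !≢0}} {{N !≢0}}}} (begin
    2 ^ N * (N ! * N !)  ≤⟨ central-lower N ⟩
    F !  ≡⟨ legendre-formula F F ≤-refl ⟨
    Πₚ (λ q → q ^ legendre F q F) F  ≤⟨ Πₚ-mono F (λ q pr _ → legendre-central F q (prime>1 pr) F N 1≤F (m≤m+n F 1)) ⟩
    Πₚ (λ q → F * q ^ (2 * legendre F q N)) F  ≡⟨ Πₚ-* (λ _ → F) (λ q → q ^ (2 * legendre F q N)) F ⟩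
    Πₚ (λ _ → F) F * Πₚ (λ q → q ^ (2 * legendre F q N)) F
      ≡⟨ cong₂ _*_ (trans (Πₚ-cong F (λ _ _ _ → sym (^-identityʳ F))) (Πₚ-^ F (λ _ → 1) F)) square ⟩
    F ^ π F * (N ! * N !)  ∎)
    where
    square : Πₚ (λ q → q ^ (2 * legendre F q N)) F ≡ N ! * N !
    square = trans (Πₚ-cong F (λ q _ _ → trans (cong (λ z → q ^ (legendre F q N + z)) (+-identityʳ _)) (^-distribˡ-+-* q (legendre F q N) (legendre F q N))))
      (trans (Πₚ-* (λ q → q ^ legendre F q N) (λ q → q ^ legendre F q N) F)
        (cong₂ _*_ (legendre-formula F N (m≤m+n N (N + 0))) (legendre-formula F N (m≤m+n N (N + 0)))))
  big : F ^ π F ≤ 2 ^ (suc (lg F) * π F)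
  big = ≤-trans (^-monoˡ-≤ (π F) (<⇒≤ (lg-upper F))) (≤-reflexive (^-*-assoc 2 (suc (lg F)) (π F)))

-- Mertens' estimates with cleared denominators

module Scaled (B D : ℕ) (ρ : ℕ → ℕ) (ρ-spec : ∀ k → 1 ≤ k → k ≤ B → k * ρ k ≡ D) where

  ρ≤D : ∀ k → 1 ≤ k → k ≤ B → ρ k ≤ D
  ρ≤D k@(suc _) 1≤k k≤B = ≤-trans (m≤m+n (ρ k) _) (≤-reflexive (ρ-spec k 1≤k k≤B))

  ρ-anti : ∀ {j k} → 1 ≤ j → j ≤ k → k ≤ B → ρ k ≤ ρ j
  ρ-anti {j@(suc _)} {k} 1≤j j≤k k≤B = *-cancelˡ-≤ j (begin
    j * ρ k  ≤⟨ *-monoˡ-≤ (ρ k) j≤k ⟩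
    k * ρ k  ≡⟨ ρ-spec k (≤-trans 1≤j j≤k) k≤B ⟩
    D  ≡⟨ ρ-spec j 1≤j (≤-trans j≤k k≤B) ⟨
    j * ρ j  ∎)
    where open ≤-Reasoning

  ρ-double : ∀ {j k} → 1 ≤ j → k ≤ 2 * j → 1 ≤ k → k ≤ B → j ≤ B → ρ j ≤ 2 * ρ k
  ρ-double {j@(suc _)} {k} 1≤j le 1≤k k≤B j≤B = *-cancelˡ-≤ j (begin
    j * ρ j  ≡⟨ ρ-spec j 1≤j j≤B ⟩
    D  ≡⟨ ρ-spec k 1≤k k≤B ⟨
    k * ρ k  ≤⟨ *-monoˡ-≤ (ρ k) le ⟩
    2 * j * ρ k  ≡⟨ lem j (ρ k) ⟩
    j * (2 * ρ k)  ∎)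
    where
    open ≤-Reasoning
    lem : ∀ j r → 2 * j * r ≡ j * (2 * r)
    lem = solve-∀

  -- V! is at least the product of the powers q^⌊V/q⌋ and at most V^V. The factor 2 comes from V ≤ 2
  -- q ⌊V/q⌋ for q ≤ V.
  mertens-upper : ∀ v → 2 ^ v ≤ B → Σₚ (λ q → lg q * ρ q) (2 ^ v) ≤ 2 * (v * D)
  mertens-upper v V≤B = *-cancelˡ-≤ V {{m^n≢0 2 v}} (begin
    V * Σₚ (λ q → lg q * ρ q) V  ≡⟨ Σₚ-* V (λ q → lg q * ρ q) V ⟨
    Σₚ (λ q → V * (lg q * ρ q)) V  ≤⟨ Σₚ-mono V term ⟩
    Σₚ (λ q → 2 * D * (lg q * quot q)) V  ≡⟨ Σₚ-* (2 * D) (λ q → lg q * quot q) V ⟩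
    2 * D * Σₚ (λ q → lg q * quot q) V  ≤⟨ *-monoʳ-≤ (2 * D) (2^-mono-inv power) ⟩
    2 * D * (v * V)  ≡⟨ lem D v V ⟩
    V * (2 * (v * D))  ∎)
    where
    open ≤-Reasoning
    V : ℕ
    V = 2 ^ v
    quot : ℕ → ℕ
    quot zero      = 0
    quot q@(suc _) = V / q
    lem : ∀ D v V → 2 * D * (v * V) ≡ V * (2 * (v * D))
    lem = solve-∀
    term : ∀ q → Prime q → q ≤ V → V * (lg q * ρ q) ≤ 2 * D * (lg q * quot q)
    term q@(suc _) pr q≤V = begin
      V * (lg q * ρ q)  ≤⟨ *-monoˡ-≤ (lg q * ρ q) V≤ ⟩
      2 * (V / q * q) * (lg q * ρ q)  ≡⟨ lem₁ (V / q) q (lg q) (ρ q) ⟩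
      2 * (q * ρ q) * (lg q * (V / q))  ≡⟨ cong (λ z → 2 * z * (lg q * (V / q))) (ρ-spec q (s≤s z≤n) (≤-trans q≤V V≤B)) ⟩
      2 * D * (lg q * (V / q))  ∎
      where
      lem₁ : ∀ k q l r → 2 * (k * q) * (l * r) ≡ 2 * (q * r) * (l * k)
      lem₁ = solve-∀
      V≤ : V ≤ 2 * (V / q * q)
      V≤ = begin
        V  ≡⟨ m≡m%n+[m/n]*n V q ⟩
        V % q + V / q * q  ≤⟨ +-monoˡ-≤ _ (<⇒≤ (m%n<n V q)) ⟩
        q + V / q * q  ≤⟨ +-monoˡ-≤ _ (m≤n*m q (V / q) {{>-nonZero (m≥n⇒m/n>0 q≤V)}}) ⟩
        V / q * q + V / q * q  ≡⟨ cong (V / q * q +_) (+-identityʳ _) ⟨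
        2 * (V / q * q)  ∎
    power : 2 ^ Σₚ (λ q → lg q * quot q) V ≤ 2 ^ (v * V)
    power = begin
      2 ^ Σₚ (λ q → lg q * quot q) V  ≡⟨ Πₚ-^ 2 (λ q → lg q * quot q) V ⟨
      Πₚ (λ q → 2 ^ (lg q * quot q)) V  ≤⟨ Πₚ-mono V below ⟩
      Πₚ (λ q → q ^ legendre V q V) V  ≡⟨ legendre-formula V V ≤-refl ⟩
      V !  ≤⟨ n!≤n^n V ⟩
      V ^ V  ≡⟨ ^-*-assoc 2 v V ⟩
      2 ^ (v * V)  ∎
      where
      fuel : ∀ n .{{_ : NonZero n}} q .{{_ : NonZero q}} N → N / q ≤ legendre n q N
      fuel (suc n) q N = legendre-lower n q N
      below : ∀ q → Prime q → q ≤ V → 2 ^ (lg q * quot q) ≤ q ^ legendre V q V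
      below q@(suc _) pr q≤V = begin
        2 ^ (lg q * (V / q))  ≡⟨ ^-*-assoc 2 (lg q) (V / q) ⟨
        (2 ^ lg q) ^ (V / q)  ≤⟨ ^-monoˡ-≤ (V / q) (lg-lower q) ⟩
        q ^ (V / q)  ≤⟨ ^-monoʳ-≤ q (fuel V {{m^n≢0 2 v}} q V) ⟩
        q ^ legendre V q V  ∎

  module Precision (K : ℕ) where

    -- K log₂ n rounded down: the error of 1 is small against the scale K. Rounding down makes `ℓ`
    -- superadditive on products.
    ℓ : ℕ → ℕ
    ℓ n = lg (n ^ K)

    ℓ-mono : ∀ {m n} → m ≤ n → ℓ m ≤ ℓ n
    ℓ-mono le = lg-mono (^-monoˡ-≤ K le)

    ℓ-superadditive : ∀ m n .{{_ : NonZero m}} .{{_ : NonZero n}} → ℓ m + ℓ n ≤ ℓ (m * n)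
    ℓ-superadditive m n = 2^≤⇒≤lg (begin
      2 ^ (ℓ m + ℓ n)  ≡⟨ ^-distribˡ-+-* 2 (ℓ m) (ℓ n) ⟩
      2 ^ ℓ m * 2 ^ ℓ n  ≤⟨ *-mono-≤ (lg-lower (m ^ K) {{m^n≢0 m K}}) (lg-lower (n ^ K) {{m^n≢0 n K}}) ⟩
      m ^ K * n ^ K  ≡⟨ ^-distribʳ-* K m n ⟨
      (m * n) ^ K  ∎)
      where open ≤-Reasoning

    ℓ-upper : ∀ {n k} .{{_ : NonZero n}} → n ≤ 2 ^ k → ℓ n ≤ k * K
    ℓ-upper {n} {k} le = ≤-trans (lg-mono (^-monoˡ-≤ K le)) (≤-reflexive (trans (cong lg (^-*-assoc 2 k K)) (lg-2^ (k * K))))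

    ℓ≤ : ∀ n .{{_ : NonZero n}} → ℓ n ≤ suc (lg n) * K
    ℓ≤ n = ℓ-upper {k = suc (lg n)} (<⇒≤ (lg-upper n))

    -- Compare log N! ≥ N log N - 2 N with Legendre's formula, where the exponent of q is at most N
    -- / (q - 1). The `+ 1` rounds log q upwards.
    mertens-legendre : ∀ N .{{_ : NonZero N}} → N ≤ B → D * ℓ N ≤ 2 * K * D + Σₚ (λ q → (ℓ q + 1) * ρ (q ∸ 1)) N
    mertens-legendre N N≤B = *-cancelˡ-≤ N (begin
      N * (D * ℓ N)  ≡⟨ lem₁ N D (ℓ N) ⟩
      D * (ℓ N * N)  ≤⟨ *-monoʳ-≤ D (2^-mono-inv power) ⟩
      D * (2 * N * K + Σₚ (λ q → (ℓ q + 1) * legendre N q N) N) ≡⟨ *-distribˡ-+ D (2 * N * K) _ ⟩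
      D * (2 * N * K) + D * Σₚ (λ q → (ℓ q + 1) * legendre N q N) N
        ≡⟨ cong (D * (2 * N * K) +_) (Σₚ-* D (λ q → (ℓ q + 1) * legendre N q N) N) ⟨
      D * (2 * N * K) + Σₚ (λ q → D * ((ℓ q + 1) * legendre N q N)) N
        ≤⟨ +-monoʳ-≤ (D * (2 * N * K)) (Σₚ-mono N term) ⟩
      D * (2 * N * K) + Σₚ (λ q → N * ((ℓ q + 1) * ρ (q ∸ 1))) N
        ≡⟨ cong₂ _+_ (lem₂ D N K) (Σₚ-* N (λ q → (ℓ q + 1) * ρ (q ∸ 1)) N) ⟩
      N * (2 * K * D) + N * Σₚ (λ q → (ℓ q + 1) * ρ (q ∸ 1)) N  ≡⟨ *-distribˡ-+ N (2 * K * D) _ ⟨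
      N * (2 * K * D + Σₚ (λ q → (ℓ q + 1) * ρ (q ∸ 1)) N)  ∎)
      where
      open ≤-Reasoning
      lem₁ : ∀ N D l → N * (D * l) ≡ D * (l * N)
      lem₁ = solve-∀
      lem₂ : ∀ D N K → D * (2 * N * K) ≡ N * (2 * K * D)
      lem₂ = solve-∀
      term : ∀ q → Prime q → q ≤ N → D * ((ℓ q + 1) * legendre N q N) ≤ N * ((ℓ q + 1) * ρ (q ∸ 1))
      term q@(suc r) pr q≤N = begin
        D * ((ℓ q + 1) * legendre N q N)  ≡⟨ cong (_* ((ℓ q + 1) * legendre N q N)) (ρ-spec r (≤-pred (prime>1 pr)) (≤-trans (n≤1+n r) (≤-trans q≤N N≤B))) ⟨
        r * ρ r * ((ℓ q + 1) * legendre N q N)  ≡⟨ lem₃ r (ρ r) (ℓ q + 1) (legendre N q N) ⟩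
        r * legendre N q N * ((ℓ q + 1) * ρ r)  ≤⟨ *-monoˡ-≤ _ (legendre-upper N q N) ⟩
        N * ((ℓ q + 1) * ρ r)  ∎
        where
        lem₃ : ∀ a b c d → a * b * (c * d) ≡ a * d * (c * b)
        lem₃ = solve-∀
      power : 2 ^ (ℓ N * N) ≤ 2 ^ (2 * N * K + Σₚ (λ q → (ℓ q + 1) * legendre N q N) N)
      power = begin
        2 ^ (ℓ N * N)  ≡⟨ ^-*-assoc 2 (ℓ N) N ⟨
        (2 ^ ℓ N) ^ N  ≤⟨ ^-monoˡ-≤ N (lg-lower (N ^ K) {{m^n≢0 N K}}) ⟩
        (N ^ K) ^ N  ≡⟨ trans (^-*-assoc N K N) (trans (cong (N ^_) (*-comm K N)) (sym (^-*-assoc N N K))) ⟩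
        (N ^ N) ^ K  ≤⟨ ^-monoˡ-≤ K (N^N≤4^N*N! N) ⟩
        (4 ^ N * N !) ^ K  ≡⟨ ^-distribʳ-* K (4 ^ N) (N !) ⟩
        (4 ^ N) ^ K * (N !) ^ K  ≡⟨ cong₂ _*_ four (trans (cong (_^ K) (sym (legendre-formula N N ≤-refl))) (sym (Πₚ-pow (λ q → q ^ legendre N q N) K N))) ⟩
        2 ^ (2 * N * K) * Πₚ (λ q → (q ^ legendre N q N) ^ K) N
          ≤⟨ *-monoʳ-≤ (2 ^ (2 * N * K)) (Πₚ-mono N below) ⟩
        2 ^ (2 * N * K) * Πₚ (λ q → 2 ^ ((ℓ q + 1) * legendre N q N)) N
          ≡⟨ cong (2 ^ (2 * N * K) *_) (Πₚ-^ 2 (λ q → (ℓ q + 1) * legendre N q N) N) ⟩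
        2 ^ (2 * N * K) * 2 ^ Σₚ (λ q → (ℓ q + 1) * legendre N q N) N
          ≡⟨ ^-distribˡ-+-* 2 (2 * N * K) _ ⟨
        2 ^ (2 * N * K + Σₚ (λ q → (ℓ q + 1) * legendre N q N) N) ∎
        where
        four : (4 ^ N) ^ K ≡ 2 ^ (2 * N * K)
        four = trans (cong (_^ K) (^-*-assoc 2 2 N)) (^-*-assoc 2 (2 * N) K)
        below : ∀ q → Prime q → q ≤ N → (q ^ legendre N q N) ^ K ≤ 2 ^ ((ℓ q + 1) * legendre N q N)
        below q pr _ = begin
          (q ^ e) ^ K  ≡⟨ trans (^-*-assoc q e K) (trans (cong (q ^_) (*-comm e K)) (sym (^-*-assoc q K e))) ⟩
          (q ^ K) ^ e  ≤⟨ ^-monoˡ-≤ e (<⇒≤ (lg-upper (q ^ K))) ⟩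
          (2 ^ suc (ℓ q)) ^ e  ≡⟨ ^-*-assoc 2 (suc (ℓ q)) e ⟩
          2 ^ (suc (ℓ q) * e)  ≡⟨ cong (λ z → 2 ^ (z * e)) (+-comm 1 (ℓ q)) ⟩
          2 ^ ((ℓ q + 1) * e)  ∎
          where
          e : ℕ
          e = legendre N q N

-- Sums over integers

Σ₁ : (ℕ → ℕ) → ℕ → ℕ
Σ₁ f zero    = 0
Σ₁ f (suc n) = Σ₁ f n + f (suc n)

Σ₁-mono : ∀ {f g} N → (∀ m → 1 ≤ m → m ≤ N → f m ≤ g m) → Σ₁ f N ≤ Σ₁ g N
Σ₁-mono zero    le = z≤n
Σ₁-mono (suc N) le = +-mono-≤ (Σ₁-mono N (λ m 1≤m m≤N → le m 1≤m (m≤n⇒m≤1+n m≤N))) (le (suc N) (s≤s z≤n) ≤-refl)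

Σ₁-+ : ∀ f g N → Σ₁ (λ m → f m + g m) N ≡ Σ₁ f N + Σ₁ g N
Σ₁-+ f g zero    = refl
Σ₁-+ f g (suc N) = trans (cong (_+ (f (suc N) + g (suc N))) (Σ₁-+ f g N)) (lem (Σ₁ f N) (Σ₁ g N) (f (suc N)) (g (suc N)))
  where
  lem : ∀ a b c d → a + b + (c + d) ≡ a + c + (b + d)
  lem = solve-∀

Σ₁-* : ∀ c f N → Σ₁ (λ m → c * f m) N ≡ c * Σ₁ f N
Σ₁-* c f zero    = sym (*-zeroʳ c)
Σ₁-* c f (suc N) = trans (cong (_+ c * f (suc N)) (Σ₁-* c f N)) (sym (*-distribˡ-+ c (Σ₁ f N) (f (suc N))))

Σ₁-extend : ∀ f {M N} → M ≤ N → Σ₁ f M ≤ Σ₁ f N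
Σ₁-extend f {M} {N} M≤N with m≤n⇒∃[o]m+o≡n M≤N
... | r , refl = go r
  where
  go : ∀ r → Σ₁ f M ≤ Σ₁ f (M + r)
  go zero    = ≤-reflexive (cong (Σ₁ f) (sym (+-identityʳ M)))
  go (suc r) = ≤-trans (go r) (≤-trans (m≤m+n _ (f (suc (M + r)))) (≤-reflexive (cong (Σ₁ f) (sym (+-suc M r)))))

Σ₁-block : ∀ f c a b → (∀ m → a < m → m ≤ a + b → c ≤ f m) → Σ₁ f a + b * c ≤ Σ₁ f (a + b)
Σ₁-block f c a zero    le = ≤-reflexive (trans (+-identityʳ _) (cong (Σ₁ f) (sym (+-identityʳ a))))
Σ₁-block f c a (suc b) le = begin
  Σ₁ f a + (c + b * c)  ≡⟨ lem (Σ₁ f a) c (b * c) ⟩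
  Σ₁ f a + b * c + c  ≤⟨ +-mono-≤ (Σ₁-block f c a b (λ m a<m m≤ → le m a<m (≤-trans m≤ (+-monoʳ-≤ a (n≤1+n b))))) (le (suc (a + b)) (s≤s (m≤m+n a b)) (≤-reflexive (sym (+-suc a b)))) ⟩
  Σ₁ f (suc (a + b))  ≡⟨ cong (Σ₁ f) (+-suc a b) ⟨
  Σ₁ f (a + suc b)  ∎
  where
  open ≤-Reasoning
  lem : ∀ a b c → a + (b + c) ≡ a + c + b
  lem = solve-∀

Σₚ≤Σ₁ : ∀ {f g} N → (∀ q → Prime q → q ≤ N → f q ≤ g q) → Σₚ f N ≤ Σ₁ g N
Σₚ≤Σ₁ zero    le = z≤n
Σₚ≤Σ₁ {f} {g} (suc N) le with isPrime? (suc N)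
... | yes pr = +-mono-≤ (Σₚ≤Σ₁ N (λ q pr q≤ → le q pr (m≤n⇒m≤1+n q≤))) (le (suc N) pr ≤-refl)
... | no  _  = +-mono-≤ (Σₚ≤Σ₁ N (λ q pr q≤ → le q pr (m≤n⇒m≤1+n q≤))) z≤n

Σ₁-const : ∀ c N → Σ₁ (λ _ → c) N ≡ N * c
Σ₁-const c zero    = refl
Σ₁-const c (suc N) = trans (+-comm _ c) (cong (c +_) (Σ₁-const c N))

Σₚ-const : ∀ {f} c N → (∀ q → Prime q → q ≤ N → f q ≤ c) → Σₚ f N ≤ N * c
Σₚ-const c N le = ≤-trans (Σₚ≤Σ₁ N le) (≤-reflexive (Σ₁-const c N))

Σ₁-multiples : ∀ q .{{_ : NonZero q}} g N → Σ₁ (λ m → byDec (q ∣? m) (g (m / q)) 0) N ≡ Σ₁ g (N / q)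
Σ₁-multiples q g zero    = cong (Σ₁ g) (sym (0/n≡0 q))
Σ₁-multiples q g (suc N) with q ∣? suc N
... | no ¬d = trans (+-identityʳ _) (trans (Σ₁-multiples q g N) (cong (Σ₁ g) (sym (quotient-same q N ¬d))))
... | yes (divides (suc k) e) = trans (cong₂ _+_ (trans (Σ₁-multiples q g N) (cong (Σ₁ g) (proj₁ (quotient-step q N k e)))) (cong g (proj₂ (quotient-step q N k e))))
        (cong (Σ₁ g) (sym (proj₂ (quotient-step q N k e))))

Σₚ-upto : ∀ f V r → Σₚ (λ q → byDec (V <? q) 0 (f q)) (V + r) ≡ Σₚ f V
Σₚ-upto f V zero    = trans (cong (Σₚ _) (+-identityʳ V)) (≤-antisym (Σₚ-mono V le) (Σₚ-mono V ge))
  where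
  le : ∀ q → Prime q → q ≤ V → byDec (V <? q) 0 (f q) ≤ f q
  le q _ q≤V with V <? q
  ... | yes _ = z≤n
  ... | no  _ = ≤-refl
  ge : ∀ q → Prime q → q ≤ V → f q ≤ byDec (V <? q) 0 (f q)
  ge q _ q≤V with V <? q
  ... | yes lt = contradiction q≤V (<⇒≱ lt)
  ... | no  _  = ≤-refl
Σₚ-upto f V (suc r) = trans (cong (Σₚ (λ q → byDec (V <? q) 0 (f q))) (+-suc V r))
    (trans (cong₂ _+_ (Σₚ-upto f V r) (vanish (isPrime? (suc (V + r))) (V <? suc (V + r)))) (+-identityʳ _))
  where
  vanish : ∀ d (d′ : Dec (V < suc (V + r))) → byDec d (byDec d′ 0 (f (suc (V + r)))) 0 ≡ 0
  vanish (no _)  _        = refl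
  vanish (yes _) (yes _)  = refl
  vanish (yes _) (no ¬lt) = contradiction (s≤s (m≤m+n V r)) ¬lt

Smooth : ℕ → ℕ → Set
Smooth z m = ∀ {q} → q < suc m → q ∣ m → Prime q → q ≤ z

smooth? : ∀ z m → Dec (Smooth z m)
smooth? z m = allUpTo? (λ q → (q ∣? m) →-dec (isPrime? q →-dec (q ≤? z))) (suc m)

smooth : ∀ {z m q} .{{_ : NonZero m}} → Smooth z m → Prime q → q ∣ m → q ≤ z
smooth s pr d = s (s≤s (∣⇒≤ d)) d pr

-- Mertens' lower bound with 1 / (q + 1), and Euler's product

module Scaled′ (B D : ℕ) (ρ : ℕ → ℕ) (ρ-spec : ∀ k → 1 ≤ k → k ≤ B → k * ρ k ≡ D) where
  open Scaled B D ρ ρ-spec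

  -- The price of replacing 1 / (k - 1) by 1 / (k + 1), weighted by a bound for log k. It is of
  -- order log k / k², so the sum converges.
  gap : ℕ → ℕ
  gap k = (lg k + 1) * (ρ (k ∸ 1) ∸ ρ (k + 1))

  -- Summation by parts: lg only increases at powers of two, where the last summand of the potential pays for it.
  tail-potential : ∀ n → suc n + 1 ≤ B →
    Σ₁ (λ k → gap (suc k)) n + (lg (suc n) + 1) * (ρ (suc n) + ρ (suc n + 1)) + 4 * ρ (2 ^ lg (suc n)) ≤ 6 * D
  tail-potential zero 2≤B = begin
    1 * (ρ 1 + ρ 2) + 4 * ρ 1  ≤⟨ +-monoˡ-≤ (4 * ρ 1) (*-monoʳ-≤ 1 (+-monoʳ-≤ (ρ 1) (ρ-anti ≤-refl (n≤1+n 1) 2≤B))) ⟩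
    1 * (ρ 1 + ρ 1) + 4 * ρ 1  ≡⟨ lem (ρ 1) ⟩
    6 * (1 * ρ 1)  ≡⟨ cong (6 *_) (ρ-spec 1 ≤-refl (≤-trans (n≤1+n 1) 2≤B)) ⟩
    6 * D  ∎
    where
    open ≤-Reasoning
    lem : ∀ r → 1 * (r + r) + 4 * r ≡ 6 * (1 * r)
    lem = solve-∀
  tail-potential (suc n) k+1≤B = begin
    Uₙ + (b′ + 1) * (ρ N ∸ ρ (k + 1)) + (b′ + 1) * (ρ k + ρ (k + 1)) + 4 * ρ (2 ^ b′)
      ≡⟨ cong (_+ 4 * ρ (2 ^ b′)) (merge Uₙ (b′ + 1) (ρ N) (ρ k) (ρ (k + 1)) (ρ-anti (s≤s z≤n) (≤-trans (n≤1+n N) (m≤m+n k 1)) k+1≤B)) ⟩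
    Uₙ + (b′ + 1) * (ρ N + ρ k) + 4 * ρ (2 ^ b′)
      ≤⟨ [ same , jump ]′ (lg-suc N) ⟩
    Uₙ + (b + 1) * (ρ N + ρ k) + 4 * ρ (2 ^ b)
      ≡⟨ cong (λ z → Uₙ + (b + 1) * (ρ N + ρ z) + 4 * ρ (2 ^ b)) (+-comm 1 N) ⟩
    Uₙ + (b + 1) * (ρ N + ρ (N + 1)) + 4 * ρ (2 ^ b)
      ≤⟨ tail-potential n (≤-trans (≤-reflexive (+-comm N 1)) k≤B) ⟩
    6 * D ∎
    where
    open ≤-Reasoning
    N k b b′ Uₙ : ℕ
    N  = suc n
    k  = suc N
    b  = lg N
    b′ = lg k
    Uₙ = Σ₁ (λ k → gap (suc k)) n
    k≤B : k ≤ B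
    k≤B = ≤-trans (m≤m+n k 1) k+1≤B
    merge : ∀ u c x y z → z ≤ x → u + c * (x ∸ z) + c * (y + z) ≡ u + c * (x + y)
    merge u c x y z z≤x = trans (lem u c (x ∸ z) y z) (cong (λ t → u + c * (t + y)) (m∸n+n≡m z≤x))
      where
      lem : ∀ u c a y z → u + c * a + c * (y + z) ≡ u + c * (a + z + y)
      lem = solve-∀
    same : lg k ≡ b × k < 2 ^ suc b → Uₙ + (b′ + 1) * (ρ N + ρ k) + 4 * ρ (2 ^ b′) ≤ Uₙ + (b + 1) * (ρ N + ρ k) + 4 * ρ (2 ^ b)
    same (e , _) = ≤-reflexive (cong (λ z → Uₙ + (z + 1) * (ρ N + ρ k) + 4 * ρ (2 ^ z)) e)
    -- When k reaches 2^(b + 1), the new unit of the logarithm costs `ρ N + ρ k`, at most `3 * ρ k`.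
    -- The last summand pays, as it drops from `8 * ρ k` to `4 * ρ k`.
    jump : lg k ≡ suc b × 2 ^ suc b ≤ k → Uₙ + (b′ + 1) * (ρ N + ρ k) + 4 * ρ (2 ^ b′) ≤ Uₙ + (b + 1) * (ρ N + ρ k) + 4 * ρ (2 ^ b)
    jump (e , le) = begin
      Uₙ + (b′ + 1) * (ρ N + ρ k) + 4 * ρ (2 ^ b′)  ≡⟨ cong₂ (λ z w → Uₙ + (z + 1) * (ρ N + ρ k) + 4 * ρ w) e (trans (cong (2 ^_) e) (sym k≡)) ⟩
      Uₙ + (suc b + 1) * (ρ N + ρ k) + 4 * ρ k  ≡⟨ lem Uₙ b (ρ N) (ρ k) ⟩
      Uₙ + (b + 1) * (ρ N + ρ k) + (ρ N + 5 * ρ k)  ≤⟨ +-monoʳ-≤ (Uₙ + (b + 1) * (ρ N + ρ k)) (+-mono-≤ (ρ-double (s≤s z≤n) k≤2N (s≤s z≤n) k≤B (≤-trans (n≤1+n N) k≤B)) (*-monoˡ-≤ (ρ k) (n≤1+n 5))) ⟩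
      Uₙ + (b + 1) * (ρ N + ρ k) + (2 * ρ k + 6 * ρ k)  ≡⟨ cong (Uₙ + (b + 1) * (ρ N + ρ k) +_) (trans (lem₂ (ρ k)) (cong (4 *_) half)) ⟩
      Uₙ + (b + 1) * (ρ N + ρ k) + 4 * ρ (2 ^ b)  ∎
      where
      lem : ∀ u b x y → u + (suc b + 1) * (x + y) + 4 * y ≡ u + (b + 1) * (x + y) + (x + 5 * y)
      lem = solve-∀
      lem₂ : ∀ y → 2 * y + 6 * y ≡ 4 * (2 * y)
      lem₂ = solve-∀
      k≡ : k ≡ 2 ^ suc b
      k≡ = ≤-antisym (lg-upper N) le
      k≤2N : k ≤ 2 * N
      k≤2N = +-mono-≤ {1} {N} {N} {N + 0} (s≤s z≤n) (m≤m+n N 0)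
      half : 2 * ρ k ≡ ρ (2 ^ b)
      half = *-cancelˡ-≡ (2 * ρ k) (ρ (2 ^ b)) (2 ^ b) {{m^n≢0 2 b}} (trans (lem₃ (2 ^ b) (ρ k)) (trans (cong (_* ρ k) (sym k≡))
        (trans (ρ-spec k (s≤s z≤n) k≤B) (sym (ρ-spec (2 ^ b) (>-nonZero⁻¹ (2 ^ b) {{m^n≢0 2 b}}) (≤-trans (lg-lower N) (≤-trans (n≤1+n N) k≤B)))))))
        where
        lem₃ : ∀ t r → t * (2 * r) ≡ 2 * t * r
        lem₃ = solve-∀

  Σₚ-gap : ∀ N → N + 1 ≤ B → Σₚ gap N ≤ 6 * D
  Σₚ-gap zero    _   = z≤n
  Σₚ-gap (suc n) n≤B = begin
    Σₚ gap (suc n)  ≤⟨ shift n ⟩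
    Σ₁ (λ k → gap (suc k)) n  ≤⟨ ≤-trans (m≤m+n _ _) (m≤m+n _ _) ⟩
    _  ≤⟨ tail-potential n n≤B ⟩
    6 * D  ∎
    where
    open ≤-Reasoning
    shift : ∀ n → Σₚ gap (suc n) ≤ Σ₁ (λ k → gap (suc k)) n
    shift zero with isPrime? 1
    ... | yes pr = contradiction pr ¬prime[1]
    ... | no _   = z≤n
    shift (suc n) with isPrime? (suc (suc n))
    ... | yes _ = +-monoˡ-≤ _ (shift n)
    ... | no  _ = +-mono-≤ (shift n) z≤n

  module Precision′ (K : ℕ) where
    open Precision K

    -- The 9 is 2 from the factorial bound, 6 from the sum of `gap`, and 1 from rounding: at most N
    -- ≤ K primes, each with error at most D.
    mertens-lower : ∀ N .{{_ : NonZero N}} → N + 1 ≤ B → N ≤ K → D * ℓ N ≤ 9 * (K * D) + Σₚ (λ q → ℓ q * ρ (q + 1)) N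
    mertens-lower N N+1≤B N≤K = begin
      D * ℓ N  ≤⟨ mertens-legendre N (≤-trans (m≤m+n N 1) N+1≤B) ⟩
      2 * K * D + Σₚ (λ q → (ℓ q + 1) * ρ (q ∸ 1)) N  ≤⟨ +-monoʳ-≤ (2 * K * D) (Σₚ-mono N term) ⟩
      2 * K * D + Σₚ (λ q → ℓ q * ρ (q + 1) + (K * gap q + ρ (q ∸ 1))) N
        ≡⟨ cong (2 * K * D +_) (trans (Σₚ-+ (λ q → ℓ q * ρ (q + 1)) _ N) (cong (A +_) (trans (Σₚ-+ (λ q → K * gap q) (λ q → ρ (q ∸ 1)) N) (cong (_+ Σₚ (λ q → ρ (q ∸ 1)) N) (Σₚ-* K gap N))))) ⟩
      2 * K * D + (A + (K * Σₚ gap N + Σₚ (λ q → ρ (q ∸ 1)) N))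
        ≤⟨ +-monoʳ-≤ (2 * K * D) (+-monoʳ-≤ A (+-mono-≤ (*-monoʳ-≤ K (Σₚ-gap N N+1≤B)) (≤-trans (Σₚ-const D N small) (*-monoˡ-≤ D N≤K)))) ⟩
      2 * K * D + (A + (K * (6 * D) + K * D))  ≡⟨ lem K D A ⟩
      9 * (K * D) + A  ∎
      where
      open ≤-Reasoning
      A : ℕ
      A = Σₚ (λ q → ℓ q * ρ (q + 1)) N
      lem : ∀ K D A → 2 * K * D + (A + (K * (6 * D) + K * D)) ≡ 9 * (K * D) + A
      lem = solve-∀
      small : ∀ q → Prime q → q ≤ N → ρ (q ∸ 1) ≤ D
      small (suc q) pr q≤ = ρ≤D q (≤-pred (prime>1 pr)) (≤-trans (n≤1+n q) (≤-trans q≤ (≤-trans (m≤m+n N 1) N+1≤B)))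
      term : ∀ q → Prime q → q ≤ N → (ℓ q + 1) * ρ (q ∸ 1) ≤ ℓ q * ρ (q + 1) + (K * gap q + ρ (q ∸ 1))
      term q@(suc r) pr q≤N = begin
        (ℓ q + 1) * x  ≡⟨ cong (λ z → (ℓ q + 1) * z) (sym (m+[n∸m]≡n y≤x)) ⟩
        (ℓ q + 1) * (y + (x ∸ y))  ≡⟨ lem₁ (ℓ q) y (x ∸ y) ⟩
        ℓ q * y + (ℓ q * (x ∸ y) + (y + (x ∸ y)))  ≤⟨ +-monoʳ-≤ (ℓ q * y) (+-mono-≤ (*-monoˡ-≤ (x ∸ y) (ℓ≤ q)) (≤-reflexive (m+[n∸m]≡n y≤x))) ⟩
        ℓ q * y + (suc (lg q) * K * (x ∸ y) + x)  ≡⟨ cong (λ z → ℓ q * y + (z + x)) (lem₂ (lg q) K (x ∸ y)) ⟩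
        ℓ q * y + (K * gap q + x)  ∎
        where
        x y : ℕ
        x = ρ r
        y = ρ (q + 1)
        y≤x : y ≤ x
        y≤x = ρ-anti (≤-pred (prime>1 pr)) (≤-trans (n≤1+n r) (m≤m+n q 1)) (≤-trans (+-monoˡ-≤ 1 q≤N) N+1≤B)
        lem₁ : ∀ l y d → (l + 1) * (y + d) ≡ l * y + (l * d + (y + d))
        lem₁ = solve-∀
        lem₂ : ∀ b K d → suc b * K * d ≡ K * ((b + 1) * d)
        lem₂ = solve-∀

    -- Of the 28 v bits of log Y, the constant in Mertens' bound takes at most 2 v and the primes up
    -- to V at most 12 v. The remaining 14 v come from primes above V, where q contributes at most 4
    -- · 28 v / q; hence the 8.
    primes-between : ∀ v .{{_ : NonZero v}} .{{_ : NonZero K}} → 2 ^ (28 * v) ≤ B →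
      D ≤ 8 * Σₚ (λ q → byDec (2 ^ v <? q) (ρ q) 0) (2 ^ (28 * v))
    primes-between v Y≤B = *-cancelˡ-≤ (14 * v * K) {{m*n≢0 (14 * v) K {{m*n≢0 14 v}}}} (+-cancelʳ-≤ (14 * v * K * D) _ _ (begin
      14 * v * K * D + 14 * v * K * D  ≡⟨ lem₁ v K D ⟩
      D * (s * K)  ≤⟨ *-monoʳ-≤ D ℓY ⟩
      D * ℓ Y  ≤⟨ mertens-legendre Y {{m^n≢0 2 s}} Y≤B ⟩
      2 * K * D + Σₚ (λ q → (ℓ q + 1) * ρ (q ∸ 1)) Y  ≤⟨ +-mono-≤ (≤-trans (m≤m*n (2 * K * D) v) (≤-reflexive (lem₂ K D v))) (Σₚ-mono Y term) ⟩
      2 * v * K * D + Σₚ (λ q → 6 * K * low q + 4 * s * K * high q) Y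
        ≡⟨ cong (2 * v * K * D +_) (trans (Σₚ-+ (λ q → 6 * K * low q) (λ q → 4 * s * K * high q) Y) (cong₂ _+_ (Σₚ-* (6 * K) low Y) (Σₚ-* (4 * s * K) high Y))) ⟩
      2 * v * K * D + (6 * K * Σₚ low Y + 4 * s * K * Σₚ high Y)
        ≤⟨ +-monoʳ-≤ (2 * v * K * D) (+-monoˡ-≤ _ (*-monoʳ-≤ (6 * K) lowsum)) ⟩
      2 * v * K * D + (6 * K * (2 * (v * D)) + 4 * s * K * Σₚ high Y)
        ≡⟨ lem₃ v K D (Σₚ high Y) ⟩
      14 * v * K * (8 * Σₚ high Y) + 14 * v * K * D  ∎))
      where
      open ≤-Reasoning
      s Y V : ℕ
      s = 28 * v
      Y = 2 ^ s
      V = 2 ^ v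
      low high : ℕ → ℕ
      low  q = byDec (V <? q) 0 (lg q * ρ q)
      high q = byDec (V <? q) (ρ q) 0
      lem₁ : ∀ v K D → 14 * v * K * D + 14 * v * K * D ≡ D * (28 * v * K)
      lem₁ = solve-∀
      lem₂ : ∀ K D v → 2 * K * D * v ≡ 2 * v * K * D
      lem₂ = solve-∀
      lem₃ : ∀ v K D h → 2 * v * K * D + (6 * K * (2 * (v * D)) + 4 * (28 * v) * K * h) ≡ 14 * v * K * (8 * h) + 14 * v * K * D
      lem₃ = solve-∀
      ℓY : s * K ≤ ℓ Y
      ℓY = ≤-reflexive (sym (trans (cong lg (^-*-assoc 2 s K)) (lg-2^ (s * K))))
      V≤Y : V ≤ Y
      V≤Y = ^-monoʳ-≤ 2 (m≤n*m v 28)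
      lowsum : Σₚ low Y ≤ 2 * (v * D)
      lowsum = ≤-trans (≤-reflexive (trans (cong (Σₚ low) (sym (m+[n∸m]≡n V≤Y))) (Σₚ-upto (λ q → lg q * ρ q) V (Y ∸ V)))) (mertens-upper v (≤-trans V≤Y Y≤B))
      term : ∀ q → Prime q → q ≤ Y → (ℓ q + 1) * ρ (q ∸ 1) ≤ 6 * K * low q + 4 * s * K * high q
      term q@(suc r) pr q≤Y = ≤-trans (*-monoʳ-≤ (ℓ q + 1) (ρ-double (≤-pred (prime>1 pr)) q≤2r (s≤s z≤n) (≤-trans q≤Y Y≤B) (≤-trans (n≤1+n r) (≤-trans q≤Y Y≤B)))) (cases (V <? q))
        where
        q≤2r : q ≤ 2 * r
        q≤2r = +-mono-≤ (≤-pred (prime>1 pr)) (m≤m+n r 0)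
        1≤lg : 1 ≤ lg q
        1≤lg = 2^≤⇒≤lg (prime>1 pr)
        1≤K : 1 ≤ K
        1≤K = >-nonZero⁻¹ K
        cases : ∀ d → (ℓ q + 1) * (2 * ρ q) ≤ 6 * K * byDec d 0 (lg q * ρ q) + 4 * s * K * byDec d (ρ q) 0
        cases (no _) = begin
          (ℓ q + 1) * (2 * ρ q)  ≤⟨ *-monoˡ-≤ (2 * ρ q) (+-mono-≤ (ℓ≤ q) 1≤K) ⟩
          (suc (lg q) * K + K) * (2 * ρ q)  ≡⟨ lem₄ (lg q) K (ρ q) ⟩
          (lg q + 2) * (2 * K * ρ q)  ≤⟨ *-monoˡ-≤ (2 * K * ρ q) (+-monoʳ-≤ (lg q) (*-monoʳ-≤ 2 1≤lg)) ⟩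
          (lg q + 2 * lg q) * (2 * K * ρ q)  ≡⟨ lem₅ (lg q) K (ρ q) s ⟩
          6 * K * (lg q * ρ q) + 4 * s * K * 0  ∎
          where
          lem₄ : ∀ b K r → (suc b * K + K) * (2 * r) ≡ (b + 2) * (2 * K * r)
          lem₄ = solve-∀
          lem₅ : ∀ b K r s → (b + 2 * b) * (2 * K * r) ≡ 6 * K * (b * r) + 4 * s * K * 0
          lem₅ = solve-∀
        cases (yes _) = begin
          (ℓ q + 1) * (2 * ρ q)  ≤⟨ *-monoˡ-≤ (2 * ρ q) (+-mono-≤ (ℓ-upper {q} {s} q≤Y) (*-mono-≤ 1≤s 1≤K)) ⟩
          (s * K + s * K) * (2 * ρ q)  ≡⟨ lem₆ s K (ρ q) ⟩
          6 * K * 0 + 4 * s * K * ρ q  ∎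
          where
          1≤s : 1 ≤ s
          1≤s = ≤-trans (>-nonZero⁻¹ v) (m≤n*m v 28)
          lem₆ : ∀ s K r → (s * K + s * K) * (2 * r) ≡ 6 * K * 0 + 4 * s * K * r
          lem₆ = solve-∀

  module Euler (Y : ℕ) (Y≤B : Y ≤ B) where

    S : ℕ → ℕ
    S z = Σ₁ (λ m → byDec (smooth? z m) (ρ m) 0) Y

    byDec-mono : ∀ {P Q : Set} {a} (d : Dec P) (d′ : Dec Q) → (P → Q) → byDec d a 0 ≤ byDec d′ a 0
    byDec-mono (no _)  _       _ = z≤n
    byDec-mono (yes _) (yes _) _ = ≤-refl
    byDec-mono (yes x) (no ¬y) f = contradiction (f x) ¬y

    S-composite : ∀ z → ¬ Prime (suc z) → S (suc z) ≤ S z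
    S-composite z ¬pr = Σ₁-mono Y λ m _ _ → byDec-mono (smooth? (suc z) m) (smooth? z m)
      (λ s lt d pr → ≤-pred (≤∧≢⇒< (s lt d pr) λ { refl → ¬pr pr }))

    -- Split the q-smooth m by divisibility by q: the others are already z-smooth, and m = q k has k
    -- again q-smooth with 1 / m = (1 / q)(1 / k). Extending the range of k from Y / q to Y only
    -- weakens the bound.
    S-prime : ∀ z → Prime (suc z) → suc z * S (suc z) ≤ suc z * S z + S (suc z)
    S-prime z pr = begin
      q * S q  ≡⟨ Σ₁-* q (χ q) Y ⟨
      Σ₁ (λ m → q * χ q m) Y  ≤⟨ Σ₁-mono Y term ⟩
      Σ₁ (λ m → q * χ z m + byDec (q ∣? m) (χ q (m / q)) 0) Y
        ≡⟨ trans (Σ₁-+ (λ m → q * χ z m) _ Y) (cong₂ _+_ (Σ₁-* q (χ z) Y) (Σ₁-multiples q (χ q) Y)) ⟩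
      q * S z + Σ₁ (χ q) (Y / q)  ≤⟨ +-monoʳ-≤ (q * S z) (Σ₁-extend (χ q) (m/n≤m Y q)) ⟩
      q * S z + S q  ∎
      where
      open ≤-Reasoning
      q : ℕ
      q = suc z
      χ : ℕ → ℕ → ℕ
      χ z m = byDec (smooth? z m) (ρ m) 0
      term : ∀ m → 1 ≤ m → m ≤ Y → q * χ q m ≤ q * χ z m + byDec (q ∣? m) (χ q (m / q)) 0
      term m@(suc _) 1≤m m≤Y = cases (q ∣? m)
        where
        cases : ∀ d → q * χ q m ≤ q * χ z m + byDec d (χ q (m / q)) 0
        cases (no ¬d) = ≤-trans (*-monoʳ-≤ q (byDec-mono (smooth? q m) (smooth? z m)
          (λ s lt d pr → ≤-pred (≤∧≢⇒< (s lt d pr) λ { refl → ¬d d })))) (m≤m+n _ 0)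
        cases (yes d) = ≤-trans (smaller (smooth? q m) (smooth? q (m / q))) (m≤n+m _ (q * χ z m))
          where
          k : ℕ
          k = m / q
          kq : k * q ≡ m
          kq = m/n*n≡m d
          1≤k : 1 ≤ k
          1≤k = m≥n⇒m/n>0 (∣⇒≤ d)
          instance
            k≢0 : NonZero k
            k≢0 = >-nonZero 1≤k
          scaled : q * ρ m ≡ ρ k
          scaled = *-cancelˡ-≡ (q * ρ m) (ρ k) k (trans (sym (*-assoc k q (ρ m))) (trans (cong (_* ρ m) kq)
            (trans (ρ-spec m 1≤m (≤-trans m≤Y Y≤B)) (sym (ρ-spec k 1≤k (≤-trans (m/n≤m m q) (≤-trans m≤Y Y≤B)))))))
          smaller : ∀ (e : Dec (Smooth q m)) (e′ : Dec (Smooth q k)) → q * byDec e (ρ m) 0 ≤ byDec e′ (ρ k) 0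
          smaller (no _)  _       = ≤-trans (≤-reflexive (*-zeroʳ q)) z≤n
          smaller (yes _) (yes _) = ≤-reflexive scaled
          smaller (yes s) (no ¬s) = contradiction (λ {r} lt r∣k pr → smooth s pr (subst (r ∣_) kq (∣m⇒∣m*n q r∣k))) ¬s

    S-1 : 1 ≤ Y → S 1 ≤ D
    S-1 1≤Y = ≤-trans (go Y) (≤-reflexive (trans (sym (*-identityˡ (ρ 1))) (ρ-spec 1 ≤-refl (≤-trans 1≤Y Y≤B))))
      where
      χ : ℕ → ℕ
      χ m = byDec (smooth? 1 m) (ρ m) 0
      zero′ : ∀ m → 1 < m → (d : Dec (Smooth 1 m)) → byDec d (ρ m) 0 ≤ 0
      zero′ m 1<m (no _)  = z≤n
      zero′ m 1<m (yes s) with prime-divisor m 1<m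
      ... | q , pr , d = contradiction (smooth {{>-nonZero (<-trans (s≤s z≤n) 1<m)}} s pr d) (<⇒≱ (prime>1 pr))
      one : (d : Dec (Smooth 1 1)) → byDec d (ρ 1) 0 ≤ ρ 1
      one (yes _) = ≤-refl
      one (no _)  = z≤n
      go : ∀ Y → Σ₁ χ Y ≤ ρ 1
      go zero          = z≤n
      go (suc zero)    = one (smooth? 1 1)
      go (suc (suc Y)) = ≤-trans (+-mono-≤ (go (suc Y)) (zero′ (suc (suc Y)) (s≤s (s≤s z≤n)) (smooth? 1 (suc (suc Y))))) (≤-reflexive (+-identityʳ (ρ 1)))

    -- The factor 2 z / (z + 1) is the product of k² / (k² - 1) over 2 ≤ k ≤ z; it turns 1 / (1 - 1 / q) into 1 + 1 / q.
    euler : 1 ≤ Y → ∀ n → S (suc n) * Πₚ id (suc n) * (suc n + 1) ≤ 2 * suc n * D * Πₚ suc (suc n)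
    euler 1≤Y zero with isPrime? 1
    ... | yes pr = contradiction pr ¬prime[1]
    ... | no _   = ≤-trans (≤-reflexive (lem (S 1))) (≤-trans (*-monoʳ-≤ 2 (S-1 1≤Y)) (≤-reflexive (lem₂ D)))
      where
      lem : ∀ s → s * 1 * 2 ≡ 2 * s
      lem = solve-∀
      lem₂ : ∀ d → 2 * d ≡ 2 * d * 1
      lem₂ = solve-∀
    euler 1≤Y (suc n) with isPrime? (suc (suc n))
    ... | no ¬pr = *-cancelˡ-≤ z {{nz}} (begin
      z * (S (suc z′) * (P * 1) * (suc z′ + 1))  ≤⟨ *-monoʳ-≤ z (*-monoˡ-≤ (suc z′ + 1) (*-monoˡ-≤ (P * 1) (S-composite z′ ¬pr))) ⟩
      z * (S z′ * (P * 1) * (suc z′ + 1))  ≡⟨ lem₁ n (S z′) P ⟩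
      (S z′ * P * (z′ + 1)) * (n + 3)  ≤⟨ *-monoˡ-≤ (n + 3) (euler 1≤Y n) ⟩
      2 * z′ * D * P⁺ * (n + 3)  ≡⟨ lem₂ n D P⁺ ⟩
      2 * D * P⁺ * ((1 + n) * (n + 3))  ≤⟨ *-monoʳ-≤ (2 * D * P⁺) (square n) ⟩
      2 * D * P⁺ * ((n + 2) * (n + 2))  ≡⟨ lem₃ n D P⁺ ⟩
      z * (2 * suc z′ * D * (P⁺ * 1))  ∎)
      where
      open ≤-Reasoning
      z z′ P P⁺ : ℕ
      z′ = suc n
      z = n + 2
      P = Πₚ id z′
      P⁺ = Πₚ suc z′
      nz : NonZero z
      nz = >-nonZero (≤-trans (s≤s z≤n) (m≤n+m 2 n))
      lem₁ : ∀ n s p → (n + 2) * (s * (p * 1) * (suc (suc n) + 1)) ≡ (s * p * (suc n + 1)) * (n + 3)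
      lem₁ = solve-∀
      lem₂ : ∀ n d p → 2 * suc n * d * p * (n + 3) ≡ 2 * d * p * ((1 + n) * (n + 3))
      lem₂ = solve-∀
      lem₃ : ∀ n d p → 2 * d * p * ((n + 2) * (n + 2)) ≡ (n + 2) * (2 * suc (suc n) * d * (p * 1))
      lem₃ = solve-∀
      square : ∀ n → (1 + n) * (n + 3) ≤ (n + 2) * (n + 2)
      square n = ≤-trans (n≤1+n _) (≤-reflexive (lem₄ n))
        where
        lem₄ : ∀ n → 1 + (1 + n) * (n + 3) ≡ (n + 2) * (n + 2)
        lem₄ = solve-∀
    ... | yes pr = *-cancelˡ-≤ (suc n) (begin
      z′ * (S q * (P * q) * (q + 1))  ≡⟨ lem₁ n (S q) P ⟩
      (z′ * S q) * (P * q * (q + 1))  ≤⟨ *-monoˡ-≤ (P * q * (q + 1)) S′ ⟩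
      (q * S z′) * (P * q * (q + 1))  ≡⟨ lem₂ n (S z′) P ⟩
      (S z′ * P * (z′ + 1)) * (q * (q + 1))  ≤⟨ *-monoˡ-≤ (q * (q + 1)) (euler 1≤Y n) ⟩
      2 * z′ * D * P⁺ * (q * (q + 1))  ≡⟨ lem₃ n D P⁺ ⟩
      z′ * (2 * q * D * (P⁺ * suc q))  ∎)
      where
      open ≤-Reasoning
      q z′ P P⁺ : ℕ
      z′ = suc n
      q = suc z′
      P = Πₚ id z′
      P⁺ = Πₚ suc z′
      S′ : z′ * S q ≤ q * S z′
      S′ = +-cancelʳ-≤ (S q) _ _ (≤-trans (≤-reflexive (+-comm (z′ * S q) (S q))) (S-prime z′ pr))
      lem₁ : ∀ n s p → suc n * (s * (p * suc (suc n)) * (suc (suc n) + 1)) ≡ (suc n * s) * (p * suc (suc n) * (suc (suc n) + 1))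
      lem₁ = solve-∀
      lem₂ : ∀ n s p → (suc (suc n) * s) * (p * suc (suc n) * (suc (suc n) + 1)) ≡ (s * p * (suc n + 1)) * (suc (suc n) * (suc (suc n) + 1))
      lem₂ = solve-∀
      lem₃ : ∀ n d p → 2 * suc n * d * p * (suc (suc n) * (suc (suc n) + 1)) ≡ suc n * (2 * suc (suc n) * d * (p * suc (suc (suc n))))
      lem₃ = solve-∀

    S-top : S Y ≡ Σ₁ ρ Y
    S-top = ≤-antisym (Σ₁-mono Y λ m _ _ → le (smooth? Y m)) (Σ₁-mono Y λ m 1≤m m≤Y → ge m 1≤m m≤Y (smooth? Y m))
      where
      le : ∀ {m} (d : Dec (Smooth Y m)) → byDec d (ρ m) 0 ≤ ρ m
      le (yes _) = ≤-refl
      le (no _)  = z≤n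
      ge : ∀ m → 1 ≤ m → m ≤ Y → (d : Dec (Smooth Y m)) → ρ m ≤ byDec d (ρ m) 0
      ge m 1≤m m≤Y (yes _) = ≤-refl
      ge m 1≤m m≤Y (no ¬s) = contradiction (λ {q} lt _ _ → ≤-trans (≤-pred lt) m≤Y) ¬s

  harmonic : ∀ s → 2 ^ s ≤ B → s * D ≤ 2 * Σ₁ ρ (2 ^ s)
  harmonic zero    _ = z≤n
  harmonic (suc s) le = begin
    D + s * D  ≤⟨ +-monoʳ-≤ D (harmonic s (≤-trans (m≤m+n (2 ^ s) _) le)) ⟩
    D + 2 * Σ₁ ρ (2 ^ s)  ≡⟨ cong (_+ 2 * Σ₁ ρ (2 ^ s)) (sym (ρ-spec (2 ^ suc s) (>-nonZero⁻¹ _ {{m^n≢0 2 (suc s)}}) le)) ⟩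
    2 * 2 ^ s * ρ (2 ^ suc s) + 2 * Σ₁ ρ (2 ^ s)  ≡⟨ lem (2 ^ s) (ρ (2 ^ suc s)) (Σ₁ ρ (2 ^ s)) ⟩
    2 * (Σ₁ ρ (2 ^ s) + 2 ^ s * ρ (2 ^ suc s))  ≤⟨ *-monoʳ-≤ 2 (Σ₁-block ρ (ρ (2 ^ suc s)) (2 ^ s) (2 ^ s) (λ m lt m≤ → ρ-anti (≤-trans (s≤s z≤n) lt) (≤-trans m≤ (≤-reflexive e)) le)) ⟩
    2 * Σ₁ ρ (2 ^ s + 2 ^ s)  ≡⟨ cong (λ z → 2 * Σ₁ ρ z) e ⟩
    2 * Σ₁ ρ (2 ^ suc s)  ∎
    where
    open ≤-Reasoning
    e : 2 ^ s + 2 ^ s ≡ 2 ^ suc s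
    e = cong (2 ^ s +_) (sym (+-identityʳ (2 ^ s)))
    lem : ∀ t r x → 2 * t * r + 2 * x ≡ 2 * (x + t * r)
    lem = solve-∀

  -- Π (1 + 1/q) is at least s / 4: the harmonic sum up to 2^s is at least s / 2, and passing from 1
  -- / (1 - 1/q) to 1 + 1/q loses at most a factor 2.
  euler-product : ∀ s .{{_ : NonZero D}} → 2 ^ s ≤ B → s * Πₚ id (2 ^ s) ≤ 4 * Πₚ suc (2 ^ s)
  euler-product s le = go (2 ^ s) refl (>-nonZero⁻¹ (2 ^ s) {{m^n≢0 2 s}})
    where
    go : ∀ Y → 2 ^ s ≡ Y → 1 ≤ Y → s * Πₚ id Y ≤ 4 * Πₚ suc Y
    go (suc n) Y≡ _ = *-cancelˡ-≤ (D * (Y + 1)) {{m*n≢0 D (Y + 1)}} (begin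
      D * (Y + 1) * (s * Πₚ id Y)  ≡⟨ lem₁ D (Y + 1) s (Πₚ id Y) ⟩
      s * D * (Πₚ id Y * (Y + 1))  ≤⟨ *-monoˡ-≤ (Πₚ id Y * (Y + 1)) (subst (λ z → s * D ≤ 2 * Σ₁ ρ z) Y≡ (harmonic s le)) ⟩
      2 * Σ₁ ρ Y * (Πₚ id Y * (Y + 1))  ≡⟨ cong (λ z → 2 * z * (Πₚ id Y * (Y + 1))) (sym E.S-top) ⟩
      2 * E.S Y * (Πₚ id Y * (Y + 1))  ≡⟨ lem₂ (E.S Y) (Πₚ id Y) (Y + 1) ⟩
      2 * (E.S Y * Πₚ id Y * (Y + 1))  ≤⟨ *-monoʳ-≤ 2 (E.euler (s≤s z≤n) n) ⟩
      2 * (2 * Y * D * Πₚ suc Y)  ≤⟨ *-monoʳ-≤ 2 (*-monoˡ-≤ (Πₚ suc Y) (*-monoˡ-≤ D (*-monoʳ-≤ 2 (m≤m+n Y 1)))) ⟩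
      2 * (2 * (Y + 1) * D * Πₚ suc Y)  ≡⟨ lem₃ D (Y + 1) (Πₚ suc Y) ⟩
      D * (Y + 1) * (4 * Πₚ suc Y)  ∎)
      where
      open ≤-Reasoning
      Y : ℕ
      Y = suc n
      module E = Euler Y (subst (_≤ B) Y≡ le)
      lem₁ : ∀ D y s p → D * y * (s * p) ≡ s * D * (p * y)
      lem₁ = solve-∀
      lem₂ : ∀ s p y → 2 * s * (p * y) ≡ 2 * (s * p * y)
      lem₂ = solve-∀
      lem₃ : ∀ D y p → 2 * (2 * y * D * p) ≡ D * y * (4 * p)
      lem₃ = solve-∀

-- Counting

sumL : (ℕ → ℕ) → List ℕ → ℕ
sumL f []       = 0
sumL f (x ∷ xs) = f x + sumL f xs

sumL-++ : ∀ f xs ys → sumL f (xs ++ ys) ≡ sumL f xs + sumL f ys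
sumL-++ f []       ys = refl
sumL-++ f (x ∷ xs) ys = trans (cong (f x +_) (sumL-++ f xs ys)) (sym (+-assoc (f x) _ _))

sumL-concatMap : ∀ f (g : ℕ → List ℕ) xs → sumL f (concatMap g xs) ≡ sumL (λ x → sumL f (g x)) xs
sumL-concatMap f g []       = refl
sumL-concatMap f g (x ∷ xs) = trans (sumL-++ f (g x) (concatMap g xs)) (cong (sumL f (g x) +_) (sumL-concatMap f g xs))

sumL-map : ∀ f g xs → sumL f (map g xs) ≡ sumL (f ∘ g) xs
sumL-map f g []       = refl
sumL-map f g (x ∷ xs) = cong (f (g x) +_) (sumL-map f g xs)

sumL-mono : ∀ {f g} xs → (∀ x → f x ≤ g x) → sumL f xs ≤ sumL g xs
sumL-mono []       le = z≤n
sumL-mono (x ∷ xs) le = +-mono-≤ (le x) (sumL-mono xs le)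

sumL-mono-All : ∀ {f g xs} → All (λ x → f x ≤ g x) xs → sumL f xs ≤ sumL g xs
sumL-mono-All []         = z≤n
sumL-mono-All (le ∷ les) = +-mono-≤ le (sumL-mono-All les)

sumL-+ : ∀ f g xs → sumL (λ x → f x + g x) xs ≡ sumL f xs + sumL g xs
sumL-+ f g []       = refl
sumL-+ f g (x ∷ xs) = trans (cong (f x + g x +_) (sumL-+ f g xs)) (lem (f x) (g x) (sumL f xs) (sumL g xs))
  where
  lem : ∀ a b c d → a + b + (c + d) ≡ a + c + (b + d)
  lem = solve-∀

sumL-const : ∀ c xs → sumL (λ _ → c) xs ≡ length xs * c
sumL-const c []       = refl
sumL-const c (x ∷ xs) = cong (c +_) (sumL-const c xs)

sumL-swap : ∀ (F : ℕ → ℕ → ℕ) xs ys → sumL (λ x → sumL (F x) ys) xs ≡ sumL (λ y → sumL (λ x → F x y) xs) ys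
sumL-swap F []       ys = sym (trans (sumL-const 0 ys) (*-zeroʳ (length ys)))
sumL-swap F (x ∷ xs) ys = trans (cong (sumL (F x) ys +_) (sumL-swap F xs ys)) (sym (sumL-+ (F x) (λ y → sumL (λ x → F x y) xs) ys))

sumL-Σₚ : ∀ (F : ℕ → ℕ → ℕ) b xs → sumL (λ x → Σₚ (F x) b) xs ≡ Σₚ (λ q → sumL (λ x → F x q) xs) b
sumL-Σₚ F zero    xs = trans (sumL-const 0 xs) (*-zeroʳ (length xs))
sumL-Σₚ F (suc b) xs = trans (sumL-+ (λ x → Σₚ (F x) b) _ xs) (cong₂ _+_ (sumL-Σₚ F b xs) (inner (isPrime? (suc b))))
  where
  inner : ∀ d → sumL (λ x → byDec d (F x (suc b)) 0) xs ≡ byDec d (sumL (λ x → F x (suc b)) xs) 0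
  inner (yes _) = refl
  inner (no  _) = trans (sumL-const 0 xs) (*-zeroʳ (length xs))

equal? : ℕ → ℕ → ℕ
equal? m n = byDec (m ≟ n) 1 0

occ : ℕ → List ℕ → ℕ
occ n = sumL (λ m → (equal? m n))

occ-∈ : ∀ {n xs} → n ∈ xs → 1 ≤ occ n xs
occ-∈ {n} (here {x} {xs} refl) with x ≟ x
... | yes _ = s≤s z≤n
... | no ¬e = contradiction refl ¬e
occ-∈ {n} (there {x} {xs} p) = ≤-trans (occ-∈ p) (m≤n+m _ (equal? x n))

occ-absent : ∀ {n xs} → All (_≢ n) xs → occ n xs ≡ 0
occ-absent []              = refl
occ-absent {n} {x ∷ _} (≢ ∷ ps) with x ≟ n
... | yes e = contradiction e ≢
... | no  _ = occ-absent ps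

indicator-sym : ∀ m n → (equal? m n) ≡ (equal? n m)
indicator-sym m n with m ≟ n | n ≟ m
... | yes _ | yes _ = refl
... | no  _ | no  _ = refl
... | yes e | no ¬e = contradiction (sym e) ¬e
... | no ¬e | yes e = contradiction (sym e) ¬e

-- Double counting of pairs of equal entries in the list and its deduplication: every entry occurs
-- in some pair, and every distinct value in at most M.
length-deduplicate : ∀ M xs → (∀ n → occ n xs ≤ M) → length xs ≤ length (deduplicate _≟_ xs) * M
length-deduplicate M xs bound = begin
  length xs  ≡⟨ *-identityʳ _ ⟨
  length xs * 1  ≡⟨ sumL-const 1 xs ⟨
  sumL (λ _ → 1) xs  ≤⟨ sumL-mono-All {xs = xs} (All.tabulate λ {m} m∈ → occ-∈ (∈-deduplicate⁺ _≟_ m∈)) ⟩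
  sumL (λ m → sumL (λ n → (equal? n m)) ys) xs  ≡⟨ sumL-swap (λ m n → (equal? n m)) xs ys ⟩
  sumL (λ n → sumL (λ m → (equal? n m)) xs) ys  ≤⟨ sumL-mono ys (λ n → ≤-trans (sumL-mono xs (λ m → ≤-reflexive (indicator-sym n m))) (bound n)) ⟩
  sumL (λ _ → M) ys  ≡⟨ sumL-const M ys ⟩
  length ys * M  ∎
  where
  open ≤-Reasoning
  ys : List ℕ
  ys = deduplicate _≟_ xs

All-deduplicate : ∀ {P : ℕ → Set} {xs} → All P xs → All P (deduplicate _≟_ xs)
All-deduplicate {xs = xs} ps = All.tabulate λ m∈ → All.lookup ps (∈-deduplicate⁻ _≟_ xs m∈)

All-++ : ∀ {P : ℕ → Set} {xs ys} → All P xs → All P ys → All P (xs ++ ys)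
All-++ []       qs = qs
All-++ (p ∷ ps) qs = p ∷ All-++ ps qs

All-concatMap : ∀ {P : ℕ → Set} {g : ℕ → List ℕ} {xs} → All (λ x → All P (g x)) xs → All P (concatMap g xs)
All-concatMap []         = []
All-concatMap (ps ∷ pss) = All-++ ps (All-concatMap pss)

All-map : ∀ {P : ℕ → Set} {g : ℕ → ℕ} {xs} → All (P ∘ g) xs → All P (map g xs)
All-map []       = []
All-map (p ∷ ps) = p ∷ All-map ps

primesBetween : ℕ → ℕ → List ℕ
primesBetween a zero    = []
primesBetween a (suc b) = byDec (isPrime? (suc b)) (byDec (a <? suc b) (suc b ∷ primesBetween a b) (primesBetween a b)) (primesBetween a b)

above : ℕ → (ℕ → ℕ) → ℕ → ℕ
above a f q = byDec (a <? q) (f q) 0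

sumL-primesBetween : ∀ f a b → sumL f (primesBetween a b) ≡ Σₚ (above a f) b
sumL-primesBetween f a zero    = refl
sumL-primesBetween f a (suc b) with isPrime? (suc b)
... | no  _ = trans (sumL-primesBetween f a b) (sym (+-identityʳ _))
... | yes _ with a <? suc b
...   | yes _ = trans (cong (f (suc b) +_) (sumL-primesBetween f a b)) (+-comm (f (suc b)) _)
...   | no  _ = trans (sumL-primesBetween f a b) (sym (+-identityʳ _))

All-primesBetween : ∀ a b → All (λ q → Prime q × a < q × q ≤ b) (primesBetween a b)
All-primesBetween a zero    = []
All-primesBetween a (suc b) with isPrime? (suc b)
... | no  _  = All.map (λ (pr , lt , le) → pr , lt , m≤n⇒m≤1+n le) (All-primesBetween a b)
... | yes pr with a <? suc b
...   | yes lt = (pr , lt , ≤-refl) ∷ All.map (λ (pr , lt , le) → pr , lt , m≤n⇒m≤1+n le) (All-primesBetween a b)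
...   | no  _  = All.map (λ (pr , lt , le) → pr , lt , m≤n⇒m≤1+n le) (All-primesBetween a b)

Σₚ-extend : ∀ f {M N} → M ≤ N → Σₚ f M ≤ Σₚ f N
Σₚ-extend f {M} {N} M≤N with m≤n⇒∃[o]m+o≡n M≤N
... | r , refl = go r
  where
  go : ∀ r → Σₚ f M ≤ Σₚ f (M + r)
  go zero    = ≤-reflexive (cong (Σₚ f) (sym (+-identityʳ M)))
  go (suc r) = ≤-trans (go r) (≤-trans (m≤m+n _ _) (≤-reflexive (cong (Σₚ f) (sym (+-suc M r)))))

divides? : ℕ → ℕ → ℕ
divides? n q = byDec (q ∣? n) 1 0

prime∤⇒ : ∀ {q q′ n} → Prime q → Prime q′ → q ≢ q′ → q ∣ n * q′ → q ∣ n
prime∤⇒ {q} {q′} {n} pr pr′ ≢ d with euclidsLemma n q′ pr d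
... | inj₁ q∣n  = q∣n
... | inj₂ q∣q′ = contradiction (prime⇒irreducible pr′ q∣q′) λ
  { (inj₁ refl) → ¬prime[1] pr ; (inj₂ e) → ≢ e }

-- Distinct prime divisors above V multiply to a divisor of n.
many-prime-divisors : ∀ V .{{_ : NonZero V}} b n .{{_ : NonZero n}} → V ^ Σₚ (above V (divides? n)) b ≤ n
many-prime-divisors V zero    n = >-nonZero⁻¹ n
many-prime-divisors V (suc b) n with isPrime? (suc b)
... | no  _ = ≤-trans (≤-reflexive (cong (V ^_) (+-identityʳ (Σₚ (above V (divides? n)) b)))) (many-prime-divisors V b n)
... | yes pr with V <? suc b
...   | no  _ = ≤-trans (≤-reflexive (cong (V ^_) (+-identityʳ (Σₚ (above V (divides? n)) b)))) (many-prime-divisors V b n)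
...   | yes V<q with suc b ∣? n
...     | no  _ = ≤-trans (≤-reflexive (cong (V ^_) (+-identityʳ (Σₚ (above V (divides? n)) b)))) (many-prime-divisors V b n)
...     | yes (divides n′ refl) = begin
  V ^ (Σₚ (above V (divides? (n′ * q))) b + 1)  ≡⟨ cong (V ^_) (+-comm (Σₚ (above V (divides? (n′ * q))) b) 1) ⟩
  V * V ^ Σₚ (above V (divides? (n′ * q))) b  ≤⟨ *-monoʳ-≤ V (^-monoʳ-≤ V (Σₚ-mono b fewer)) ⟩
  V * V ^ Σₚ (above V (divides? n′)) b  ≤⟨ *-mono-≤ (<⇒≤ V<q) (many-prime-divisors V b n′ {{m*n≢0⇒m≢0 n′}}) ⟩
  q * n′  ≡⟨ *-comm q n′ ⟩
  n′ * q  ∎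
  where
  open ≤-Reasoning
  q : ℕ
  q = suc b
  fewer : ∀ r → Prime r → r ≤ b → above V (divides? (n′ * q)) r ≤ above V (divides? n′) r
  fewer r pr′ r≤b with V <? r
  ... | no  _ = z≤n
  ... | yes _ with r ∣? n′ * q | r ∣? n′
  ...   | no _  | _     = z≤n
  ...   | yes _ | yes _ = ≤-refl
  ...   | yes d | no ¬d = contradiction (prime∤⇒ pr′ pr (<⇒≢ (s≤s r≤b)) d) ¬d

quo : ℕ → ℕ → ℕ
quo x zero    = 0
quo x (suc m) = x / suc m

abstract
  -- 448 = 16 · 28: below, n ≤ X < Y^16 = V^448, so n has at most 448 distinct prime divisors above
  -- V.
  divisorBound : ℕ
  divisorBound = 448

  448≤divisorBound : 448 ≤ divisorBound
  448≤divisorBound = ≤-refl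

abstract
  steps : ℕ
  steps = 196

  196≤steps : 196 ≤ steps
  196≤steps = ≤-refl

2^≤⇒≤⌊log₂⌋ : ∀ k {n} → 2 ^ k ≤ n → k ≤ ⌊log₂ n ⌋
2^≤⇒≤⌊log₂⌋ k {n} le = subst (_≤ ⌊log₂ n ⌋) (⌊log₂[2^n]⌋≡n k) (⌊log₂⌋-mono-≤ {2 ^ k} {n} le)

-- In one extension round a value is either kept or made by one of at most 448 of its prime
-- divisors, which gives the factor 449 for each round. The last prime gives another 448, and the
-- leaves of the tree are distinct.
multiplicity : ℕ
multiplicity = divisorBound * (suc divisorBound ^ steps * 1)

-- 4 and the product over primes up to P₀ come from Euler's product, 64 from Chebyshev's bound, 16
-- from each extension round, and 8 from the threshold in Markov's inequality.
density-constant : ℕ → ℕ → ℕ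
density-constant P₀ n₀ = 4 * Πₚ suc P₀ * (n₀ * (64 * 16 ^ steps * 8)) * multiplicity

Σₚ-split : ∀ f a {N} → a ≤ N → Σₚ f N ≤ Σₚ (above a f) N + Σₚ f a
Σₚ-split f a {N} a≤N = begin
  Σₚ f N  ≤⟨ Σₚ-mono N (λ q _ _ → term q (a <? q)) ⟩
  Σₚ (λ q → above a f q + byDec (a <? q) 0 (f q)) N  ≡⟨ Σₚ-+ (above a f) (λ q → byDec (a <? q) 0 (f q)) N ⟩
  Σₚ (above a f) N + Σₚ (λ q → byDec (a <? q) 0 (f q)) N  ≡⟨ cong (Σₚ (above a f) N +_) (trans (cong (Σₚ _) (sym (m+[n∸m]≡n a≤N))) (Σₚ-upto f a (N ∸ a))) ⟩
  Σₚ (above a f) N + Σₚ f a  ∎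
  where
  open ≤-Reasoning
  term : ∀ q (d : Dec (a < q)) → f q ≤ byDec d (f q) 0 + byDec d 0 (f q)
  term q (yes _) = m≤m+n (f q) 0
  term q (no  _) = ≤-refl

Σₚ-above-0 : ∀ f a → Σₚ (above a f) a ≤ 0
Σₚ-above-0 f a = ≤-trans (Σₚ-const 0 a none) (≤-reflexive (*-zeroʳ a))
  where
  none : ∀ q → Prime q → q ≤ a → above a f q ≤ 0
  none q _ q≤a with a <? q
  ... | yes lt = contradiction q≤a (<⇒≱ lt)
  ... | no  _  = z≤n

length-concatMap : ∀ (g : ℕ → List ℕ) xs → length (concatMap g xs) ≡ sumL (length ∘ g) xs
length-concatMap g []       = refl
length-concatMap g (x ∷ xs) = trans (length-++ (g x)) (cong (length (g x) +_) (length-concatMap g xs))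

-- The product over the primes in (z, z + r], unfolded from below so that it runs in step with the
-- recursion of `tree`.
Πᵣ : (ℕ → ℕ) → ℕ → ℕ → ℕ
Πᵣ f z zero    = 1
Πᵣ f z (suc r) = byDec (isPrime? (suc z)) (f (suc z)) 1 * Πᵣ f (suc z) r

Σᵣ : (ℕ → ℕ) → ℕ → ℕ → ℕ
Σᵣ f z zero    = 0
Σᵣ f z (suc r) = byDec (isPrime? (suc z)) (f (suc z)) 0 + Σᵣ f (suc z) r

Πₚ-Πᵣ : ∀ f z r → Πₚ f z * Πᵣ f z r ≡ Πₚ f (z + r)
Πₚ-Πᵣ f z zero    = trans (*-identityʳ _) (cong (Πₚ f) (sym (+-identityʳ z)))
Πₚ-Πᵣ f z (suc r) = trans (sym (*-assoc (Πₚ f z) _ _)) (trans (Πₚ-Πᵣ f (suc z) r) (cong (Πₚ f) (sym (+-suc z r))))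

Σₚ-Σᵣ : ∀ f z r → Σₚ f z + Σᵣ f z r ≡ Σₚ f (z + r)
Σₚ-Σᵣ f z zero    = trans (+-identityʳ _) (cong (Σₚ f) (sym (+-identityʳ z)))
Σₚ-Σᵣ f z (suc r) = trans (sym (+-assoc (Σₚ f z) _ _)) (trans (Σₚ-Σᵣ f (suc z) r) (cong (Σₚ f) (sym (+-suc z r))))

Πᵣ-id≢0 : ∀ z r → NonZero (Πᵣ id z r)
Πᵣ-id≢0 z zero    = nonZero
Πᵣ-id≢0 z (suc r) with isPrime? (suc z)
... | yes _ = m*n≢0 (suc z) (Πᵣ id (suc z) r) {{nonZero}} {{Πᵣ-id≢0 (suc z) r}}
... | no  _ = m*n≢0 1 (Πᵣ id (suc z) r) {{nonZero}} {{Πᵣ-id≢0 (suc z) r}}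

Πₚ-id≥1 : ∀ z → 1 ≤ Πₚ id z
Πₚ-id≥1 zero    = ≤-refl
Πₚ-id≥1 (suc z) with isPrime? (suc z)
... | yes _ = *-mono-≤ {1} {_} {1} (Πₚ-id≥1 z) (s≤s z≤n)
... | no  _ = *-mono-≤ {1} {_} {1} (Πₚ-id≥1 z) ≤-refl

-- The tree of products, its extensions and the last prime

module Construction (v X : ℕ) (13≤v : 13 ≤ v) (≤X : 2 ^ (12 * (28 * v)) ≤ X) (X< : X < 2 ^ (16 * (28 * v))) where

  -- Leaves of the tree lie in [Y, Y⁸); at most 196 = 7 * 28 primes from (V, Y] bring them into [Y⁸, Y⁹),
  -- and since Y ^ 12 ≤ X < Y ^ 16 a last prime in (Y, X / m] is at most m.
  s V Y Y⁸ : ℕ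
  s  = 28 * v
  V  = 2 ^ v
  Y  = 2 ^ s
  Y⁸ = 2 ^ (8 * s)

  V≤Y : V ≤ Y
  V≤Y = ^-monoʳ-≤ 2 (m≤n*m v 28)

  Y≤X : Y ≤ X
  Y≤X = ≤-trans (^-monoʳ-≤ 2 (m≤n*m s 12)) ≤X

  tree : ℕ → ℕ → ℕ → List ℕ
  tree z zero    n = byDec (Y ≤? n) (byDec (n <? Y⁸) (n ∷ []) []) []
  tree z (suc r) n = byDec (isPrime? (suc z))
    (byDec (suc z ≤? n) (tree (suc z) r n ++ tree (suc z) r (n * suc z)) []) (tree (suc z) r n)

  extend : ℕ → List ℕ
  extend m = byDec (Y⁸ ≤? m) (m ∷ []) (concatMap (λ q → byDec (q ∣? m) [] (m * q ∷ [])) (primesBetween V Y))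

  extendⁿ : ℕ → List ℕ → List ℕ
  extendⁿ zero    xs = xs
  extendⁿ (suc j) xs = extendⁿ j (concatMap extend xs)

  complete : ℕ → List ℕ
  complete m = byDec (Y⁸ ≤? m) (map (m *_) (primesBetween Y (quo X m))) []

  module Soundness (P₀ : ℕ) (Good : ℕ → Set)
    (step : ∀ n q → Good n → Prime q → P₀ < q → ¬ q ∣ n → q ≤ n → Good (n * q))
    (P₀≤V : P₀ ≤ V) where

    -- Primes are taken in increasing order in the tree, so divisibility by primes above z is all
    -- that has to be excluded for the next prime to be new. At z = Y the same condition serves the
    -- last prime.
    Clean : ℕ → ℕ → Set
    Clean z n = Good n × (∀ q → Prime q → z < q → ¬ q ∣ n)

    clean-step : ∀ {z n q} → P₀ ≤ z → Clean z n → Prime q → z < q → q ≤ n → Clean q (n * q)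
    clean-step P₀≤z (g , c) pr z<q q≤n = step _ _ g pr (≤-<-trans P₀≤z z<q) (c _ pr z<q) q≤n ,
      λ r prr q<r d → c r prr (<-trans z<q q<r) (prime∤⇒ prr pr (λ e → <⇒≢ q<r (sym e)) d)

    clean-weaken : ∀ {z n} → Clean z n → Clean (suc z) n
    clean-weaken (g , c) = g , λ q pr lt → c q pr (<-trans (n<1+n _) lt)

    tree-sound : ∀ z r n → P₀ ≤ z → z + r ≡ Y → Clean z n → All (λ m → Clean Y m × Y ≤ m) (tree z r n)
    tree-sound z zero n P₀≤z e c with Y ≤? n
    ... | no  _ = []
    ... | yes le with n <? Y⁸
    ...   | no  _ = []
    ...   | yes _ = (subst (λ z → Clean z n) (trans (sym (+-identityʳ z)) e) c , le) ∷ []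
    tree-sound z (suc r) n P₀≤z e c with isPrime? (suc z)
    ... | no  _ = tree-sound (suc z) r n (m≤n⇒m≤1+n P₀≤z) (trans (sym (+-suc z r)) e) (clean-weaken c)
    ... | yes pr with suc z ≤? n
    ...   | no  _ = []
    ...   | yes le = All-++ (tree-sound (suc z) r n (m≤n⇒m≤1+n P₀≤z) (trans (sym (+-suc z r)) e) (clean-weaken c))
                            (tree-sound (suc z) r (n * suc z) (m≤n⇒m≤1+n P₀≤z) (trans (sym (+-suc z r)) e) (clean-step P₀≤z c pr (n<1+n z) le))

    extend-sound : ∀ m → Clean Y m × Y ≤ m → All (λ m → Clean Y m × Y ≤ m) (extend m)
    extend-sound m (c@(g , no>) , Y≤m) with Y⁸ ≤? m
    ... | yes _ = (c , Y≤m) ∷ []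
    ... | no  _ = All-concatMap (All.map one (All-primesBetween V Y))
      where
      one : ∀ {q} → Prime q × V < q × q ≤ Y → All (λ m → Clean Y m × Y ≤ m) (byDec (q ∣? m) [] (m * q ∷ []))
      one {q} (pr , V<q , q≤Y) with q ∣? m
      ... | yes _ = []
      ... | no ¬d = ((step m q g pr (≤-<-trans P₀≤V V<q) ¬d (≤-trans q≤Y Y≤m) ,
            λ r prr Y<r d → no> r prr Y<r (prime∤⇒ prr pr (λ { refl → <⇒≱ Y<r q≤Y }) d)) ,
            ≤-trans Y≤m (m≤m*n m q {{prime⇒nonZero pr}})) ∷ []

    extendⁿ-sound : ∀ j xs → All (λ m → Clean Y m × Y ≤ m) xs → All (λ m → Clean Y m × Y ≤ m) (extendⁿ j xs)
    extendⁿ-sound zero    xs ps = ps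
    extendⁿ-sound (suc j) xs ps = extendⁿ-sound j _ (All-concatMap (All.map (λ {m} → extend-sound m) ps))

    complete-sound : ∀ m → Clean Y m × Y ≤ m → All (λ n → 1 ≤ n × n ≤ X × Good n) (complete m)
    complete-sound zero c with Y⁸ ≤? 0
    ... | no  _ = []
    ... | yes le = contradiction (>-nonZero⁻¹ Y⁸ {{m^n≢0 2 (8 * s)}}) (≤⇒≯ le)
    complete-sound m@(suc _) ((g , no>) , Y≤m) with Y⁸ ≤? m
    ... | no  _ = []
    ... | yes le = All-map (All.map (λ {q} → one {q}) (All-primesBetween Y (X / m)))
      where
      one : ∀ {q} → Prime q × Y < q × q ≤ X / m → 1 ≤ m * q × m * q ≤ X × Good (m * q)
      one {q} (pr , Y<q , q≤) =
        ≤-trans (<⇒≤ (prime>1 pr)) (m≤n*m q m) ,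
        ≤-trans (≤-trans (*-monoʳ-≤ m q≤) (≤-reflexive (*-comm m (X / m)))) (m/n*n≤m X m) ,
        step m q g pr (≤-<-trans P₀≤V (≤-<-trans V≤Y Y<q)) (no> q pr Y<q) (≤-trans q≤ (<⇒≤ (m<n*o⇒m/o<n {X} {m} {m} X<m²)))
        where
        X<m² : X < m * m
        X<m² = <-≤-trans X< (≤-trans (≤-reflexive (trans (cong (2 ^_) (lem s)) (^-distribˡ-+-* 2 (8 * s) (8 * s)))) (*-mono-≤ le le))
          where
          lem : ∀ s → 16 * s ≡ 8 * s + 8 * s
          lem = solve-∀

  tree-multiples : ∀ z r n → All (n ∣_) (tree z r n)
  tree-multiples z zero n with Y ≤? n
  ... | no  _ = []
  ... | yes _ with n <? Y⁸
  ...   | no  _ = []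
  ...   | yes _ = ∣-refl ∷ []
  tree-multiples z (suc r) n with isPrime? (suc z)
  ... | no  _ = tree-multiples (suc z) r n
  ... | yes _ with suc z ≤? n
  ...   | no  _ = []
  ...   | yes _ = All-++ (tree-multiples (suc z) r n) (All.map (∣-trans (m∣m*n (suc z))) (tree-multiples (suc z) r (n * suc z)))

  tree-coprime : ∀ z r n q → Prime q → q ≤ z → ¬ q ∣ n → All (λ m → ¬ q ∣ m) (tree z r n)
  tree-coprime z zero n q pr q≤z ¬d with Y ≤? n
  ... | no  _ = []
  ... | yes _ with n <? Y⁸
  ...   | no  _ = []
  ...   | yes _ = ¬d ∷ []
  tree-coprime z (suc r) n q pr q≤z ¬d with isPrime? (suc z)
  ... | no  _ = tree-coprime (suc z) r n q pr (m≤n⇒m≤1+n q≤z) ¬d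
  ... | yes pr′ with suc z ≤? n
  ...   | no  _ = []
  ...   | yes _ = All-++ (tree-coprime (suc z) r n q pr (m≤n⇒m≤1+n q≤z) ¬d)
                         (tree-coprime (suc z) r (n * suc z) q pr (m≤n⇒m≤1+n q≤z) (¬d ∘ prime∤⇒ pr pr′ (<⇒≢ (s≤s q≤z))))

  -- The two branches at q are told apart by divisibility by q: the first never acquires this factor
  -- afterwards, and the second never loses it.
  tree-unique : ∀ z r n → (∀ q → Prime q → z < q → ¬ q ∣ n) → ∀ m → occ m (tree z r n) ≤ 1
  tree-unique z zero n c m with Y ≤? n
  ... | no  _ = z≤n
  ... | yes _ with n <? Y⁸
  ...   | no  _ = z≤n
  ...   | yes _ with n ≟ m
  ...     | yes _ = ≤-refl
  ...     | no  _ = z≤n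
  tree-unique z (suc r) n c m with isPrime? (suc z)
  ... | no  _ = tree-unique (suc z) r n (λ q pr lt → c q pr (<-trans (n<1+n z) lt)) m
  ... | yes pr with suc z ≤? n
  ...   | no  _ = z≤n
  ...   | yes _ = ≤-trans (≤-reflexive (sumL-++ (λ x → equal? x m) (tree (suc z) r n) (tree (suc z) r (n * suc z)))) (cases (suc z ∣? m))
    where
    q : ℕ
    q = suc z
    cases : Dec (q ∣ m) → occ m (tree q r n) + occ m (tree q r (n * q)) ≤ 1
    cases (yes d) = ≤-trans (≤-reflexive (cong (_+ occ m (tree q r (n * q)))
        (occ-absent (All.map (λ ¬d e → ¬d (subst (q ∣_) (sym e) d)) (tree-coprime q r n q pr ≤-refl (c q pr (n<1+n z)))))))
      (tree-unique q r (n * q) (λ t prt lt → c t prt (<-trans (n<1+n z) lt) ∘ prime∤⇒ prt pr (λ e → <⇒≢ lt (sym e))) m)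
    cases (no ¬d) = ≤-trans (+-mono-≤ (tree-unique q r n (λ t prt lt → c t prt (<-trans (n<1+n z) lt)) m)
      (≤-reflexive (occ-absent (All.map (λ d e → ¬d (∣-trans (n∣m*n n) (subst (n * q ∣_) e d))) (tree-multiples q r (n * q))))))
      ≤-refl

  instance
    v≢0 : NonZero v
    v≢0 = >-nonZero (≤-trans (s≤s z≤n) 13≤v)
    s≢0 : NonZero s
    s≢0 = m*n≢0 28 v
    Y≢0 : NonZero Y
    Y≢0 = m^n≢0 2 s
    V≢0 : NonZero V
    V≢0 = m^n≢0 2 v

  few-divisors : ∀ n .{{_ : NonZero n}} → n ≤ X → Σₚ (above V (divides? n)) X ≤ 448
  few-divisors n n≤X = *-cancelʳ-≤ _ 448 v (2^-mono-inv (begin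
    2 ^ (c * v)  ≡⟨ cong (2 ^_) (*-comm c v) ⟩
    2 ^ (v * c)  ≡⟨ ^-*-assoc 2 v c ⟨
    V ^ c  ≤⟨ many-prime-divisors V {{m^n≢0 2 v}} X n ⟩
    n  ≤⟨ n≤X ⟩
    X  ≤⟨ <⇒≤ X< ⟩
    2 ^ (16 * s)  ≡⟨ cong (2 ^_) (lem v) ⟩
    2 ^ (448 * v)  ∎))
    where
    open ≤-Reasoning
    c : ℕ
    c = Σₚ (above V (divides? n)) X
    lem : ∀ v → 16 * (28 * v) ≡ 448 * v
    lem = solve-∀

  -- For each last prime q, the equation m q = n determines m.
  products : ∀ M n xs .{{_ : NonZero n}} → n ≤ X → (∀ k → 1 ≤ k → k ≤ X → occ k xs ≤ M) → ∀ b → b ≤ X →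
    sumL (λ m → Σₚ (above V (λ q → equal? (m * q) n)) b) xs ≤ divisorBound * M
  products M n xs n≤X bound b b≤X = begin
    sumL (λ m → Σₚ (above V (λ q → equal? (m * q) n)) b) xs  ≡⟨ sumL-Σₚ (λ m → above V (λ q → equal? (m * q) n)) b xs ⟩
    Σₚ (λ q → sumL (λ m → above V (λ q → equal? (m * q) n) q) xs) b  ≤⟨ Σₚ-mono b term ⟩
    Σₚ (λ q → M * above V (divides? n) q) b  ≡⟨ Σₚ-* M (above V (divides? n)) b ⟩
    M * Σₚ (above V (divides? n)) b  ≤⟨ *-monoʳ-≤ M (≤-trans (Σₚ-extend _ b≤X) (≤-trans (few-divisors n n≤X) 448≤divisorBound)) ⟩
    M * divisorBound  ≡⟨ *-comm M divisorBound ⟩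
    divisorBound * M  ∎
    where
    open ≤-Reasoning
    term : ∀ q → Prime q → q ≤ b → sumL (λ m → above V (λ q → equal? (m * q) n) q) xs ≤ M * above V (divides? n) q
    term q@(suc _) pr _ with V <? q
    ... | no  _ = ≤-trans (≤-reflexive (trans (sumL-const 0 xs) (*-zeroʳ (length xs)))) z≤n
    ... | yes _ with q ∣? n
    ...   | no ¬d = ≤-trans (sumL-mono xs none) (≤-trans (≤-reflexive (trans (sumL-const 0 xs) (*-zeroʳ (length xs)))) z≤n)
      where
      none : ∀ m → equal? (m * q) n ≤ 0
      none m with m * q ≟ n
      ... | yes e = contradiction (divides m (sym e)) ¬d
      ... | no  _ = z≤n
    ...   | yes d@(divides k e) = ≤-trans (sumL-mono xs match) (≤-trans (bound k 1≤k (≤-trans (∣⇒≤ (divides q (trans e (*-comm k q)))) n≤X)) (≤-reflexive (sym (*-identityʳ M))))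
      where
      1≤k : 1 ≤ k
      1≤k = >-nonZero⁻¹ k {{m*n≢0⇒m≢0 k {{subst NonZero e n≢0}}}}
        where
        n≢0 : NonZero n
        n≢0 = ≢-nonZero (≢-nonZero⁻¹ n)
      match : ∀ m → equal? (m * q) n ≤ equal? m k
      match m with m * q ≟ n | m ≟ k
      ... | no  _ | _     = z≤n
      ... | yes _ | yes _ = ≤-refl
      ... | yes f | no ¬f = contradiction (*-cancelʳ-≡ m k q (trans f e)) ¬f

  extend-occ : ∀ n m → occ n (extend m) ≤ equal? m n + Σₚ (above V (λ q → equal? (m * q) n)) Y
  extend-occ n m with Y⁸ ≤? m
  ... | yes _ = +-monoʳ-≤ (equal? m n) z≤n
  ... | no  _ = ≤-trans (≤-reflexive (sumL-concatMap (λ x → equal? x n) _ (primesBetween V Y)))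
      (≤-trans (sumL-mono (primesBetween V Y) one) (≤-trans (≤-reflexive (sumL-primesBetween (λ q → equal? (m * q) n) V Y)) (m≤n+m _ (equal? m n))))
    where
    one : ∀ q → occ n (byDec (q ∣? m) [] (m * q ∷ [])) ≤ equal? (m * q) n
    one q with q ∣? m
    ... | yes _ = z≤n
    ... | no  _ = ≤-reflexive (+-identityʳ _)

  Bounded : ℕ → List ℕ → Set
  Bounded M xs = ∀ n → 1 ≤ n → n ≤ X → occ n xs ≤ M

  extend-bounded : ∀ M xs → Bounded M xs → Bounded (suc divisorBound * M) (concatMap extend xs)
  extend-bounded M xs bd n@(suc _) 1≤n n≤X = begin
    occ n (concatMap extend xs)  ≡⟨ sumL-concatMap (λ x → equal? x n) extend xs ⟩
    sumL (λ m → occ n (extend m)) xs  ≤⟨ sumL-mono xs (extend-occ n) ⟩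
    sumL (λ m → equal? m n + Σₚ (above V (λ q → equal? (m * q) n)) Y) xs  ≡⟨ sumL-+ (λ m → equal? m n) _ xs ⟩
    occ n xs + sumL (λ m → Σₚ (above V (λ q → equal? (m * q) n)) Y) xs  ≤⟨ +-mono-≤ (bd n 1≤n n≤X) (products M n xs n≤X bd Y Y≤X) ⟩
    M + divisorBound * M  ≡⟨⟩
    suc divisorBound * M  ∎
    where open ≤-Reasoning

  extendⁿ-bounded : ∀ j M xs → Bounded M xs → Bounded (suc divisorBound ^ j * M) (extendⁿ j xs)
  extendⁿ-bounded zero    M xs bd n 1≤n n≤X = ≤-trans (bd n 1≤n n≤X) (≤-reflexive (sym (+-identityʳ M)))
  extendⁿ-bounded (suc j) M xs bd n 1≤n n≤X = ≤-trans (extendⁿ-bounded j (suc divisorBound * M) _ (extend-bounded M xs bd) n 1≤n n≤X)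
    (≤-reflexive (lem (suc divisorBound ^ j) M (suc divisorBound)))
    where
    lem : ∀ t M c → t * (c * M) ≡ c * t * M
    lem = solve-∀

  quo≤ : ∀ m → quo X m ≤ X
  quo≤ zero    = z≤n
  quo≤ (suc m) = m/n≤m X (suc m)

  complete-occ : ∀ n m → occ n (complete m) ≤ Σₚ (above V (λ q → equal? (m * q) n)) X
  complete-occ n m with Y⁸ ≤? m
  ... | no  _ = z≤n
  ... | yes _ = begin
    occ n (map (m *_) (primesBetween Y (quo X m)))  ≡⟨ sumL-map (λ x → equal? x n) (m *_) (primesBetween Y (quo X m)) ⟩
    sumL (λ q → equal? (m * q) n) (primesBetween Y (quo X m))  ≡⟨ sumL-primesBetween (λ q → equal? (m * q) n) Y (quo X m) ⟩
    Σₚ (above Y (λ q → equal? (m * q) n)) (quo X m)  ≤⟨ Σₚ-extend _ (quo≤ m) ⟩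
    Σₚ (above Y (λ q → equal? (m * q) n)) X  ≤⟨ Σₚ-mono X (λ q _ _ → more q) ⟩
    Σₚ (above V (λ q → equal? (m * q) n)) X  ∎
    where
    open ≤-Reasoning
    more : ∀ q → above Y (λ q → equal? (m * q) n) q ≤ above V (λ q → equal? (m * q) n) q
    more q with Y <? q | V <? q
    ... | no  _  | _     = z≤n
    ... | yes _  | yes _ = ≤-refl
    ... | yes lt | no ¬l = contradiction (≤-<-trans V≤Y lt) ¬l

  complete-bounded : ∀ M xs → Bounded M xs → Bounded (divisorBound * M) (concatMap complete xs)
  complete-bounded M xs bd n@(suc _) 1≤n n≤X = begin
    occ n (concatMap complete xs)  ≡⟨ sumL-concatMap (λ x → equal? x n) complete xs ⟩
    sumL (λ m → occ n (complete m)) xs  ≤⟨ sumL-mono xs (complete-occ n) ⟩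
    sumL (λ m → Σₚ (above V (λ q → equal? (m * q) n)) X) xs  ≤⟨ products M n xs n≤X bd X ≤-refl ⟩
    divisorBound * M  ∎
    where open ≤-Reasoning

  count : ℕ → ℕ → ℕ
  count zero    m = length (complete m)
  count (suc j) m = sumL (count j) (extend m)

  length-total : ∀ j xs → length (concatMap complete (extendⁿ j xs)) ≡ sumL (count j) xs
  length-total zero    xs = length-concatMap complete xs
  length-total (suc j) xs = trans (length-total j (concatMap extend xs)) (sumL-concatMap (count j) extend xs)

  32≤Y : 32 ≤ Y
  32≤Y = ^-monoʳ-≤ 2 {5} {s} (≤-trans (≤-trans (m≤n+m 5 8) 13≤v) (m≤n*m v 28))

  -- Z = X / m lies between Y³ and Y⁸, so Chebyshev's bound for N = ⌊Z/2⌋ gives at least N / (8 s)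
  -- primes. Discarding those up to Y costs at most half, and Z + 1 ≤ 4 N; together 8 · 2 · 4 = 64.
  complete-count : ∀ m → Y⁸ ≤ m → m < 2 ^ (9 * s) → X ≤ length (complete m) * m * (64 * s)
  complete-count zero      le lt = contradiction (>-nonZero⁻¹ Y⁸ {{m^n≢0 2 (8 * s)}}) (≤⇒≯ le)
  complete-count m@(suc _) le lt = begin
    X  ≤⟨ <⇒≤ X<m[Z+1] ⟩
    m * (Z + 1)  ≤⟨ *-monoʳ-≤ m Z+1≤ ⟩
    m * (64 * s * c)  ≡⟨ lem m s c ⟩
    c * m * (64 * s)  ≡⟨ cong (λ z → z * m * (64 * s)) (sym c≡) ⟩
    length (complete m) * m * (64 * s) ∎
    where
    open ≤-Reasoning
    Z c N : ℕ
    Z = X / m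
    c = Σₚ (above Y (λ _ → 1)) Z
    N = Z / 2
    lem : ∀ m s c → m * (64 * s * c) ≡ c * m * (64 * s)
    lem = solve-∀
    c≡ : length (complete m) ≡ c
    c≡ with Y⁸ ≤? m
    ... | no ¬le = contradiction le ¬le
    ... | yes _  = trans (length-map (m *_) (primesBetween Y Z)) (trans (sym (*-identityʳ _)) (trans (sym (sumL-const 1 (primesBetween Y Z))) (sumL-primesBetween (λ _ → 1) Y Z)))
    X<m[Z+1] : X < m * (Z + 1)
    X<m[Z+1] = begin-strict
      X  ≡⟨ m≡m%n+[m/n]*n X m ⟩
      X % m + Z * m  <⟨ +-monoˡ-< (Z * m) (m%n<n X m) ⟩
      m + Z * m  ≡⟨ lem₁ m Z ⟩
      m * (Z + 1)  ∎
      where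
      lem₁ : ∀ m z → m + z * m ≡ m * (z + 1)
      lem₁ = solve-∀
    Y³≤Z : Y * Y * Y ≤ Z
    Y³≤Z = ≤-pred (*-cancelˡ-< m (Y * Y * Y) (suc Z) (begin-strict
      m * (Y * Y * Y)  ≤⟨ *-monoˡ-≤ (Y * Y * Y) (<⇒≤ lt) ⟩
      2 ^ (9 * s) * (Y * Y * Y)  ≡⟨ cong (2 ^ (9 * s) *_) (trans (cong (_* Y) (sym (^-distribˡ-+-* 2 s s))) (sym (^-distribˡ-+-* 2 (s + s) s))) ⟩
      2 ^ (9 * s) * 2 ^ (s + s + s) ≡⟨ ^-distribˡ-+-* 2 (9 * s) (s + s + s) ⟨
      2 ^ (9 * s + (s + s + s))  ≡⟨ cong (2 ^_) (lem₂ s) ⟩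
      2 ^ (12 * s)  ≤⟨ ≤X ⟩
      X  <⟨ X<m[Z+1] ⟩
      m * (Z + 1)  ≡⟨ cong (m *_) (+-comm Z 1) ⟩
      m * suc Z  ∎))
      where
      lem₂ : ∀ s → 9 * s + (s + s + s) ≡ 12 * s
      lem₂ = solve-∀
    Z<Y⁸ : Z < 2 ^ (8 * s)
    Z<Y⁸ = m<n*o⇒m/o<n {X} {2 ^ (8 * s)} {m} (<-≤-trans X< (≤-trans (≤-reflexive (trans (cong (2 ^_) (lem₃ s)) (^-distribˡ-+-* 2 (8 * s) (8 * s)))) (*-monoʳ-≤ (2 ^ (8 * s)) le)))
      where
      lem₃ : ∀ s → 16 * s ≡ 8 * s + 8 * s
      lem₃ = solve-∀
    Z≤2N+1 : Z ≤ 2 * N + 1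
    Z≤2N+1 = begin
      Z  ≡⟨ m≡m%n+[m/n]*n Z 2 ⟩
      Z % 2 + N * 2  ≤⟨ +-monoˡ-≤ (N * 2) (≤-pred (m%n<n Z 2)) ⟩
      1 + N * 2  ≡⟨ lem₄ N ⟩
      2 * N + 1  ∎
      where
      lem₄ : ∀ N → 1 + N * 2 ≡ 2 * N + 1
      lem₄ = solve-∀
    -- The primes up to Y are negligible because Z ≥ Y³ and Y² ≥ 32 (s + 1), from Y ≥ 32 and Y = 2^s
    -- ≥ s + 1.
    16sY≤N : 16 * s * Y ≤ N
    16sY≤N = *-cancelˡ-≤ 2 (+-cancelʳ-≤ 1 _ _ (begin
      2 * (16 * s * Y) + 1  ≤⟨ +-monoʳ-≤ (2 * (16 * s * Y)) (*-mono-≤ {1} {32} {1} {Y} (s≤s z≤n) (>-nonZero⁻¹ Y)) ⟩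
      2 * (16 * s * Y) + 32 * Y  ≡⟨ lem₅ s Y ⟩
      32 * suc s * Y  ≤⟨ *-monoˡ-≤ Y (*-mono-≤ 32≤Y (n<2^n s)) ⟩
      Y * Y * Y  ≤⟨ Y³≤Z ⟩
      Z  ≤⟨ Z≤2N+1 ⟩
      2 * N + 1  ∎))
      where
      lem₅ : ∀ s Y → 2 * (16 * s * Y) + 32 * Y ≡ 32 * suc s * Y
      lem₅ = solve-∀
    1≤N : 1 ≤ N
    1≤N = ≤-trans (>-nonZero⁻¹ (16 * s * Y) {{m*n≢0 (16 * s) Y {{m*n≢0 16 s}}}}) 16sY≤N
    2N≤Z : 2 * N ≤ Z
    2N≤Z = ≤-trans (≤-reflexive (*-comm 2 N)) (m/n*n≤m Z 2)
    Y≤Z : Y ≤ Z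
    Y≤Z = ≤-trans (m≤n*m Y (Y * Y) {{m*n≢0 Y Y}}) Y³≤Z
    N≤ : N ≤ 8 * s * (c + Y)
    N≤ = begin
      N  ≤⟨ chebyshev N {{>-nonZero 1≤N}} ⟩
      suc (lg (2 * N)) * π (2 * N)  ≤⟨ *-mono-≤ (≤-trans (s≤s (lg-mono 2N≤Z)) (<2^⇒lg< {8 * s} {Z} {{>-nonZero (≤-trans 1≤N (≤-trans (m≤n*m N 2) 2N≤Z))}} Z<Y⁸)) (Σₚ-extend (λ _ → 1) 2N≤Z) ⟩
      8 * s * π Z  ≤⟨ *-monoʳ-≤ (8 * s) (≤-trans (Σₚ-split (λ _ → 1) Y Y≤Z) (+-monoʳ-≤ c (≤-trans (Σₚ-const 1 Y (λ _ _ _ → ≤-refl)) (≤-reflexive (*-identityʳ Y))))) ⟩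
      8 * s * (c + Y)  ∎
    N≤16sc : N ≤ 16 * s * c
    N≤16sc = +-cancelʳ-≤ N _ _ (begin
      N + N  ≤⟨ +-mono-≤ N≤ N≤ ⟩
      8 * s * (c + Y) + 8 * s * (c + Y) ≡⟨ lem₆ s c Y ⟩
      16 * s * c + 16 * s * Y  ≤⟨ +-monoʳ-≤ (16 * s * c) 16sY≤N ⟩
      16 * s * c + N  ∎)
      where
      lem₆ : ∀ s c Y → 8 * s * (c + Y) + 8 * s * (c + Y) ≡ 16 * s * c + 16 * s * Y
      lem₆ = solve-∀
    Z+1≤ : Z + 1 ≤ 64 * s * c
    Z+1≤ = begin
      Z + 1  ≤⟨ +-monoˡ-≤ 1 Z≤2N+1 ⟩
      2 * N + 1 + 1  ≡⟨ lem₇ N ⟩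
      2 * (N + 1)  ≤⟨ *-monoʳ-≤ 2 (+-monoʳ-≤ N 1≤N) ⟩
      2 * (N + N)  ≤⟨ *-monoʳ-≤ 2 (+-mono-≤ N≤16sc N≤16sc) ⟩
      2 * (16 * s * c + 16 * s * c) ≡⟨ lem₈ s c ⟩
      64 * s * c  ∎
      where
      lem₇ : ∀ N → 2 * N + 1 + 1 ≡ 2 * (N + 1)
      lem₇ = solve-∀
      lem₈ : ∀ s c → 2 * (16 * s * c + 16 * s * c) ≡ 64 * s * c
      lem₈ = solve-∀

  -- Expected numbers of descendants

  module WithScale (D : ℕ) .{{D≢0 : NonZero D}} (ρ : ℕ → ℕ) (ρ-spec : ∀ k → 1 ≤ k → k ≤ Y + 1 → k * ρ k ≡ D) where
    open Scaled (Y + 1) D ρ ρ-spec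
    open Scaled′ (Y + 1) D ρ ρ-spec
    open Precision Y
    open Precision′ Y

    Y≤Y+1 : Y ≤ Y + 1
    Y≤Y+1 = m≤m+n Y 1

    fresh : ℕ → ℕ → ℕ
    fresh m = above V (λ q → byDec (q ∣? m) 0 (ρ q))

    -- The reciprocals of all primes in (V, Y] sum to at least 1/8. At most 448 of these primes
    -- divide m, each with reciprocal at most 1 / V, and V ≥ 2^13 ≥ 16 · 448 bounds their share by
    -- half. This is the origin of 13 ≤ v.
    fresh-primes : ∀ m .{{_ : NonZero m}} → m ≤ X → D ≤ 16 * Σₚ (fresh m) Y
    fresh-primes m m≤X = +-cancelʳ-≤ D _ _ (begin
      D + D  ≡⟨ cong (D +_) (+-identityʳ D) ⟨
      2 * D  ≤⟨ *-monoʳ-≤ 2 (primes-between v Y≤Y+1) ⟩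
      2 * (8 * Σₚ (above V ρ) Y)  ≤⟨ *-monoʳ-≤ 2 (*-monoʳ-≤ 8 (Σₚ-mono Y term)) ⟩
      2 * (8 * Σₚ (λ q → fresh m q + ρ V * above V (divides? m) q) Y)
        ≡⟨ cong (λ z → 2 * (8 * z)) (trans (Σₚ-+ (fresh m) _ Y) (cong (Σₚ (fresh m) Y +_) (Σₚ-* (ρ V) (above V (divides? m)) Y))) ⟩
      2 * (8 * (Σₚ (fresh m) Y + ρ V * Σₚ (above V (divides? m)) Y))
        ≤⟨ *-monoʳ-≤ 2 (*-monoʳ-≤ 8 (+-monoʳ-≤ (Σₚ (fresh m) Y) (*-monoʳ-≤ (ρ V) (≤-trans (Σₚ-extend _ Y≤X) (few-divisors m m≤X))))) ⟩
      2 * (8 * (Σₚ (fresh m) Y + ρ V * 448))  ≡⟨ lem (Σₚ (fresh m) Y) (ρ V) ⟩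
      16 * Σₚ (fresh m) Y + 7168 * ρ V  ≤⟨ +-monoʳ-≤ (16 * Σₚ (fresh m) Y) (≤-trans (*-monoˡ-≤ (ρ V) 7168≤V) (≤-reflexive (ρ-spec V (>-nonZero⁻¹ V) (≤-trans V≤Y Y≤Y+1)))) ⟩
      16 * Σₚ (fresh m) Y + D  ∎)
      where
      open ≤-Reasoning
      lem : ∀ a r → 2 * (8 * (a + r * 448)) ≡ 16 * a + 7168 * r
      lem = solve-∀
      7168≤V : 7168 ≤ V
      7168≤V = ≤-trans (m≤m+n 7168 1024) (^-monoʳ-≤ 2 13≤v)
      term : ∀ q → Prime q → q ≤ Y → above V ρ q ≤ fresh m q + ρ V * above V (divides? m) q
      term q pr q≤Y with V <? q
      ... | no  _ = z≤n
      ... | yes V<q with q ∣? m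
      ...   | no  _ = m≤m+n (ρ q) _
      ...   | yes _ = ≤-trans (ρ-anti (>-nonZero⁻¹ V) (<⇒≤ V<q) (≤-trans q≤Y Y≤Y+1)) (≤-reflexive (sym (*-identityʳ (ρ V))))

    -- A child m q has at least its share X / (m q) of descendants, up to the constant, so summing
    -- over the new primes multiplies the share of m by at least 1/16 in each round. The condition
    -- Y⁸ ≤ m V^j says that the remaining rounds suffice.
    extend-count : ∀ j m → Y ≤ m → m < 2 ^ (9 * s) → Y⁸ ≤ m * V ^ j → X ≤ count j m * m * (64 * s * 16 ^ j)
    extend-count zero    m Y≤m m< reach = ≤-trans (complete-count m (≤-trans reach (≤-reflexive (*-identityʳ m))) m<)
      (≤-reflexive (cong (length (complete m) * m *_) (sym (*-identityʳ (64 * s)))))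
    extend-count (suc j) m Y≤m m< reach with Y⁸ ≤? m
    ... | yes le = ≤-trans (extend-count j m Y≤m m< (≤-trans le (m≤m*n m (V ^ j) {{m^n≢0 V j}})))
            (≤-trans (*-monoʳ-≤ (count j m * m) (*-monoʳ-≤ (64 * s) (^-monoʳ-≤ 16 (n≤1+n j)))) (≤-reflexive (cong (λ z → z * m * (64 * s * 16 ^ suc j)) (sym (+-identityʳ (count j m))))))
    ... | no ¬le = *-cancelʳ-≤ X _ D (begin
      X * D  ≤⟨ *-monoʳ-≤ X (fresh-primes m {{m≢0}} m≤X) ⟩
      X * (16 * Σₚ (fresh m) Y)  ≡⟨ lem₁ X (Σₚ (fresh m) Y) ⟩
      16 * (X * Σₚ (fresh m) Y)  ≡⟨ cong (16 *_) (Σₚ-* X (fresh m) Y) ⟨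
      16 * Σₚ (λ q → X * fresh m q) Y  ≤⟨ *-monoʳ-≤ 16 (Σₚ-mono Y term) ⟩
      16 * Σₚ (λ q → κ * above V g q) Y  ≡⟨ cong (16 *_) (Σₚ-* κ (above V g) Y) ⟩
      16 * (κ * Σₚ (above V g) Y)  ≡⟨ cong (λ z → 16 * (κ * z)) (sym total) ⟩
      16 * (κ * T)  ≡⟨ lem₂ m (64 * s) (16 ^ j) D T ⟩
      T * m * (64 * s * (16 * 16 ^ j)) * D  ∎)
      where
      open ≤-Reasoning
      m<Y⁸ : m < Y⁸
      m<Y⁸ = ≰⇒> ¬le
      m≢0 : NonZero m
      m≢0 = >-nonZero (≤-trans (>-nonZero⁻¹ Y) Y≤m)
      m≤X : m ≤ X
      m≤X = ≤-trans (<⇒≤ m<) (≤-trans (^-monoʳ-≤ 2 (*-monoˡ-≤ s (m≤m+n 9 3))) ≤X)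
      κ T : ℕ
      κ = m * (64 * s * 16 ^ j) * D
      T = sumL (count j) (concatMap (λ q → byDec (q ∣? m) [] (m * q ∷ [])) (primesBetween V Y))
      g : ℕ → ℕ
      g q = byDec (q ∣? m) 0 (count j (m * q))
      lem₁ : ∀ X a → X * (16 * a) ≡ 16 * (X * a)
      lem₁ = solve-∀
      lem₂ : ∀ m c t D T → 16 * (m * (c * t) * D * T) ≡ T * m * (c * (16 * t)) * D
      lem₂ = solve-∀
      total : T ≡ Σₚ (above V g) Y
      total = trans (sumL-concatMap (count j) _ (primesBetween V Y)) (trans (≤-antisym (sumL-mono (primesBetween V Y) (≤-reflexive ∘ single)) (sumL-mono (primesBetween V Y) (≤-reflexive ∘ sym ∘ single))) (sumL-primesBetween g V Y))
        where
        single : ∀ q → sumL (count j) (byDec (q ∣? m) [] (m * q ∷ [])) ≡ g q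
        single q with q ∣? m
        ... | yes _ = refl
        ... | no  _ = +-identityʳ _
      term : ∀ q → Prime q → q ≤ Y → X * fresh m q ≤ κ * above V g q
      term q pr q≤Y with V <? q
      ... | no  _ = ≤-trans (≤-reflexive (*-zeroʳ X)) z≤n
      ... | yes V<q with q ∣? m
      ...   | yes _ = ≤-trans (≤-reflexive (*-zeroʳ X)) z≤n
      ...   | no  _ = begin
        X * ρ q  ≤⟨ *-monoˡ-≤ (ρ q) (extend-count j (m * q) (≤-trans Y≤m (m≤m*n m q {{prime⇒nonZero pr}})) mq< reach′) ⟩
        count j (m * q) * (m * q) * (64 * s * 16 ^ j) * ρ q  ≡⟨ lem₃ (count j (m * q)) m q (64 * s * 16 ^ j) (ρ q) ⟩
        m * (64 * s * 16 ^ j) * (q * ρ q) * count j (m * q)  ≡⟨ cong (λ z → m * (64 * s * 16 ^ j) * z * count j (m * q)) (ρ-spec q (<⇒≤ (prime>1 pr)) (≤-trans q≤Y Y≤Y+1)) ⟩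
        κ * count j (m * q)  ∎
        where
        lem₃ : ∀ c m q t r → c * (m * q) * t * r ≡ m * t * (q * r) * c
        lem₃ = solve-∀
        mq< : m * q < 2 ^ (9 * s)
        mq< = begin-strict
          m * q  ≤⟨ *-monoʳ-≤ m q≤Y ⟩
          m * Y  <⟨ *-monoˡ-< Y m<Y⁸ ⟩
          Y⁸ * Y  ≡⟨ ^-distribˡ-+-* 2 (8 * s) s ⟨
          2 ^ (8 * s + s)  ≡⟨ cong (2 ^_) (lem₄ s) ⟩
          2 ^ (9 * s)  ∎
          where
          lem₄ : ∀ s → 8 * s + s ≡ 9 * s
          lem₄ = solve-∀
        reach′ : Y⁸ ≤ m * q * V ^ j
        reach′ = begin
          Y⁸  ≤⟨ reach ⟩
          m * (V * V ^ j)  ≤⟨ *-monoʳ-≤ m (*-monoˡ-≤ (V ^ j) (<⇒≤ V<q)) ⟩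
          m * (q * V ^ j)  ≡⟨ *-assoc m q (V ^ j) ⟨
          m * q * V ^ j  ∎

    module TreeBound (j : ℕ) (196≤j : 196 ≤ j) (P₀ : ℕ) where

      T : ℕ → ℕ → ℕ → ℕ
      T z r n = sumL (count j) (tree z r n)

      κ : ℕ
      κ = 64 * s * 16 ^ j

      leaf : ∀ m → Y ≤ m → m < Y⁸ → X ≤ count j m * m * κ
      leaf m Y≤m m< = extend-count j m Y≤m (<-≤-trans m< (^-monoʳ-≤ 2 (*-monoˡ-≤ s (n≤1+n 8)))) (begin
        2 ^ (8 * (28 * v))  ≡⟨ cong (2 ^_) (lem v) ⟩
        2 ^ (28 * v + v * 196) ≡⟨ ^-distribˡ-+-* 2 (28 * v) (v * 196) ⟩
        Y * 2 ^ (v * 196)  ≡⟨ cong (Y *_) (^-*-assoc 2 v 196) ⟨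
        Y * V ^ 196  ≤⟨ *-mono-≤ Y≤m (^-monoʳ-≤ V 196≤j) ⟩
        m * V ^ j  ∎)
        where
        open ≤-Reasoning
        lem : ∀ v → 8 * (28 * v) ≡ 28 * v + v * 196
        lem = solve-∀

      -- The mean growth of the exponent u in n ≤ 2^u when q is taken with probability 1 / (q + 1);
      -- `lg q + 1` bounds log q from above.
      cost : ℕ → ℕ
      cost q = (lg q + 1) * ρ (q + 1)

      ρ+1 : ∀ {q} → 1 ≤ q → q ≤ Y → (q + 1) * ρ (q + 1) ≡ D
      ρ+1 {q} 1≤q q≤Y = ρ-spec (q + 1) (≤-trans 1≤q (m≤m+n q 1)) (+-monoˡ-≤ 1 q≤Y)

      -- Above Y no branch dies; this is Markov's inequality for the cofactor still to be chosen.
      free : ∀ z r n u → z + r ≡ Y → Y ≤ n → n ≤ 2 ^ u →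
        Πᵣ suc z r * X * (8 * s * D) ≤ T z r n * n * (κ * (8 * s * D)) * Πᵣ id z r + Πᵣ suc z r * X * (u * D + Σᵣ cost z r)
      free z zero n u e Y≤n n≤ with Y ≤? n
      ... | no ¬le = contradiction Y≤n ¬le
      ... | yes _ with n <? Y⁸
      ...   | yes lt = begin
        1 * X * J  ≡⟨ cong (_* J) (*-identityˡ X) ⟩
        X * J  ≤⟨ *-monoˡ-≤ J (leaf n Y≤n lt) ⟩
        count j n * n * κ * J  ≡⟨ lem (count j n) n κ J ⟩
        (count j n + 0) * n * (κ * J) * 1  ≤⟨ m≤m+n _ _ ⟩
        (count j n + 0) * n * (κ * J) * 1 + 1 * X * (u * D + 0) ∎
        where
        open ≤-Reasoning
        J : ℕ
        J = 8 * s * D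
        lem : ∀ c n k J → c * n * k * J ≡ (c + 0) * n * (k * J) * 1
        lem = solve-∀
      -- A discarded leaf contributes nothing to `T`, but n ≥ Y⁸ forces u ≥ 8 s, and the last
      -- summand alone is large enough.
      ...   | no ¬lt = ≤-trans (*-monoʳ-≤ (1 * X) (≤-trans (*-monoˡ-≤ D {8 * s} {u} (2^-mono-inv {8 * s} {u} (≤-trans (≮⇒≥ ¬lt) n≤))) (m≤m+n (u * D) 0))) (m≤n+m _ _)
      free z (suc r) n u e Y≤n n≤ with isPrime? (suc z)
      ... | no  _ = subst₂ _≤_ (one (Πᵣ suc (suc z) r) X (8 * s * D))
          (two (T (suc z) r n * n * (κ * (8 * s * D))) (Πᵣ id (suc z) r) (Πᵣ suc (suc z) r) X (u * D + Σᵣ cost (suc z) r))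
          (free (suc z) r n u (trans (sym (+-suc z r)) e) Y≤n n≤)
        where
        one : ∀ a b c → a * b * c ≡ 1 * a * b * c
        one = solve-∀
        two : ∀ t p a b c → t * p + a * b * c ≡ t * (1 * p) + 1 * a * b * c
        two = solve-∀
      ... | yes pr with suc z ≤? n
      ...   | no ¬le = contradiction (≤-trans q≤Y Y≤n) ¬le
        where
        q≤Y : suc z ≤ Y
        q≤Y = ≤-trans (s≤s (m≤m+n z r)) (≤-reflexive (trans (sym (+-suc z r)) e))
      ...   | yes _ = begin
        -- The factor q + 1 splits into weight q for omitting the prime and weight 1 for taking it.
        suc q * P⁺ * X * J  ≡⟨ lem₁ q P⁺ X J ⟩
        q * (P⁺ * X * J) + P⁺ * X * J  ≤⟨ +-mono-≤ (*-monoʳ-≤ q (free q r n u e′ Y≤n n≤)) (free q r (n * q) (u + (lg q + 1)) e′ (≤-trans Y≤n (m≤m*n n q)) nq≤) ⟩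
        q * (T₁ * n * (κ * J) * P + P⁺ * X * (u * D + S)) + (T₂ * (n * q) * (κ * J) * P + P⁺ * X * ((u + (lg q + 1)) * D + S))
          ≡⟨ cong (λ z → q * (T₁ * n * (κ * J) * P + P⁺ * X * (u * D + S)) + (T₂ * (n * q) * (κ * J) * P + P⁺ * X * (z + S))) (trans (*-distribʳ-+ D u (lg q + 1)) (cong (λ z → u * D + (lg q + 1) * z) (sym (ρ+1 {q} (s≤s z≤n) q≤Y)))) ⟩
        q * (T₁ * n * (κ * J) * P + P⁺ * X * (u * D + S)) + (T₂ * (n * q) * (κ * J) * P + P⁺ * X * (u * D + (lg q + 1) * ((q + 1) * ρ (q + 1)) + S))
          ≡⟨ lem₂ q T₁ T₂ n (κ * J) P P⁺ X (u * D) S (lg q + 1) (ρ (q + 1)) ⟩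
        (T₁ + T₂) * n * (κ * J) * (q * P) + suc q * P⁺ * X * (u * D + (cost q + S))
          ≡⟨ cong (λ z → z * n * (κ * J) * (q * P) + suc q * P⁺ * X * (u * D + (cost q + S))) (sumL-++ (count j) (tree q r n) (tree q r (n * q))) ⟨
        sumL (count j) (tree q r n ++ tree q r (n * q)) * n * (κ * J) * (q * P) + suc q * P⁺ * X * (u * D + (cost q + S)) ∎
        where
        open ≤-Reasoning
        q J P P⁺ S T₁ T₂ : ℕ
        q  = suc z
        J  = 8 * s * D
        P  = Πᵣ id q r
        P⁺ = Πᵣ suc q r
        S  = Σᵣ cost q r
        T₁ = T q r n
        T₂ = T q r (n * q)
        e′ : q + r ≡ Y
        e′ = trans (sym (+-suc z r)) e
        q≤Y : q ≤ Y
        q≤Y = ≤-trans (m≤m+n q r) (≤-reflexive e′)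
        nq≤ : n * q ≤ 2 ^ (u + (lg q + 1))
        nq≤ = ≤-trans (*-mono-≤ n≤ (<⇒≤ (lg-upper q))) (≤-reflexive (trans (sym (^-distribˡ-+-* 2 u (suc (lg q)))) (cong (λ z → 2 ^ (u + z)) (+-comm 1 (lg q)))))
        lem₁ : ∀ q a X J → suc q * a * X * J ≡ q * (a * X * J) + a * X * J
        lem₁ = solve-∀
        lem₂ : ∀ q t₁ t₂ n k p a X u S b r →
          q * (t₁ * n * k * p + a * X * (u + S)) + (t₂ * (n * q) * k * p + a * X * (u + b * ((q + 1) * r) + S))
            ≡ (t₁ + t₂) * n * k * (q * p) + suc q * a * X * (u + (b * r + S))
        lem₂ = solve-∀

      Σᵣ-cost : ∀ z r → z + r ≡ Y → Σᵣ cost z r ≤ 4 * (s * D)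
      Σᵣ-cost z r e = begin
        Σᵣ cost z r  ≤⟨ m≤n+m _ (Σₚ cost z) ⟩
        Σₚ cost z + Σᵣ cost z r  ≡⟨ trans (Σₚ-Σᵣ cost z r) (cong (Σₚ cost) e) ⟩
        Σₚ cost Y  ≤⟨ Σₚ-mono Y term ⟩
        Σₚ (λ q → 2 * (lg q * ρ q)) Y  ≡⟨ Σₚ-* 2 (λ q → lg q * ρ q) Y ⟩
        2 * Σₚ (λ q → lg q * ρ q) Y  ≤⟨ *-monoʳ-≤ 2 (mertens-upper s Y≤Y+1) ⟩
        2 * (2 * (s * D))  ≡⟨ *-assoc 2 2 (s * D) ⟨
        4 * (s * D)  ∎
        where
        open ≤-Reasoning
        term : ∀ q → Prime q → q ≤ Y → cost q ≤ 2 * (lg q * ρ q)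
        term q pr q≤Y = ≤-trans (*-mono-≤ (+-monoʳ-≤ (lg q) (2^≤⇒≤lg (prime>1 pr))) (ρ-anti (<⇒≤ (prime>1 pr)) (m≤m+n q 1) (+-monoˡ-≤ 1 q≤Y)))
          (≤-reflexive (lem (lg q) (ρ q)))
          where
          lem : ∀ b r → (b + b) * r ≡ 2 * (b * r)
          lem = solve-∀

      drift : ℕ → ℕ
      drift q = ℓ q * ρ (q + 1)

      -- The sum of the mean increments `drift` over the primes actually offered, those above P₀.
      -- The initial value consists of the 9 units lost in `mertens-lower` and at most one unit for
      -- each number up to P₀, in place of the primes left out.
      compensator : ℕ → ℕ
      compensator z = (9 + P₀) * (Y * D) + Σₚ (above P₀ drift) z

      -- A branch dies only once its compensated logarithm is no longer positive.
      death : ∀ N .{{_ : NonZero N}} → P₀ ≤ N → N ≤ Y → D * ℓ N ≤ compensator N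
      death N P₀≤N N≤Y = begin
        D * ℓ N  ≤⟨ mertens-lower N (+-monoˡ-≤ 1 N≤Y) N≤Y ⟩
        9 * (Y * D) + Σₚ drift N  ≤⟨ +-monoʳ-≤ (9 * (Y * D)) (Σₚ-split drift P₀ P₀≤N) ⟩
        9 * (Y * D) + (Σₚ (above P₀ drift) N + Σₚ drift P₀)  ≤⟨ +-monoʳ-≤ (9 * (Y * D)) (+-monoʳ-≤ (Σₚ (above P₀ drift) N) (Σₚ-const (Y * D) P₀ small)) ⟩
        9 * (Y * D) + (Σₚ (above P₀ drift) N + P₀ * (Y * D))  ≡⟨ lem (Y * D) (Σₚ (above P₀ drift) N) P₀ ⟩
        (9 + P₀) * (Y * D) + Σₚ (above P₀ drift) N  ∎
        where
        open ≤-Reasoning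
        lem : ∀ a b p → 9 * a + (b + p * a) ≡ (9 + p) * a + b
        lem = solve-∀
        small : ∀ q → Prime q → q ≤ P₀ → drift q ≤ Y * D
        small q pr q≤ = begin
          ℓ q * ρ (q + 1)  ≤⟨ *-monoˡ-≤ (ρ (q + 1)) (ℓ≤ q {{prime⇒nonZero pr}}) ⟩
          suc (lg q) * Y * ρ (q + 1)  ≤⟨ *-monoˡ-≤ (ρ (q + 1)) (*-monoˡ-≤ Y (≤-trans (s≤s (lg≤ q)) (≤-reflexive (+-comm 1 q)))) ⟩
          (q + 1) * Y * ρ (q + 1)  ≡⟨ lem₂ (q + 1) Y (ρ (q + 1)) ⟩
          Y * ((q + 1) * ρ (q + 1))  ≡⟨ cong (Y *_) (ρ+1 (<⇒≤ (prime>1 pr)) (≤-trans q≤ (≤-trans P₀≤N N≤Y))) ⟩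
          Y * D  ∎
          where
          lem₂ : ∀ a b c → a * b * c ≡ b * (a * c)
          lem₂ = solve-∀

      compensator-suc-prime : ∀ z → Prime (suc z) → P₀ ≤ z → compensator (suc z) ≡ compensator z + drift (suc z)
      compensator-suc-prime z pr P₀≤z with isPrime? (suc z)
      ... | no ¬pr = contradiction pr ¬pr
      ... | yes _ with P₀ <? suc z
      ...   | no ¬lt = contradiction (s≤s P₀≤z) ¬lt
      ...   | yes _  = sym (+-assoc ((9 + P₀) * (Y * D)) _ _)

      compensator-suc-composite : ∀ z → ¬ Prime (suc z) → compensator (suc z) ≡ compensator z
      compensator-suc-composite z ¬pr with isPrime? (suc z)
      ... | yes pr = contradiction pr ¬pr
      ... | no _   = cong ((9 + P₀) * (Y * D) +_) (+-identityʳ _)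

      dead : ∀ {l n} N A t .{{_ : NonZero N}} → l ≤ ℓ n → n ≤ N → P₀ ≤ N → N ≤ Y → A * (l * D) ≤ t + A * compensator N
      dead {l} {n} N A t l≤ n≤N P₀≤N N≤Y = ≤-trans (*-monoʳ-≤ A (begin
        l * D  ≤⟨ *-monoˡ-≤ D (≤-trans l≤ (ℓ-mono n≤N)) ⟩
        ℓ N * D  ≡⟨ *-comm (ℓ N) D ⟩
        D * ℓ N  ≤⟨ death N P₀≤N N≤Y ⟩
        compensator N  ∎)) (m≤n+m _ t)
        where open ≤-Reasoning

      κ′ : ℕ
      κ′ = Y * (κ * (8 * s * D))

      -- A product that first reaches Y by taking a prime is at most Y², so the mean of its final
      -- logarithm is at most 2 s + 4 s. Markov's inequality at 8 s, the reason for the bound Y⁸,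
      -- leaves 2 s, and this outweighs `l` because `ℓ n` is at most 2 s Y.
      hit : ∀ z r n l → z + r ≡ Y → Y ≤ n → n ≤ 2 ^ (2 * s) → l ≤ ℓ n → Πᵣ suc z r * X * (l * D) ≤ T z r n * n * κ′ * Πᵣ id z r
      hit z r n l e Y≤n n≤ l≤ = begin
        P⁺ * X * (l * D)  ≤⟨ *-monoʳ-≤ (P⁺ * X) (*-monoˡ-≤ D (≤-trans l≤ (ℓ-upper {n} {2 * s} {{>-nonZero (≤-trans (>-nonZero⁻¹ Y) Y≤n)}} n≤))) ⟩
        P⁺ * X * (2 * s * Y * D)  ≡⟨ lem₁ P⁺ X s Y D ⟩
        Y * (P⁺ * X * (2 * (s * D)))  ≤⟨ *-monoʳ-≤ Y reserve ⟩
        Y * (T z r n * n * (κ * (8 * s * D)) * P) ≡⟨ lem₂ Y (T z r n) n (κ * (8 * s * D)) P ⟩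
        T z r n * n * (Y * (κ * (8 * s * D))) * P ∎
        where
        open ≤-Reasoning
        P P⁺ : ℕ
        P  = Πᵣ id z r
        P⁺ = Πᵣ suc z r
        lem₁ : ∀ a X s Y D → a * X * (2 * s * Y * D) ≡ Y * (a * X * (2 * (s * D)))
        lem₁ = solve-∀
        lem₂ : ∀ Y t n k p → Y * (t * n * k * p) ≡ t * n * (Y * k) * p
        lem₂ = solve-∀
        reserve : P⁺ * X * (2 * (s * D)) ≤ T z r n * n * (κ * (8 * s * D)) * P
        reserve = +-cancelʳ-≤ (P⁺ * X * (6 * (s * D))) _ _ (begin
          P⁺ * X * (2 * (s * D)) + P⁺ * X * (6 * (s * D))  ≡⟨ lem₃ P⁺ X s D ⟩
          P⁺ * X * (8 * s * D)  ≤⟨ free z r n (2 * s) e Y≤n n≤ ⟩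
          T z r n * n * (κ * (8 * s * D)) * P + P⁺ * X * (2 * s * D + Σᵣ cost z r)
            ≤⟨ +-monoʳ-≤ (T z r n * n * (κ * (8 * s * D)) * P) (*-monoʳ-≤ (P⁺ * X) (≤-trans (+-monoʳ-≤ (2 * s * D) (Σᵣ-cost z r e)) (≤-reflexive (lem₄ s D)))) ⟩
          T z r n * n * (κ * (8 * s * D)) * P + P⁺ * X * (6 * (s * D)) ∎)
          where
          lem₃ : ∀ a X s D → a * X * (2 * (s * D)) + a * X * (6 * (s * D)) ≡ a * X * (8 * s * D)
          lem₃ = solve-∀
          lem₄ : ∀ s D → 2 * s * D + 4 * (s * D) ≡ 6 * (s * D)
          lem₄ = solve-∀

      -- l - compensator is a martingale: the drift of compensator is the mean of the next increment of l.
      alive : ∀ z r n l .{{_ : NonZero z}} .{{_ : NonZero n}} → P₀ ≤ z → z + r ≡ Y → n ≤ 2 ^ (2 * s) → l ≤ ℓ n →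
        Πᵣ suc z r * X * (l * D) ≤ T z r n * n * κ′ * Πᵣ id z r + Πᵣ suc z r * X * compensator z
      alive z r n l P₀≤z e n≤ l≤ with Y ≤? n
      ... | yes Y≤n = ≤-trans (hit z r n l e Y≤n n≤ l≤) (m≤m+n _ _)
      -- When the primes run out below Y, the branch counts as dead, with N = Y in `death`.
      alive z zero n l P₀≤z e n≤ l≤ | no Y≰n =
        dead z (1 * X) (T z 0 n * n * κ′ * 1) l≤ (≤-trans (<⇒≤ (≰⇒> Y≰n)) (≤-reflexive (sym z≡Y))) P₀≤z (≤-reflexive z≡Y)
        where
        z≡Y : z ≡ Y
        z≡Y = trans (sym (+-identityʳ z)) e
      alive z (suc r) n l P₀≤z e n≤ l≤ | no Y≰n with isPrime? (suc z)
      ... | no ¬pr = subst₂ _≤_ (one (Πᵣ suc (suc z) r) X (l * D))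
          (trans (cong (λ c → T (suc z) r n * n * κ′ * Πᵣ id (suc z) r + Πᵣ suc (suc z) r * X * c) (compensator-suc-composite z ¬pr))
            (two (T (suc z) r n * n * κ′) (Πᵣ id (suc z) r) (Πᵣ suc (suc z) r) X (compensator z)))
          (alive (suc z) r n l (m≤n⇒m≤1+n P₀≤z) (trans (sym (+-suc z r)) e) n≤ l≤)
        where
        one : ∀ a b c → a * b * c ≡ 1 * a * b * c
        one = solve-∀
        two : ∀ t p a b c → t * p + a * b * c ≡ t * (1 * p) + 1 * a * b * c
        two = solve-∀
      ... | yes pr with suc z ≤? n
      -- The next prime exceeds n, so n ≤ z and the compensator at z already covers the logarithm.
      ...   | no q≰n = dead z (suc (suc z) * Πᵣ suc (suc z) r * X) _ l≤ (≤-pred (≰⇒> q≰n)) P₀≤z (≤-trans (m≤m+n z (suc r)) (≤-reflexive e))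
      -- The mean increment of the logarithm, with denominators cleared, is added to both sides. On
      -- the left it arises from taking q with weight 1, on the right from the growth of the
      -- compensator with weight q + 1.
      ...   | yes q≤n = +-cancelʳ-≤ (P⁺ * X * (ℓ q * D)) _ _ (begin
        suc q * P⁺ * X * (l * D) + P⁺ * X * (ℓ q * D)  ≡⟨ lem₁ q P⁺ X l (ℓ q) D ⟩
        q * (P⁺ * X * (l * D)) + P⁺ * X * ((l + ℓ q) * D)  ≤⟨ +-mono-≤ (*-monoʳ-≤ q (alive q r n l P₀≤q e′ n≤ l≤))
                                                                            (alive q r (n * q) (l + ℓ q) {{nonZero}} {{m*n≢0 n q}} P₀≤q e′ nq≤ (≤-trans (+-monoˡ-≤ (ℓ q) l≤) (ℓ-superadditive n q))) ⟩
        q * (T₁ * n * κ′ * P + P⁺ * X * compensator q) + (T₂ * (n * q) * κ′ * P + P⁺ * X * compensator q)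
          ≡⟨ cong (λ c → q * (T₁ * n * κ′ * P + P⁺ * X * c) + (T₂ * (n * q) * κ′ * P + P⁺ * X * c)) (compensator-suc-prime z pr P₀≤z) ⟩
        q * (T₁ * n * κ′ * P + P⁺ * X * (C + ℓ q * ρ (q + 1))) + (T₂ * (n * q) * κ′ * P + P⁺ * X * (C + ℓ q * ρ (q + 1)))
          ≡⟨ lem₂ q T₁ T₂ n κ′ P P⁺ X C (ℓ q) (ρ (q + 1)) ⟩
        (T₁ + T₂) * n * κ′ * (q * P) + suc q * P⁺ * X * C + P⁺ * X * (ℓ q * ((q + 1) * ρ (q + 1)))
          ≡⟨ cong₂ (λ t d → t * n * κ′ * (q * P) + suc q * P⁺ * X * C + P⁺ * X * (ℓ q * d)) (sym (sumL-++ (count j) (tree q r n) (tree q r (n * q)))) (ρ+1 {q} (s≤s z≤n) q≤Y) ⟩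
        sumL (count j) (tree q r n ++ tree q r (n * q)) * n * κ′ * (q * P) + suc q * P⁺ * X * C + P⁺ * X * (ℓ q * D) ∎)
        where
        open ≤-Reasoning
        q P P⁺ C T₁ T₂ : ℕ
        q  = suc z
        P  = Πᵣ id q r
        P⁺ = Πᵣ suc q r
        C  = compensator z
        T₁ = T q r n
        T₂ = T q r (n * q)
        P₀≤q : P₀ ≤ q
        P₀≤q = m≤n⇒m≤1+n P₀≤z
        e′ : q + r ≡ Y
        e′ = trans (sym (+-suc z r)) e
        q≤Y : q ≤ Y
        q≤Y = ≤-trans (m≤m+n q r) (≤-reflexive e′)
        nq≤ : n * q ≤ 2 ^ (2 * s)
        nq≤ = ≤-trans (*-mono-≤ (<⇒≤ (≰⇒> Y≰n)) q≤Y) (≤-reflexive (trans (sym (^-distribˡ-+-* 2 s s)) (cong (λ z → 2 ^ (s + z)) (sym (+-identityʳ s)))))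
        lem₁ : ∀ q a X l m D → suc q * a * X * (l * D) + a * X * (m * D) ≡ q * (a * X * (l * D)) + a * X * ((l + m) * D)
        lem₁ = solve-∀
        lem₂ : ∀ q t₁ t₂ n k p a X C b r →
          q * (t₁ * n * k * p + a * X * (C + b * r)) + (t₂ * (n * q) * k * p + a * X * (C + b * r))
            ≡ (t₁ + t₂) * n * k * (q * p) + suc q * a * X * C + a * X * (b * ((q + 1) * r))
        lem₂ = solve-∀

      -- The initial logarithm is at least (10 + P₀) units against a compensator of 9 + P₀. The
      -- surplus of one unit `Y * D` bounds `T` below by Π (q + 1) / q over the primes in (P₀, Y], a
      -- product of order s by `euler-product`. Of the s² from the last prime and from Markov's
      -- threshold one factor s then remains.
      root : ∀ n₀ .{{_ : NonZero n₀}} .{{_ : NonZero P₀}} → 2 ^ (10 + P₀) ≤ n₀ → n₀ ≤ Y → P₀ ≤ Y →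
        X ≤ 4 * Πₚ suc P₀ * (n₀ * (64 * 16 ^ j * 8)) * (T P₀ (Y ∸ P₀) n₀ * s)
      root n₀ big n₀≤Y P₀≤Y = *-cancelˡ-≤ (s * P) {{m*n≢0 s P {{s≢0}} {{Πᵣ-id≢0 P₀ r}}}} (begin
        s * P * X  ≤⟨ *-monoˡ-≤ X sP≤ ⟩
        4 * Πₚ suc P₀ * P⁺ * X  ≡⟨ *-assoc (4 * Πₚ suc P₀) P⁺ X ⟩
        4 * Πₚ suc P₀ * (P⁺ * X)  ≤⟨ *-monoʳ-≤ (4 * Πₚ suc P₀) P⁺X≤ ⟩
        4 * Πₚ suc P₀ * (t * n₀ * (κ * (8 * s)) * P) ≡⟨ lem₁ (4 * Πₚ suc P₀) t n₀ s (16 ^ j) P ⟩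
        s * P * (4 * Πₚ suc P₀ * (n₀ * (64 * 16 ^ j * 8)) * (t * s)) ∎)
        where
        open ≤-Reasoning
        r P P⁺ t : ℕ
        r  = Y ∸ P₀
        P  = Πᵣ id P₀ r
        P⁺ = Πᵣ suc P₀ r
        t  = T P₀ r n₀
        e : P₀ + r ≡ Y
        e = m+[n∸m]≡n P₀≤Y
        lem₁ : ∀ a t n s c p → a * (t * n * (64 * s * c * (8 * s)) * p) ≡ s * p * (a * (n * (64 * c * 8)) * (t * s))
        lem₁ = solve-∀
        sP≤ : s * P ≤ 4 * Πₚ suc P₀ * P⁺
        sP≤ = begin
          s * P  ≤⟨ *-monoʳ-≤ s (m≤n*m P (Πₚ id P₀) {{>-nonZero (Πₚ-id≥1 P₀)}}) ⟩
          s * (Πₚ id P₀ * P)  ≡⟨ cong (s *_) (trans (Πₚ-Πᵣ id P₀ r) (cong (Πₚ id) e)) ⟩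
          s * Πₚ id Y  ≤⟨ euler-product s Y≤Y+1 ⟩
          4 * Πₚ suc Y  ≡⟨ cong (4 *_) (sym (trans (Πₚ-Πᵣ suc P₀ r) (cong (Πₚ suc) e))) ⟩
          4 * (Πₚ suc P₀ * P⁺)  ≡⟨ *-assoc 4 (Πₚ suc P₀) P⁺ ⟨
          4 * Πₚ suc P₀ * P⁺  ∎
        l≤ : (10 + P₀) * Y ≤ ℓ n₀
        l≤ = 2^≤⇒≤lg (≤-trans (≤-reflexive (sym (^-*-assoc 2 (10 + P₀) Y))) (^-monoˡ-≤ Y big))
        P⁺X≤ : P⁺ * X ≤ t * n₀ * (κ * (8 * s)) * P
        P⁺X≤ = *-cancelʳ-≤ _ _ (Y * D) {{m*n≢0 Y D}} (+-cancelʳ-≤ (P⁺ * X * ((9 + P₀) * (Y * D))) _ _ (begin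
          P⁺ * X * (Y * D) + P⁺ * X * ((9 + P₀) * (Y * D))  ≡⟨ lem₂ (P⁺ * X) Y D P₀ ⟩
          P⁺ * X * ((10 + P₀) * Y * D)  ≤⟨ alive P₀ r n₀ ((10 + P₀) * Y) ≤-refl e (≤-trans n₀≤Y (^-monoʳ-≤ 2 (m≤n*m s 2))) l≤ ⟩
          t * n₀ * κ′ * P + P⁺ * X * compensator P₀  ≤⟨ +-monoʳ-≤ (t * n₀ * κ′ * P) (*-monoʳ-≤ (P⁺ * X) (≤-trans (+-monoʳ-≤ ((9 + P₀) * (Y * D)) (Σₚ-above-0 drift P₀)) (≤-reflexive (+-identityʳ _)))) ⟩
          t * n₀ * κ′ * P + P⁺ * X * ((9 + P₀) * (Y * D))  ≡⟨ cong (_+ P⁺ * X * ((9 + P₀) * (Y * D))) (lem₃ t n₀ Y κ s D P) ⟩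
          t * n₀ * (κ * (8 * s)) * P * (Y * D) + P⁺ * X * ((9 + P₀) * (Y * D)) ∎))
          where
          lem₂ : ∀ a Y D p → a * (Y * D) + a * ((9 + p) * (Y * D)) ≡ a * ((10 + p) * Y * D)
          lem₂ = solve-∀
          lem₃ : ∀ t n Y k s D p → t * n * (Y * (k * (8 * s * D))) * p ≡ t * n * (k * (8 * s)) * p * (Y * D)
          lem₃ = solve-∀

  -- From the tree to a set of integers

  module Conclusion (Good : ℕ → Set) (P₀ n₀ : ℕ) .{{P₀≢0 : NonZero P₀}} .{{n₀≢0 : NonZero n₀}} (seed : Good n₀)
    (seed-smooth : ∀ q → Prime q → P₀ < q → ¬ q ∣ n₀)
    (step : ∀ n q → Good n → Prime q → P₀ < q → ¬ q ∣ n → q ≤ n → Good (n * q))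
    (big : 2 ^ (10 + P₀) ≤ n₀) (n₀+P₀≤v : n₀ + P₀ ≤ v) where

    -- A common multiple of all k ≤ Y + 1; the extra 1 is there for the denominators q + 1 with q ≤
    -- Y.
    D : ℕ
    D = (Y + 1) !

    ρ-spec : ∀ k → 1 ≤ k → k ≤ Y + 1 → k * quo D k ≡ D
    ρ-spec k@(suc i) 1≤k k≤ = trans (*-comm k (D / k)) (m/n*n≡m (∣-trans (m∣m*n (i !)) (m≤n⇒m!∣n! k≤)))

    V≥ : ∀ {k} → k ≤ n₀ + P₀ → k ≤ V
    V≥ k≤ = ≤-trans (<⇒≤ (n<2^n _)) (^-monoʳ-≤ 2 (≤-trans k≤ n₀+P₀≤v))

    P₀≤V : P₀ ≤ V
    P₀≤V = V≥ (m≤n+m P₀ n₀)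

    n₀≤Y : n₀ ≤ Y
    n₀≤Y = ≤-trans (V≥ (m≤m+n n₀ P₀)) V≤Y

    P₀≤Y : P₀ ≤ Y
    P₀≤Y = ≤-trans P₀≤V V≤Y

    leaves all : List ℕ
    leaves = tree P₀ (Y ∸ P₀) n₀
    all    = concatMap complete (extendⁿ steps leaves)

    all-sound : All (λ n → 1 ≤ n × n ≤ X × Good n) all
    all-sound = All-concatMap (All.map (λ {m} → Soundness.complete-sound P₀ Good step P₀≤V m)
      (Soundness.extendⁿ-sound P₀ Good step P₀≤V steps leaves (Soundness.tree-sound P₀ Good step P₀≤V P₀ (Y ∸ P₀) n₀ ≤-refl (m+[n∸m]≡n P₀≤Y) (seed , seed-smooth))))

    all-bounded : ∀ n → occ n all ≤ multiplicity
    all-bounded n = cases (1 ≤? n) (n ≤? X)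
      where
      absent : All (_≢ n) all → occ n all ≤ multiplicity
      absent ≢ = ≤-trans (≤-reflexive (occ-absent {n} {all} ≢)) z≤n
      cases : Dec (1 ≤ n) → Dec (n ≤ X) → occ n all ≤ multiplicity
      cases (yes 1≤n) (yes n≤X) = complete-bounded (suc divisorBound ^ steps * 1) (extendⁿ steps leaves)
        (extendⁿ-bounded steps 1 leaves (λ m _ _ → tree-unique P₀ (Y ∸ P₀) n₀ seed-smooth m)) n 1≤n n≤X
      cases (no ¬1≤n) _         = absent (All.map (λ (1≤m , _) e → ¬1≤n (subst (1 ≤_) e 1≤m)) all-sound)
      cases (yes _) (no ¬n≤X)   = absent (All.map (λ (_ , m≤X , _) e → ¬n≤X (subst (_≤ X) e m≤X)) all-sound)

    s≤log : s ≤ ⌊log₂ X ⌋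
    s≤log = 2^≤⇒≤⌊log₂⌋ s Y≤X

    C : ℕ
    C = 4 * Πₚ suc P₀ * (n₀ * (64 * 16 ^ steps * 8))

    L : List ℕ
    L = deduplicate _≟_ all

    enough : 1 * X ≤ suc (density-constant P₀ n₀) * (length L * ⌊log₂ X ⌋)
    enough = begin
      1 * X  ≡⟨ *-identityˡ X ⟩
      X  ≤⟨ WithScale.TreeBound.root D {{(Y + 1) !≢0}} (quo D) ρ-spec steps 196≤steps P₀ n₀ big n₀≤Y P₀≤Y ⟩
      C * (sumL (count steps) leaves * s)  ≡⟨ cong (λ z → C * (z * s)) (length-total steps leaves) ⟨
      C * (length all * s)  ≤⟨ *-monoʳ-≤ C (*-mono-≤ (length-deduplicate multiplicity all all-bounded) s≤log) ⟩
      C * (length L * multiplicity * ⌊log₂ X ⌋)  ≡⟨ lem C (length L) multiplicity ⌊log₂ X ⌋ ⟩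
      C * multiplicity * (length L * ⌊log₂ X ⌋)  ≤⟨ m≤n+m _ (length L * ⌊log₂ X ⌋) ⟩
      suc (density-constant P₀ n₀) * (length L * ⌊log₂ X ⌋)  ∎
      where
      open ≤-Reasoning
      lem : ∀ c l m g → c * (l * m * g) ≡ c * m * (l * g)
      lem = solve-∀

    conclusion : Σ (List ℕ) λ L → Unique L × All (λ n → 1 ≤ n × n ≤ X × Good n) L × (1 * X ≤ suc (density-constant P₀ n₀) * (length L * ⌊log₂ X ⌋))
    conclusion = L , deduplicate-! all , All-deduplicate all-sound , enough

density : ∀ (Good : ℕ → Set) (P₀ n₀ : ℕ) .{{_ : NonZero P₀}} → Good n₀ →
  (∀ q → Prime q → P₀ < q → ¬ q ∣ n₀) →
  (∀ n q → Good n → Prime q → P₀ < q → ¬ q ∣ n → q ≤ n → Good (n * q)) →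
  2 ^ (10 + P₀) ≤ n₀ →
  Σ ℕ λ a → Σ ℕ λ b → Σ ℕ λ X₀ → (0 < a) × (0 < b) ×
  (∀ X → X₀ ≤ X → Σ (List ℕ) λ L → Unique L × All (λ n → 1 ≤ n × n ≤ X × Good n) L × (a * X ≤ b * (length L * ⌊log₂ X ⌋)))
density Good P₀ n₀ {{P₀≢0}} seed seed-smooth step big = 1 , suc (density-constant P₀ n₀) , 2 ^ (336 * v₀) , s≤s z≤n , s≤s z≤n , λ X X₀≤X → build X X₀≤X
  where
  v₀ : ℕ
  v₀ = n₀ + P₀ + 13
  n₀≢0 : NonZero n₀
  n₀≢0 = >-nonZero (≤-trans (>-nonZero⁻¹ (2 ^ (10 + P₀)) {{m^n≢0 2 (10 + P₀)}}) big)
  build : ∀ X → 2 ^ (336 * v₀) ≤ X → Σ (List ℕ) λ L → Unique L × All (λ n → 1 ≤ n × n ≤ X × Good n) L × (1 * X ≤ suc (density-constant P₀ n₀) * (length L * ⌊log₂ X ⌋))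
  build X X₀≤X = Construction.Conclusion.conclusion v X 13≤v low high Good P₀ n₀ {{P₀≢0}} {{n₀≢0}} seed seed-smooth step big (≤-trans (m≤m+n (n₀ + P₀) 13) v₀≤v)
    where
    g v : ℕ
    g = lg X
    -- 336 = 12 · 28 gives Y^12 ≤ X at once. For X < Y^16 = 2^(448 v) the rounding loss of 336 bits
    -- has to fit into the slack 448 v - 336 v = 112 v, which needs only v ≥ 3.
    v = g / 336
    instance
      X≢0 : NonZero X
      X≢0 = >-nonZero (≤-trans (>-nonZero⁻¹ _ {{m^n≢0 2 (336 * v₀)}}) X₀≤X)
    v₀≤v : v₀ ≤ v
    v₀≤v = ≤-trans (≤-reflexive (sym (trans (cong (_/ 336) (*-comm 336 v₀)) (m*n/n≡m v₀ 336)))) (/-monoˡ-≤ 336 (2^≤⇒≤lg {336 * v₀} X₀≤X))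
    13≤v : 13 ≤ v
    13≤v = ≤-trans (m≤n+m 13 (n₀ + P₀)) v₀≤v
    low : 2 ^ (12 * (28 * v)) ≤ X
    low = ≤-trans (^-monoʳ-≤ 2 (≤-trans (≤-reflexive (lem v)) (m/n*n≤m g 336))) (lg-lower X)
      where
      lem : ∀ v → 12 * (28 * v) ≡ v * 336
      lem = solve-∀
    high : X < 2 ^ (16 * (28 * v))
    high = <-≤-trans (lg-upper X) (^-monoʳ-≤ 2 (begin
      suc g  ≡⟨ cong suc (m≡m%n+[m/n]*n g 336) ⟩
      suc (g % 336) + v * 336 ≤⟨ +-monoˡ-≤ (v * 336) (m%n<n g 336) ⟩
      336 + v * 336  ≤⟨ +-monoˡ-≤ (v * 336) (*-monoˡ-≤ 112 {3} {v} (≤-trans (≤-trans (m≤m+n 3 10) (m≤n+m 13 (n₀ + P₀))) v₀≤v)) ⟩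
      v * 112 + v * 336  ≡⟨ lem v ⟩
      16 * (28 * v)  ∎))
      where
      open ≤-Reasoning
      lem : ∀ v → v * 112 + v * 336 ≡ 16 * (28 * v)
      lem = solve-∀

-- Seeds

prime∤⇒coprime : ∀ {q n} → Prime q → ¬ q ∣ n → Coprime q n
prime∤⇒coprime pr ¬d (i∣q , i∣n) with prime⇒irreducible pr i∣q
... | inj₁ e    = e
... | inj₂ refl = contradiction i∣n ¬d

-- This keeps the obstruction of the seed alive along the whole tree: only primes outside E are ever
-- multiplied in.
gcd-*-prime : ∀ {q E} n → Prime q → ¬ q ∣ E → gcd (n * q) E ≡ gcd n E
gcd-*-prime {q} {E} n pr ¬d = ∣-antisym
  (gcd-greatest (coprime-divisor d⊥q (subst (d ∣_) (*-comm n q) (gcd[m,n]∣m (n * q) E))) (gcd[m,n]∣n (n * q) E))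
  (gcd-greatest (∣m⇒∣m*n q (gcd[m,n]∣m n E)) (gcd[m,n]∣n n E))
  where
  d : ℕ
  d = gcd (n * q) E
  d⊥q : Coprime d q
  d⊥q (i∣d , i∣q) = prime∤⇒coprime pr ¬d (i∣q , ∣-trans i∣d (gcd[m,n]∣n (n * q) E))

gcd-^-prime : ∀ {p E} k → Prime p → ¬ p ∣ E → gcd (p ^ k) E ≡ 1
gcd-^-prime {p} {E} zero    pr ¬d = ∣1⇒≡1 (gcd[m,n]∣m 1 E)
gcd-^-prime {p} {E} (suc k) pr ¬d = trans (cong (λ z → gcd z E) (*-comm p (p ^ k))) (trans (gcd-*-prime (p ^ k) pr ¬d) (gcd-^-prime k pr ¬d))

prime∣^⇒∣ : ∀ {q p} k → Prime q → q ∣ p ^ k → q ∣ p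
prime∣^⇒∣ zero    pr d = contradiction (∣⇒≤ d) (<⇒≱ (prime>1 pr))
prime∣^⇒∣ {q} {p} (suc k) pr d = [ id , prime∣^⇒∣ k pr ]′ (euclidsLemma p (p ^ k) pr d)

Result : ℕ → Set
Result p = Σ ℕ λ a → Σ ℕ λ b → Σ ℕ λ X₀ →
  (0 < a) × (0 < b) ×
  (∀ X → X₀ ≤ X →
    Σ (List ℕ) λ L →
      Unique L ×
      All (λ n → (1 ≤ n) × (n ≤ X) × PPractical p n × ¬ LambdaPractical n) L ×
      (a * X ≤ b * (length L * ⌊log₂ X ⌋)))

module Family (p : ℕ) (pr : Prime p) (E G : ℕ)
  (not-practical : ∀ n .{{_ : NonZero n}} → gcd n E ≡ G → 4 ≤ n → ¬ LambdaPractical n) where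
  open Practicality p pr

  record Good (n : ℕ) : Set where
    constructor good
    field
      practical : Practical n
      gcd≡      : gcd n E ≡ G
      4≤n       : 4 ≤ n
  open Good

  good-* : ∀ n q → Good n → Prime q → ¬ q ∣ E → ¬ q ∣ n → q ≤ n + 2 → Good (n * q)
  good-* n q (good P e 4≤n) prq q∤E q∤n q≤ = good
    (practical-* n q {{>-nonZero (≤-trans (s≤s z≤n) 4≤n)}} (prime∤⇒coprime prq q∤n) (prime>1 prq) q≤ P)
    (trans (gcd-*-prime n prq q∤E) e)
    (≤-trans 4≤n (m≤m*n n q {{prime⇒nonZero prq}}))

  good⇒ : ∀ {n} → Good n → PPractical p n × ¬ LambdaPractical n
  good⇒ {n} g = Practical⇒PPractical (practical g) , not-practical n {{>-nonZero (≤-trans (s≤s z≤n) (4≤n g))}} (gcd≡ g) (4≤n g)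

  conclude : ∀ P₀ n₀ .{{_ : NonZero P₀}} → Good n₀ → (∀ q → Prime q → P₀ < q → ¬ q ∣ E) → (∀ q → Prime q → P₀ < q → ¬ q ∣ n₀) → 2 ^ (10 + P₀) ≤ n₀ →
    Result p
  conclude P₀ n₀ g ∤E ∤n₀ big =
    let (a , b , X₀ , a>0 , b>0 , f) = density Good P₀ n₀ g ∤n₀ (λ n q gn prq lt q∤n q≤n → good-* n q gn prq (∤E q prq lt) q∤n (≤-trans q≤n (m≤m+n n 2))) big in
    a , b , X₀ , a>0 , b>0 , λ X X₀≤X → let (L , u , gs , le) = f X X₀≤X in
      L , u , All.map (λ (1≤n , n≤X , gn) → 1≤n , n≤X , good⇒ gn) gs , le

case-large : ∀ p → Prime p → 4 ≤ p → Result p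
-- For p ≥ 5 the powers of p are coprime to 6, which rules out quadratic divisors over F_2. P₀ = p +
-- 6 lies above the prime divisors of 6 and of the seed, and the exponent 10 + P₀ makes the seed
-- large enough since p ≥ 2.
case-large p pr 4≤p = conclude (p + 6) (p ^ K) {{>-nonZero (≤-trans (s≤s z≤n) (m≤n+m 6 p))}} seed
    (λ q prq lt d → <⇒≱ lt (≤-trans (∣⇒≤ d) (m≤n+m 6 p)))
    (λ q prq lt d → <⇒≱ lt (≤-trans (∣⇒≤ {{prime⇒nonZero pr}} (prime∣^⇒∣ K prq d)) (m≤m+n p 6)))
    (^-monoˡ-≤ K (prime>1 pr))
  where
  open Family p pr 6 1 (λ n e 4≤n LP → not-2-practical n e (≤-trans (m≤m+n 2 2) 4≤n) (LP 2 prime[2]))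
  K : ℕ
  K = 10 + (p + 6)
  p∤6 : ¬ p ∣ 6
  p∤6 d = [ (λ d₂ → <⇒≱ 4≤p (≤-trans (∣⇒≤ d₂) (n≤1+n 2))) , (λ d₃ → <⇒≱ 4≤p (∣⇒≤ d₃)) ]′ (euclidsLemma 2 3 pr d)
  seed : Good (p ^ K)
  seed = good (Practicality.practical-p^ p pr K) (gcd-^-prime K pr p∤6)
    (≤-trans 4≤p (m≤m*n p (p ^ (9 + (p + 6))) {{m^n≢0 p (9 + (p + 6)) {{prime⇒nonZero pr}}}}))

case-3 : Result 3
case-3 = go 430 refl
  where
  open Family 3 prime[3] 420 3 (λ n e 4≤n LP → not-2-practical′ n e 4≤n (LP 2 prime[2]))
  go : ∀ K → K ≡ 10 + 420 → Result 3
  go K e = conclude 420 (3 ^ suc K) seed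
      (λ q prq lt d → <⇒≱ lt (∣⇒≤ d))
      (λ q prq lt d → <⇒≱ lt (≤-trans (∣⇒≤ (prime∣^⇒∣ (suc K) prq d)) (m≤m+n 3 417)))
      (≤-trans (≤-reflexive (cong (2 ^_) (sym e))) (≤-trans (^-monoˡ-≤ K (n≤1+n 2)) (m≤n*m (3 ^ K) 3)))
    where
    1≤K : 1 ≤ K
    1≤K = ≤-trans (s≤s z≤n) (≤-reflexive (sym e))
    seed : Good (3 ^ suc K)
    seed = good (Practicality.practical-p^ 3 prime[3] (suc K))
      -- 420 = 3 · 140 contains the prime 3 just once, so after removing a single 3 the remaining
      -- power of 3 is coprime to 140.
      (trans (sym (c*gcd[m,n]≡gcd[cm,cn] 3 (3 ^ K) 140)) (cong (3 *_) (gcd-^-prime K prime[3] (from-no (3 ∣? 140)))))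
      (≤-trans (n≤1+n 4 ) (≤-trans (m≤m+n 5 4) (*-monoʳ-≤ 3 (^-monoʳ-≤ 3 1≤K))))

module Two where
  open Family 2 prime[2] 312 2 (λ n e 4≤n LP → not-3-practical n e (≤-trans (n≤1+n 3) 4≤n) (LP 3 prime[3]))

  fold-ok : ℕ → List ℕ → Bool
  fold-ok n []       = true
  fold-ok n (q ∷ qs) = isYes (prime? q) ∧ (not (isYes (q ∣? 312)) ∧ (not (isYes (q ∣? n)) ∧ (isYes (q ≤? n + 2) ∧ (isYes (q ≤? 61) ∧ fold-ok (n * q) qs))))

  Smooth61 : ℕ → Set
  Smooth61 n = ∀ q → Prime q → 61 < q → ¬ q ∣ n

  fold-good : ∀ n qs → True (fold-ok n qs) → Good n → Smooth61 n → Good (foldl _*_ n qs) × Smooth61 (foldl _*_ n qs)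
  fold-good n []       t g sm = g , sm
  fold-good n (q ∷ qs) t g sm =
    let (t₁ , t) = Equivalence.to T-∧ t
        (t₂ , t) = Equivalence.to T-∧ t
        (t₃ , t) = Equivalence.to T-∧ t
        (t₄ , t) = Equivalence.to T-∧ t
        (t₅ , t) = Equivalence.to T-∧ t
        prq = toWitness {a? = prime? q} t₁
    in fold-good (n * q) qs t (good-* n q g prq (toWitnessFalse {a? = q ∣? 312} t₂) (toWitnessFalse {a? = q ∣? n} t₃) (toWitness {a? = q ≤? n + 2} t₄))
         (λ r prr lt d → sm r prr lt (prime∤⇒ prr prq (λ { refl → <⇒≱ lt (toWitness {a? = q ≤? 61} t₅) }) d))

  -- The odd primes up to 61 without 3 and 13, which divide 312, and without 7, which divides 14.
  -- The product with 14 exceeds 2^71, as required for P₀ = 61.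
  primes : List ℕ
  primes = 5 ∷ 11 ∷ 17 ∷ 19 ∷ 23 ∷ 29 ∷ 31 ∷ 37 ∷ 41 ∷ 43 ∷ 47 ∷ 53 ∷ 59 ∷ 61 ∷ []

  -- Powers of 2 do not serve as seeds: from 4 on they have more than 2 in common with 312, and from
  -- 2 the only new prime up to N + 2 is 3, a divisor of 312. The factor 7 gets past this barrier.
  start : Good 14
  start = good practical-14 refl (m≤m+n 4 10)

  seeded : Good (foldl _*_ 14 primes) × Smooth61 (foldl _*_ 14 primes)
  seeded = fold-good 14 primes tt start (λ q prq lt d → <⇒≱ lt (≤-trans (∣⇒≤ d) (m≤m+n 14 47)))

  case-2 : Result 2
  case-2 = go (foldl _*_ 14 primes) seeded (≤ᵇ⇒≤ (2 ^ 71) (foldl _*_ 14 primes) tt)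
    where
    ∤312 : ∀ q → Prime q → 61 < q → ¬ q ∣ 312
    ∤312 q prq lt d = [ (λ d → <⇒≱ lt (≤-trans (∣⇒≤ d) (m≤m+n 24 37))) , (λ d → <⇒≱ lt (≤-trans (∣⇒≤ d) (m≤m+n 13 48))) ]′ (euclidsLemma 24 13 prq d)
    go : ∀ n₀ → Good n₀ × Smooth61 n₀ → 2 ^ 71 ≤ n₀ → Result 2
    go n₀ (g , sm) big = conclude 61 n₀ g ∤312 sm big

theorem1p2 : ∀ p → Prime p →
    Σ ℕ λ a → Σ ℕ λ b → Σ ℕ λ X₀ →
    (0 < a) × (0 < b) ×
    (∀ X → X₀ ≤ X →
    Σ (List ℕ) λ L →
    Unique L ×
    All (λ n → (1 ≤ n) × (n ≤ X) × PPractical p n × ¬ LambdaPractical n) L ×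
    (a * X ≤ b * (length L * ⌊log₂ X ⌋)))
theorem1p2 zero pr = contradiction pr ¬prime[0]
theorem1p2 (suc zero) pr = contradiction pr ¬prime[1]
theorem1p2 (suc (suc zero)) pr = Two.case-2
theorem1p2 (suc (suc (suc zero))) pr = case-3
theorem1p2 p@(suc (suc (suc (suc _)))) pr = case-large p pr (s≤s (s≤s (s≤s (s≤s z≤n))))
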